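{- Let $k\ge 1$ and $n\geq 2$ be integers, let $r\in\mathbb{C}$, and let $\mathbf{P}_n=\mathrm{Circ}_r(P_{k,0},P_{k,1},\ldots,P_{k,n-1})$. Then $$\sqrt{\mathcal{S}^{(2)}_{n-1}+\frac{|r|^2-1}{n}\,\mathcal{W}^{(2)}_{n-1}}\;\leq\;\|\mathbf{P}_n\|_2\;\leq\;\max\{|r|,1\}\,\mathcal{S}^{(1)}_{n-1}.$$
   Context: For an integer $k\geq 1$, the generalized $k$-Pell-Tribonacci sequence $(P_{k,n})_{n\ge 0}$ is defined by $P_{k,0}=0$, $P_{k,1}=1$, $P_{k,2}=2k$ and $P_{k,n}=2kP_{k,n-1}+kP_{k,n-2}+P_{k,n-3}$ for $n\geq 3$. Set $\mathcal{S}^{(1)}_n=\sum_{i=0}^n P_{k,i}$, $\mathcal{S}^{(2)}_n=\sum_{i=0}^n P_{k,i}^2$, $\mathcal{W}^{(2)}_n=\sum_{i=0}^n iP_{k,i}^2$. For $n\ge 2$, $r\in\mathbb{C}$ and $a_0,\dots,a_{n-1}\in\mathbb{C}$, the $r$-circulant matrix $\mathrm{Circ}_r(a_0,\dots,a_{n-1})$ is the $n\times n$ matrix whose $(i,j)$ entry ($1\le i,j\le n$) is $a_{j-i}$ if $j\ge i$ and $r\,a_{n+j-i}$ if $j<i$. $\|A\|_2$ denotes the spectral norm of $A\in\mathbb{C}^{n\times n}$, i.e. the square root of the largest eigenvalue of $A^*A$ (the largest singular value of $A$), where $A^*$ is the conjugate transpose. -}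

module Defs where

open import Data.Nat.Base as ℕ using (ℕ; zero; suc; NonZero)
import Data.Nat.Properties as ℕ
open import Data.Integer.Base as ℤ using (ℤ; +_)
import Data.Integer.Properties as ℤ
open import Data.Rational.Base as ℚ using (ℚ; 0ℚ; 1ℚ; ½)
import Data.Rational.Properties as ℚ
import Data.Rational.Unnormalised.Base as ℚᵘ
import Data.Rational.Unnormalised.Properties as ℚᵘ
open import Data.Rational.Solver using (module +-*-Solver)
open import Data.Fin.Base using (Fin; toℕ; fromℕ<)
open import Data.Fin.Properties using (toℕ<n)
open import Data.Vec.Functional using (Vector)
open import Data.Product.Base using (Σ; ∃; _×_; _,_; proj₁; proj₂)
open import Data.Sum.Base using (inj₁; inj₂)
open import Algebra.Bundles.Raw using (RawMonoid)
import Algebra.Definitions.RawMonoid as RawMonoidOps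
open import Level using (0ℓ)
open import Relation.Nullary using (¬_; yes; no; contradiction)
open import Relation.Binary.PropositionalEquality
  using (_≡_; refl; sym; trans; cong; cong₂; subst)

open +-*-Solver using (solve; _:=_; _:+_; _:*_; _:-_; :-_)
open ℚ.≤-Reasoning

private
  p-q≤r⇒p≤q+r : ∀ {p q r} → p ℚ.- q ℚ.≤ r → p ℚ.≤ q ℚ.+ r
  p-q≤r⇒p≤q+r {p} {q} {r} h = begin
    p                   ≡⟨ solve 2 (λ p q → p := q :+ (p :- q)) refl p q ⟩
    q ℚ.+ (p ℚ.- q)     ≤⟨ ℚ.+-monoʳ-≤ q h ⟩
    q ℚ.+ r             ∎

  p≤q+r⇒p-q≤r : ∀ {p q r} → p ℚ.≤ q ℚ.+ r → p ℚ.- q ℚ.≤ r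
  p≤q+r⇒p-q≤r {p} {q} {r} h = begin
    p ℚ.- q             ≤⟨ ℚ.+-monoˡ-≤ (ℚ.- q) h ⟩
    q ℚ.+ r ℚ.- q       ≡⟨ solve 2 (λ q r → q :+ r :- q := r) refl q r ⟩
    r                   ∎

  p≤∣p∣ : ∀ p → p ℚ.≤ ℚ.∣ p ∣
  p≤∣p∣ p with ℚ.≤-total 0ℚ p
  ... | inj₁ 0≤p = ℚ.≤-reflexive (sym (ℚ.0≤p⇒∣p∣≡p 0≤p))
  ... | inj₂ p≤0 = ℚ.≤-trans p≤0 (ℚ.nonNegative⁻¹ ℚ.∣ p ∣ {{ℚ.∣-∣-nonNeg p}})

  ∣p-q∣≡∣q-p∣ : ∀ p q → ℚ.∣ p ℚ.- q ∣ ≡ ℚ.∣ q ℚ.- p ∣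
  ∣p-q∣≡∣q-p∣ p q = trans (sym (ℚ.∣-p∣≡∣p∣ (p ℚ.- q)))
    (cong ℚ.∣_∣ (solve 2 (λ p q → :- (p :- q) := q :- p) refl p q))

  ∣p-q∣≤r⇒p≤q+r : ∀ {p q r} → ℚ.∣ p ℚ.- q ∣ ℚ.≤ r → p ℚ.≤ q ℚ.+ r
  ∣p-q∣≤r⇒p≤q+r h = p-q≤r⇒p≤q+r (ℚ.≤-trans (p≤∣p∣ _) h)

  p≤q+r⇒∣p-q∣≤r : ∀ {p q r} → p ℚ.≤ q ℚ.+ r → q ℚ.≤ p ℚ.+ r → ℚ.∣ p ℚ.- q ∣ ℚ.≤ r
  p≤q+r⇒∣p-q∣≤r {p} {q} h₁ h₂ with ℚ.∣p∣≡p∨∣p∣≡-p (p ℚ.- q)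
  ... | inj₁ e = ℚ.≤-trans (ℚ.≤-reflexive e) (p≤q+r⇒p-q≤r h₁)
  ... | inj₂ e = ℚ.≤-trans
    (ℚ.≤-reflexive (trans e (solve 2 (λ p q → :- (p :- q) := q :- p) refl p q)))
    (p≤q+r⇒p-q≤r h₂)

  *-pos : ∀ {p q} → 0ℚ ℚ.< p → 0ℚ ℚ.< q → 0ℚ ℚ.< p ℚ.* q
  *-pos {p} {q} 0<p 0<q = begin-strict
    0ℚ          ≡⟨ sym (ℚ.*-zeroʳ p) ⟩
    p ℚ.* 0ℚ    <⟨ ℚ.*-monoʳ-<-pos p {{ℚ.positive 0<p}} 0<q ⟩
    p ℚ.* q     ∎

  *-mono-nonNeg : ∀ {p q r s} → 0ℚ ℚ.≤ q → 0ℚ ℚ.≤ r →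
                  p ℚ.≤ q → r ℚ.≤ s → p ℚ.* r ℚ.≤ q ℚ.* s
  *-mono-nonNeg {p} {q} {r} {s} 0≤q 0≤r p≤q r≤s = ℚ.≤-trans
    (ℚ.*-monoʳ-≤-nonNeg r {{ℚ.nonNegative 0≤r}} p≤q)
    (ℚ.*-monoˡ-≤-nonNeg q {{ℚ.nonNegative 0≤q}} r≤s)

  0≤∣p∣ : ∀ p → 0ℚ ℚ.≤ ℚ.∣ p ∣
  0≤∣p∣ p = ℚ.nonNegative⁻¹ ℚ.∣ p ∣ {{ℚ.∣-∣-nonNeg p}}

  0<½ : 0ℚ ℚ.< ½
  0<½ = ℚ.positive⁻¹ ½

  ½p+½p≡p : ∀ p → ½ ℚ.* p ℚ.+ ½ ℚ.* p ≡ p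
  ½p+½p≡p p = trans (sym (ℚ.*-distribʳ-+ p ½ ½)) (ℚ.*-identityˡ p)

  square-cancel : ∀ {p q} → 0ℚ ℚ.≤ q → p ℚ.* p ℚ.≤ q ℚ.* q → p ℚ.≤ q
  square-cancel {p} {q} 0≤q h with p ℚ.≤? q
  ... | yes p≤q = p≤q
  ... | no p≰q = contradiction (ℚ.<-≤-trans q²<p² h) (ℚ.<-irrefl refl)
    where
    q<p = ℚ.≰⇒> p≰q
    q²<p² : q ℚ.* q ℚ.< p ℚ.* p
    q²<p² = ℚ.≤-<-trans
      (ℚ.*-monoˡ-≤-nonNeg q {{ℚ.nonNegative 0≤q}} (ℚ.<⇒≤ q<p))
      (ℚ.*-monoˡ-<-pos p {{ℚ.positive (ℚ.≤-<-trans 0≤q q<p)}} q<p)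

  toℚᵘ-/ : ∀ i d → ℚ.toℚᵘ (i ℚ./ suc d) ℚᵘ.≃ ℚᵘ.mkℚᵘ i d
  toℚᵘ-/ i d = ℚ.toℚᵘ-fromℚᵘ (ℚᵘ.mkℚᵘ i d)

  /-mono : ∀ i j d e → i ℤ.* + suc e ℤ.≤ j ℤ.* + suc d →
           i ℚ./ suc d ℚ.≤ j ℚ./ suc e
  /-mono i j d e h = ℚ.toℚᵘ-cancel-≤
    (ℚᵘ.≤-respˡ-≃ (ℚᵘ.≃-sym (toℚᵘ-/ i d))
    (ℚᵘ.≤-respʳ-≃ (ℚᵘ.≃-sym (toℚᵘ-/ j e)) (ℚᵘ.*≤* h)))

  archimedean : ∀ p → 0ℚ ℚ.< p → ∀ n → ℚ.denominatorℕ p ℕ.≤ n → + 1 ℚ./ suc n ℚ.≤ p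
  archimedean p@(ℚ.mkℚ (+ zero) _ _) 0<p n _ with ℚ.positive 0<p
  ... | ()
  archimedean p@(ℚ.mkℚ (ℤ.-[1+ _ ]) _ _) 0<p n _ with ℚ.positive 0<p
  ... | ()
  archimedean p@(ℚ.mkℚ (+ suc a) d _) _ n d≤n = ℚ.toℚᵘ-cancel-≤
    (ℚᵘ.≤-respˡ-≃ (ℚᵘ.≃-sym (toℚᵘ-/ (+ 1) n)) (ℚᵘ.*≤* h))
    where
    h : + 1 ℤ.* + suc d ℤ.≤ + suc a ℤ.* + suc n
    h = ℤ.+≤+ (ℕ.≤-trans (ℕ.≤-reflexive (ℕ.*-identityˡ (suc d)))
          (ℕ.≤-trans (ℕ.m≤n⇒m≤1+n d≤n) (ℕ.m≤n*m (suc n) (suc a))))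

-- Cauchy sequences of rationals, not quotiented: equality of reals is _≈_
record ℝ : Set where
  no-eta-equality
  constructor mkℝ
  field
    seq    : ℕ → ℚ
    cauchy : ∀ ε → 0ℚ ℚ.< ε → ∃ λ N → ∀ m n → N ℕ.≤ m → N ℕ.≤ n →
             ℚ.∣ seq m ℚ.- seq n ∣ ℚ.≤ ε

open ℝ public

infix 4 _≈_ _≤_

_≈_ : ℝ → ℝ → Set
x ≈ y = ∀ ε → 0ℚ ℚ.< ε → ∃ λ N → ∀ n → N ℕ.≤ n →
        ℚ.∣ seq x n ℚ.- seq y n ∣ ℚ.≤ ε

_≤_ : ℝ → ℝ → Set
x ≤ y = ∀ ε → 0ℚ ℚ.< ε → ∃ λ N → ∀ n → N ℕ.≤ n →
        seq x n ℚ.≤ seq y n ℚ.+ ε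

OneSidedCauchy : (ℕ → ℚ) → Set
OneSidedCauchy a = ∀ ε → 0ℚ ℚ.< ε → ∃ λ N → ∀ m n → N ℕ.≤ m → N ℕ.≤ n →
                   a m ℚ.≤ a n ℚ.+ ε

abstract
  twoSided : ∀ {a} → OneSidedCauchy a →
             ∀ ε → 0ℚ ℚ.< ε → ∃ λ N → ∀ m n → N ℕ.≤ m → N ℕ.≤ n →
             ℚ.∣ a m ℚ.- a n ∣ ℚ.≤ ε
  twoSided h ε 0<ε = let N , hN = h ε 0<ε in
    N , λ m n N≤m N≤n → p≤q+r⇒∣p-q∣≤r (hN m n N≤m N≤n) (hN n m N≤n N≤m)

fromOneSided : (a : ℕ → ℚ) → OneSidedCauchy a → ℝ
fromOneSided a h = mkℝ a (twoSided h)

oneSided : ∀ x → OneSidedCauchy (seq x)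
oneSided x ε 0<ε = let N , hN = cauchy x ε 0<ε in
  N , λ m n N≤m N≤n → ∣p-q∣≤r⇒p≤q+r (hN m n N≤m N≤n)

abstract
  fromℚ-cauchy : ∀ q → OneSidedCauchy (λ _ → q)
  fromℚ-cauchy q ε 0<ε = 0 , λ _ _ _ _ →
    ℚ.≤-trans (ℚ.≤-reflexive (sym (ℚ.+-identityʳ q))) (ℚ.+-monoʳ-≤ q (ℚ.<⇒≤ 0<ε))

fromℚ : ℚ → ℝ
fromℚ q = fromOneSided (λ _ → q) (fromℚ-cauchy q)

fromℕ : ℕ → ℝ
fromℕ n = fromℚ (+ n ℚ./ 1)

0ℝ 1ℝ : ℝ
0ℝ = fromℕ 0
1ℝ = fromℕ 1

infix  8 -_
infixl 7 _*_ _/_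
infixl 6 _+_ _-_ _⊔_

abstract
  +-cauchy : ∀ x y → OneSidedCauchy (λ n → seq x n ℚ.+ seq y n)
  +-cauchy x y ε 0<ε =
    let 0<½ε = *-pos 0<½ 0<ε
        M , hM = oneSided x (½ ℚ.* ε) 0<½ε
        N , hN = oneSided y (½ ℚ.* ε) 0<½ε
    in M ℕ.⊔ N , λ m n h₁ h₂ → begin
      seq x m ℚ.+ seq y m
        ≤⟨ ℚ.+-mono-≤ (hM m n (ℕ.m⊔n≤o⇒m≤o M N h₁) (ℕ.m⊔n≤o⇒m≤o M N h₂))
                      (hN m n (ℕ.m⊔n≤o⇒n≤o M N h₁) (ℕ.m⊔n≤o⇒n≤o M N h₂)) ⟩
      (seq x n ℚ.+ ½ ℚ.* ε) ℚ.+ (seq y n ℚ.+ ½ ℚ.* ε)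
        ≡⟨ solve 3 (λ a b c → (a :+ c) :+ (b :+ c) := (a :+ b) :+ (c :+ c)) refl
             (seq x n) (seq y n) (½ ℚ.* ε) ⟩
      (seq x n ℚ.+ seq y n) ℚ.+ (½ ℚ.* ε ℚ.+ ½ ℚ.* ε)
        ≡⟨ cong ((seq x n ℚ.+ seq y n) ℚ.+_) (½p+½p≡p ε) ⟩
      (seq x n ℚ.+ seq y n) ℚ.+ ε ∎

_+_ : ℝ → ℝ → ℝ
x + y = fromOneSided (λ n → seq x n ℚ.+ seq y n) (+-cauchy x y)

abstract
  neg-cauchy : ∀ x → OneSidedCauchy (λ n → ℚ.- seq x n)
  neg-cauchy x ε 0<ε =
    let N , hN = oneSided x ε 0<ε
    in N , λ m n h₁ h₂ → begin
      ℚ.- seq x m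
        ≡⟨ solve 2 (λ a e → :- a := :- (a :+ e) :+ e) refl (seq x m) ε ⟩
      ℚ.- (seq x m ℚ.+ ε) ℚ.+ ε
        ≤⟨ ℚ.+-monoˡ-≤ ε (ℚ.neg-antimono-≤ (hN n m h₂ h₁)) ⟩
      ℚ.- seq x n ℚ.+ ε ∎

-_ : ℝ → ℝ
- x = fromOneSided (λ n → ℚ.- seq x n) (neg-cauchy x)

_-_ : ℝ → ℝ → ℝ
x - y = x + (- y)

private
  bounded : ∀ x → ∃ λ K → 0ℚ ℚ.< K × ∃ λ N → ∀ n → N ℕ.≤ n → ℚ.∣ seq x n ∣ ℚ.≤ K
  bounded x with cauchy x 1ℚ (ℚ.positive⁻¹ 1ℚ)
  ... | N , hN = ℚ.∣ seq x N ∣ ℚ.+ 1ℚ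
    , ℚ.+-mono-≤-< (0≤∣p∣ (seq x N)) (ℚ.positive⁻¹ 1ℚ)
    , N , λ n N≤n → begin
        ℚ.∣ seq x n ∣
          ≡⟨ cong ℚ.∣_∣ (solve 2 (λ a b → a := b :+ (a :- b)) refl (seq x n) (seq x N)) ⟩
        ℚ.∣ seq x N ℚ.+ (seq x n ℚ.- seq x N) ∣
          ≤⟨ ℚ.∣p+q∣≤∣p∣+∣q∣ (seq x N) (seq x n ℚ.- seq x N) ⟩
        ℚ.∣ seq x N ∣ ℚ.+ ℚ.∣ seq x n ℚ.- seq x N ∣
          ≤⟨ ℚ.+-monoʳ-≤ ℚ.∣ seq x N ∣ (hN n N N≤n ℕ.≤-refl) ⟩
        ℚ.∣ seq x N ∣ ℚ.+ 1ℚ ∎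

abstract
  *-cauchy : ∀ x y ε → 0ℚ ℚ.< ε → ∃ λ N → ∀ m n → N ℕ.≤ m → N ℕ.≤ n →
    ℚ.∣ seq x m ℚ.* seq y m ℚ.- seq x n ℚ.* seq y n ∣ ℚ.≤ ε
  *-cauchy x y ε 0<ε = let
      K , 0<K , M₁ , hK = bounded x
      L , 0<L , M₂ , hL = bounded y
      B = K ℚ.+ L
      0<B = ℚ.+-mono-< 0<K 0<L
      instance
        B-pos : ℚ.Positive B
        B-pos = ℚ.positive 0<B
        B≢0 : ℚ.NonZero B
        B≢0 = ℚ.pos⇒nonZero B
      δ = ℚ.1/ B ℚ.* ε
      0<δ = *-pos (ℚ.positive⁻¹ (ℚ.1/ B) {{ℚ.1/pos⇒pos B}}) 0<ε
      M₃ , hx = cauchy x δ 0<δ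
      M₄ , hy = cauchy y δ 0<δ
    in (M₁ ℕ.⊔ M₂) ℕ.⊔ (M₃ ℕ.⊔ M₄) , λ m n h₁ h₂ → let
      h₁₂ : ∀ {o} → (M₁ ℕ.⊔ M₂) ℕ.⊔ (M₃ ℕ.⊔ M₄) ℕ.≤ o → M₁ ℕ.⊔ M₂ ℕ.≤ o
      h₁₂ = ℕ.m⊔n≤o⇒m≤o (M₁ ℕ.⊔ M₂) (M₃ ℕ.⊔ M₄)
      h₃₄ : ∀ {o} → (M₁ ℕ.⊔ M₂) ℕ.⊔ (M₃ ℕ.⊔ M₄) ℕ.≤ o → M₃ ℕ.⊔ M₄ ℕ.≤ o
      h₃₄ = ℕ.m⊔n≤o⇒n≤o (M₁ ℕ.⊔ M₂) (M₃ ℕ.⊔ M₄)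
      a = seq x m ; b = seq y m ; c = seq x n ; d = seq y n
    in begin
      ℚ.∣ a ℚ.* b ℚ.- c ℚ.* d ∣
        ≡⟨ cong ℚ.∣_∣ (solve 4 (λ a b c d →
             a :* b :- c :* d := a :* (b :- d) :+ d :* (a :- c)) refl a b c d) ⟩
      ℚ.∣ a ℚ.* (b ℚ.- d) ℚ.+ d ℚ.* (a ℚ.- c) ∣
        ≤⟨ ℚ.∣p+q∣≤∣p∣+∣q∣ (a ℚ.* (b ℚ.- d)) (d ℚ.* (a ℚ.- c)) ⟩
      ℚ.∣ a ℚ.* (b ℚ.- d) ∣ ℚ.+ ℚ.∣ d ℚ.* (a ℚ.- c) ∣
        ≡⟨ cong₂ ℚ._+_ (ℚ.∣p*q∣≡∣p∣*∣q∣ a (b ℚ.- d)) (ℚ.∣p*q∣≡∣p∣*∣q∣ d (a ℚ.- c)) ⟩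
      ℚ.∣ a ∣ ℚ.* ℚ.∣ b ℚ.- d ∣ ℚ.+ ℚ.∣ d ∣ ℚ.* ℚ.∣ a ℚ.- c ∣
        ≤⟨ ℚ.+-mono-≤
             (*-mono-nonNeg (ℚ.<⇒≤ 0<K) (0≤∣p∣ _)
               (hK m (ℕ.m⊔n≤o⇒m≤o M₁ M₂ (h₁₂ h₁)))
               (hy m n (ℕ.m⊔n≤o⇒n≤o M₃ M₄ (h₃₄ h₁)) (ℕ.m⊔n≤o⇒n≤o M₃ M₄ (h₃₄ h₂))))
             (*-mono-nonNeg (ℚ.<⇒≤ 0<L) (0≤∣p∣ _)
               (hL n (ℕ.m⊔n≤o⇒n≤o M₁ M₂ (h₁₂ h₂)))
               (hx m n (ℕ.m⊔n≤o⇒m≤o M₃ M₄ (h₃₄ h₁)) (ℕ.m⊔n≤o⇒m≤o M₃ M₄ (h₃₄ h₂)))) ⟩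
      K ℚ.* δ ℚ.+ L ℚ.* δ
        ≡⟨ solve 4 (λ K L i e → K :* (i :* e) :+ L :* (i :* e) := ((K :+ L) :* i) :* e) refl
             K L (ℚ.1/ B) ε ⟩
      (B ℚ.* ℚ.1/ B) ℚ.* ε
        ≡⟨ cong (ℚ._* ε) (ℚ.*-inverseʳ B) ⟩
      1ℚ ℚ.* ε
        ≡⟨ ℚ.*-identityˡ ε ⟩
      ε ∎

_*_ : ℝ → ℝ → ℝ
x * y = mkℝ (λ n → seq x n ℚ.* seq y n) (*-cauchy x y)

_/_ : ℝ → (n : ℕ) → .{{NonZero n}} → ℝ
x / n = x * fromℚ (+ 1 ℚ./ n)

private
  ⊔-shift : ∀ a b c d ε → a ℚ.≤ c ℚ.+ ε → b ℚ.≤ d ℚ.+ ε → a ℚ.⊔ b ℚ.≤ (c ℚ.⊔ d) ℚ.+ ε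
  ⊔-shift a b c d ε h₁ h₂ = ℚ.⊔-lub
    (ℚ.≤-trans h₁ (ℚ.+-monoˡ-≤ ε (ℚ.p≤p⊔q c d)))
    (ℚ.≤-trans h₂ (ℚ.+-monoˡ-≤ ε (ℚ.p≤q⊔p c d)))

abstract
  ⊔-cauchy : ∀ x y → OneSidedCauchy (λ n → seq x n ℚ.⊔ seq y n)
  ⊔-cauchy x y ε 0<ε =
    let M , hM = oneSided x ε 0<ε
        N , hN = oneSided y ε 0<ε
    in M ℕ.⊔ N , λ m n h₁ h₂ → ⊔-shift (seq x m) (seq y m) (seq x n) (seq y n) ε
      (hM m n (ℕ.m⊔n≤o⇒m≤o M N h₁) (ℕ.m⊔n≤o⇒m≤o M N h₂))
      (hN m n (ℕ.m⊔n≤o⇒n≤o M N h₁) (ℕ.m⊔n≤o⇒n≤o M N h₂))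

_⊔_ : ℝ → ℝ → ℝ
x ⊔ y = fromOneSided (λ n → seq x n ℚ.⊔ seq y n) (⊔-cauchy x y)

-- The largest j / N with j ≤ b whose square is at most q (0 if there is none)
gridRoot : ℚ → (N : ℕ) → .{{NonZero N}} → ℕ → ℚ
gridRoot q N zero    = 0ℚ
gridRoot q N (suc b) with (+ suc b ℚ./ N) ℚ.* (+ suc b ℚ./ N) ℚ.≤? q
... | yes _ = + suc b ℚ./ N
... | no  _ = gridRoot q N b

-- For q ≥ 0: the largest multiple of 1 / N whose square is at most q.  The grid
-- is searched up to 1 + ∣ ↥ q ∣, which exceeds √ q.
ratRoot : ℚ → (N : ℕ) → .{{NonZero N}} → ℚ
ratRoot q N = gridRoot q N (N ℕ.* suc ℤ.∣ ℚ.↥ q ∣)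

private
  0≤/ : ∀ j d → 0ℚ ℚ.≤ + j ℚ./ suc d
  0≤/ j d = ℚ.nonNegative⁻¹ (+ j ℚ./ suc d) {{ℚ.normalize-nonNeg j (suc d)}}

  suc-/ : ∀ j d → + suc j ℚ./ suc d ≡ (+ j ℚ./ suc d) ℚ.+ (+ 1 ℚ./ suc d)
  suc-/ j d = ℚ.toℚᵘ-injective
    (ℚᵘ.≃-trans (toℚᵘ-/ (+ suc j) d)
    (ℚᵘ.≃-trans (ℚᵘ.*≡* eq)
    (ℚᵘ.≃-sym (ℚᵘ.≃-trans (ℚ.toℚᵘ-homo-+ (+ j ℚ./ suc d) (+ 1 ℚ./ suc d))
                          (ℚᵘ.+-cong (toℚᵘ-/ (+ j) d) (toℚᵘ-/ (+ 1) d))))))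
    where
    D = + suc d
    eq : + suc j ℤ.* (D ℤ.* D) ≡ (+ j ℤ.* D ℤ.+ + 1 ℤ.* D) ℤ.* D
    eq = trans (sym (ℤ.*-assoc (+ suc j) D D))
      (cong (ℤ._* D) (trans (cong (λ i → + i ℤ.* D) (ℕ.+-comm 1 j))
        (ℤ.*-distribʳ-+ D (+ j) (+ 1))))

  gridRoot-nonNeg : ∀ q d b → 0ℚ ℚ.≤ gridRoot q (suc d) b
  gridRoot-nonNeg q d zero    = ℚ.≤-refl
  gridRoot-nonNeg q d (suc b)
    with (+ suc b ℚ./ suc d) ℚ.* (+ suc b ℚ./ suc d) ℚ.≤? q
  ... | yes _ = 0≤/ (suc b) d
  ... | no  _ = gridRoot-nonNeg q d b

  gridRoot-lower : ∀ q d b → 0ℚ ℚ.≤ q →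
                   gridRoot q (suc d) b ℚ.* gridRoot q (suc d) b ℚ.≤ q
  gridRoot-lower q d zero    0≤q = 0≤q
  gridRoot-lower q d (suc b) 0≤q
    with (+ suc b ℚ./ suc d) ℚ.* (+ suc b ℚ./ suc d) ℚ.≤? q
  ... | yes h = h
  ... | no  _ = gridRoot-lower q d b 0≤q

  gridRoot-upper : ∀ q d b → q ℚ.≤ (+ suc b ℚ./ suc d) ℚ.* (+ suc b ℚ./ suc d) →
    q ℚ.≤ (gridRoot q (suc d) b ℚ.+ + 1 ℚ./ suc d) ℚ.* (gridRoot q (suc d) b ℚ.+ + 1 ℚ./ suc d)
  gridRoot-upper q d zero    h =
    subst (λ s → q ℚ.≤ s ℚ.* s) (sym (ℚ.+-identityˡ (+ 1 ℚ./ suc d))) h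
  gridRoot-upper q d (suc b) h
    with (+ suc b ℚ./ suc d) ℚ.* (+ suc b ℚ./ suc d) ℚ.≤? q
  ... | yes _ = subst (λ s → q ℚ.≤ s ℚ.* s) (suc-/ (suc b) d) h
  ... | no ≰q = gridRoot-upper q d b (ℚ.<⇒≤ (ℚ.≰⇒> ≰q))

  i≤∣i∣ : ∀ i → i ℤ.≤ + ℤ.∣ i ∣
  i≤∣i∣ (+ n)        = ℤ.≤-refl
  i≤∣i∣ (ℤ.-[1+ n ]) = ℤ.-≤+

  grid-bound : ∀ q d → let b = suc d ℕ.* suc ℤ.∣ ℚ.↥ q ∣ in
    q ℚ.≤ (+ suc b ℚ./ suc d) ℚ.* (+ suc b ℚ./ suc d)
  grid-bound q@(ℚ.mkℚ i e _) d = ℚ.≤-trans q≤t (begin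
      t           ≡⟨ sym (ℚ.*-identityʳ t) ⟩
      t ℚ.* 1ℚ    ≤⟨ *-mono-nonNeg 0≤t (ℚ.<⇒≤ (ℚ.positive⁻¹ 1ℚ)) ℚ.≤-refl 1≤t ⟩
      t ℚ.* t     ∎)
    where
    A = ℤ.∣ i ∣
    b = suc d ℕ.* suc A
    t = + suc b ℚ./ suc d
    0≤t : 0ℚ ℚ.≤ t
    0≤t = 0≤/ (suc b) d
    1≤t : 1ℚ ℚ.≤ t
    1≤t = /-mono (+ 1) (+ suc b) 0 d (ℤ.+≤+ (ℕ.≤-trans
      (ℕ.≤-reflexive (ℕ.*-identityˡ (suc d)))
      (ℕ.≤-trans (ℕ.m≤m*n (suc d) (suc A))
      (ℕ.≤-trans (ℕ.n≤1+n b) (ℕ.≤-reflexive (sym (ℕ.*-identityʳ (suc b))))))))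
    i≤A : i ℤ.≤ + A
    i≤A = i≤∣i∣ i
    h : i ℤ.* + suc d ℤ.≤ + suc b ℤ.* + suc e
    h = ℤ.≤-trans (ℤ.*-monoʳ-≤-nonNeg (+ suc d) i≤A)
      (ℤ.≤-trans (ℤ.≤-reflexive (sym (ℤ.pos-* A (suc d))))
      (ℤ.+≤+ (ℕ.≤-trans
        (ℕ.≤-trans (ℕ.≤-reflexive (ℕ.*-comm A (suc d)))
          (ℕ.≤-trans (ℕ.*-monoʳ-≤ (suc d) (ℕ.n≤1+n A)) (ℕ.n≤1+n b)))
        (ℕ.m≤m*n (suc b) (suc e)))))
    q≤t : q ℚ.≤ t
    q≤t = ℚ.toℚᵘ-cancel-≤
      (ℚᵘ.≤-respʳ-≃ (ℚᵘ.≃-sym (toℚᵘ-/ (+ suc b) d)) (ℚᵘ.*≤* h))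

ratRoot-nonNeg : ∀ q d → 0ℚ ℚ.≤ ratRoot q (suc d)
ratRoot-nonNeg q d = gridRoot-nonNeg q d (suc d ℕ.* suc ℤ.∣ ℚ.↥ q ∣)

ratRoot-lower : ∀ q d → 0ℚ ℚ.≤ q → ratRoot q (suc d) ℚ.* ratRoot q (suc d) ℚ.≤ q
ratRoot-lower q d = gridRoot-lower q d (suc d ℕ.* suc ℤ.∣ ℚ.↥ q ∣)

ratRoot-upper : ∀ q d →
  q ℚ.≤ (ratRoot q (suc d) ℚ.+ + 1 ℚ./ suc d) ℚ.* (ratRoot q (suc d) ℚ.+ + 1 ℚ./ suc d)
ratRoot-upper q d = gridRoot-upper q d (suc d ℕ.* suc ℤ.∣ ℚ.↥ q ∣) (grid-bound q d)

root : ℝ → ℕ → ℚ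
root x n = ratRoot (seq x n ℚ.⊔ 0ℚ) (suc n)

abstract
  root-cauchy : ∀ x → OneSidedCauchy (root x)
  root-cauchy x ε 0<ε = let
      δ = ½ ℚ.* ε
      0<δ = *-pos 0<½ 0<ε
      0≤δ = ℚ.<⇒≤ 0<δ
      0<δ² = *-pos 0<δ 0<δ
      N , hN = oneSided x (δ ℚ.* δ) 0<δ²
      D = ℚ.denominatorℕ δ
    in N ℕ.⊔ D , λ m n h₁ h₂ → let
      s = root x n
      0≤s = ratRoot-nonNeg (sq n) n
      u = + 1 ℚ./ suc n
      u≤δ = archimedean δ 0<δ n (ℕ.m⊔n≤o⇒n≤o N D h₂)
      s+u≤s+δ = ℚ.+-monoʳ-≤ s u≤δ
      0≤s+u = ℚ.+-mono-≤ 0≤s (0≤/ 1 n)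
      0≤s+δ = ℚ.+-mono-≤ 0≤s 0≤δ
    in square-cancel (ℚ.+-mono-≤ 0≤s (ℚ.<⇒≤ 0<ε)) (begin
      root x m ℚ.* root x m
        ≤⟨ ratRoot-lower (sq m) m (ℚ.p≤q⊔p (seq x m) 0ℚ) ⟩
      sq m
        ≤⟨ ⊔-shift (seq x m) 0ℚ (seq x n) 0ℚ (δ ℚ.* δ)
             (hN m n (ℕ.m⊔n≤o⇒m≤o N D h₁) (ℕ.m⊔n≤o⇒m≤o N D h₂))
             (ℚ.+-mono-≤ (ℚ.≤-refl {0ℚ}) (ℚ.<⇒≤ 0<δ²)) ⟩
      sq n ℚ.+ δ ℚ.* δ
        ≤⟨ ℚ.+-monoˡ-≤ (δ ℚ.* δ) (ratRoot-upper (sq n) n) ⟩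
      (s ℚ.+ u) ℚ.* (s ℚ.+ u) ℚ.+ δ ℚ.* δ
        ≤⟨ ℚ.+-monoˡ-≤ (δ ℚ.* δ) (*-mono-nonNeg 0≤s+δ 0≤s+u s+u≤s+δ s+u≤s+δ) ⟩
      (s ℚ.+ δ) ℚ.* (s ℚ.+ δ) ℚ.+ δ ℚ.* δ
        ≡⟨ sym (ℚ.+-identityʳ _) ⟩
      (s ℚ.+ δ) ℚ.* (s ℚ.+ δ) ℚ.+ δ ℚ.* δ ℚ.+ 0ℚ
        ≤⟨ ℚ.+-monoʳ-≤ ((s ℚ.+ δ) ℚ.* (s ℚ.+ δ) ℚ.+ δ ℚ.* δ)
             (ℚ.+-mono-≤ (0≤* 0≤δ 0≤s+δ) (0≤* 0≤δ 0≤s+δ)) ⟩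
      (s ℚ.+ δ) ℚ.* (s ℚ.+ δ) ℚ.+ δ ℚ.* δ ℚ.+ (δ ℚ.* (s ℚ.+ δ) ℚ.+ δ ℚ.* (s ℚ.+ δ))
        ≡⟨ solve 2 (λ s d → (s :+ d) :* (s :+ d) :+ d :* d :+ (d :* (s :+ d) :+ d :* (s :+ d))
             := (s :+ (d :+ d)) :* (s :+ (d :+ d))) refl s δ ⟩
      (s ℚ.+ (δ ℚ.+ δ)) ℚ.* (s ℚ.+ (δ ℚ.+ δ))
        ≡⟨ cong (λ e → (s ℚ.+ e) ℚ.* (s ℚ.+ e)) (½p+½p≡p ε) ⟩
      (s ℚ.+ ε) ℚ.* (s ℚ.+ ε) ∎)
    where
    sq : ℕ → ℚ
    sq n = seq x n ℚ.⊔ 0ℚ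
    0≤* : ∀ {p q} → 0ℚ ℚ.≤ p → 0ℚ ℚ.≤ q → 0ℚ ℚ.≤ p ℚ.* q
    0≤* {p} {q} 0≤p 0≤q = ℚ.≤-trans (ℚ.≤-reflexive (sym (ℚ.*-zeroʳ p)))
      (ℚ.*-monoˡ-≤-nonNeg p {{ℚ.nonNegative 0≤p}} 0≤q)

-- Total: negative arguments are replaced by 0
√_ : ℝ → ℝ
√ x = fromOneSided (root x) (root-cauchy x)

infix 8 √_

record ℂ : Set where
  no-eta-equality
  constructor _+i_
  field
    re im : ℝ

open ℂ public

infix 5 _+i_
infix 4 _≈ᶜ_
infixl 7 _*ᶜ_
infixl 6 _+ᶜ_

_≈ᶜ_ : ℂ → ℂ → Set
z ≈ᶜ w = re z ≈ re w × im z ≈ im w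

fromℝ : ℝ → ℂ
fromℝ x = x +i 0ℝ

0ᶜ : ℂ
0ᶜ = fromℝ 0ℝ

_+ᶜ_ : ℂ → ℂ → ℂ
z +ᶜ w = (re z + re w) +i (im z + im w)

_*ᶜ_ : ℂ → ℂ → ℂ
z *ᶜ w = (re z * re w - im z * im w) +i (re z * im w + im z * re w)

conj : ℂ → ℂ
conj z = re z +i (- im z)

∣_∣ : ℂ → ℝ
∣ z ∣ = √ (re z * re z + im z * im z)

+ᶜ-rawMonoid : RawMonoid 0ℓ 0ℓ
+ᶜ-rawMonoid = record { Carrier = ℂ ; _≈_ = _≈ᶜ_ ; _∙_ = _+ᶜ_ ; ε = 0ᶜ }

sumᶜ : ∀ {n} → Vector ℂ n → ℂ
sumᶜ = RawMonoidOps.sum +ᶜ-rawMonoid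

Matrix : ℕ → Set
Matrix n = Fin n → Fin n → ℂ

_*ᵐ_ : ∀ {n} → Matrix n → Matrix n → Matrix n
(A *ᵐ B) i j = sumᶜ (λ l → A i l *ᶜ B l j)

_*ᵛ_ : ∀ {n} → Matrix n → Vector ℂ n → Vector ℂ n
(A *ᵛ v) i = sumᶜ (λ l → A i l *ᶜ v l)

infixl 7 _*ᵐ_ _*ᵛ_

conjTranspose : ∀ {n} → Matrix n → Matrix n
conjTranspose A i j = conj (A j i)

-- An eigenvector need not be computable from the matrix, so its existence is
-- asserted classically (¬ ¬); with a plain Σ the largest eigenvalue of a
-- Hermitian matrix could not be shown to exist constructively.
IsEigenvalue : ∀ {n} → Matrix n → ℂ → Set
IsEigenvalue {n} A μ = ¬ ¬ Σ (Vector ℂ n) λ v →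
  ¬ (∀ i → v i ≈ᶜ 0ᶜ) × (∀ i → (A *ᵛ v) i ≈ᶜ μ *ᶜ v i)

-- Meant for matrices with real spectrum, such as conjTranspose A *ᵐ A
IsLargestEigenvalue : ∀ {n} → Matrix n → ℝ → Set
IsLargestEigenvalue A μ = IsEigenvalue A (fromℝ μ) ×
  (∀ ν → IsEigenvalue A (fromℝ ν) → ν ≤ μ)

-- A relation rather than a function ‖_‖₂; σ is determined up to _≈_
IsSpectralNorm : ∀ {n} → Matrix n → ℝ → Set
IsSpectralNorm A σ = Σ ℝ λ μ → IsLargestEigenvalue (conjTranspose A *ᵐ A) μ × σ ≈ √ μ

private
  wrap : ∀ {n} (i j : Fin n) → ¬ (toℕ i ℕ.≤ toℕ j) → n ℕ.+ toℕ j ℕ.∸ toℕ i ℕ.< n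
  wrap {n} i j i≰j = ℕ.≤-trans
    (ℕ.∸-monoˡ-< (ℕ.+-monoʳ-< n (ℕ.≰⇒> i≰j)) (ℕ.≤-trans (ℕ.<⇒≤ (toℕ<n i)) (ℕ.m≤m+n n (toℕ j))))
    (ℕ.≤-reflexive (ℕ.m+n∸n≡m n (toℕ i)))

circ : ∀ {n} → ℂ → Vector ℂ n → Matrix n
circ r a i j with toℕ i ℕ.≤? toℕ j
... | yes _   = a (fromℕ< (ℕ.≤-<-trans (ℕ.m∸n≤m (toℕ j) (toℕ i)) (toℕ<n j)))
... | no  i≰j = r *ᶜ a (fromℕ< (wrap i j i≰j))

P : ℕ → ℕ → ℕ
P k 0 = 0
P k 1 = 1
P k 2 = 2 ℕ.* k
P k (suc (suc (suc n))) =
  2 ℕ.* k ℕ.* P k (suc (suc n)) ℕ.+ k ℕ.* P k (suc n) ℕ.+ P k n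

∑≤ : ℕ → (ℕ → ℕ) → ℕ
∑≤ zero    f = f zero
∑≤ (suc m) f = ∑≤ m f ℕ.+ f (suc m)

S¹ S² W² : ℕ → ℕ → ℕ
S¹ k m = ∑≤ m λ i → P k i
S² k m = ∑≤ m λ i → P k i ℕ.^ 2
W² k m = ∑≤ m λ i → i ℕ.* P k i ℕ.^ 2

pellCirc : ℕ → (n : ℕ) → ℂ → Matrix n
pellCirc k n r = circ r (λ i → fromℝ (fromℕ (P k (toℕ i))))

{-# OPTIONS --safe #-}
-- The upper bound is Schur's test: the moduli of the entries of A are at most
-- max(|r|, 1) times weights whose rows and columns each sum to S¹, so A*A v = μ v gives
-- μ ‖v‖² = ‖A v‖² ≤ (max(|r|, 1) S¹)² ‖v‖².
--
-- For the lower bound, n S² + (|r|² - 1) W² is the squared Frobenius norm of A,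
-- i.e. the trace of A*A, and A*A has an eigenvalue x that is at least trace / n.
-- Constructively x has to be given as a limit.  Let H be A*A as a real symmetric
-- matrix of size d = 2n, and t l = trace (H ^ l).  Then t (2l) ≤ t l ² ≤ d t (2l),
-- so for l = 2 ^ j the numbers (t l) ^ (1/l) decrease and (t l / d) ^ (1/l)
-- increase, to a common limit x ≥ trace H / d.  Gaussian elimination, whose case
-- distinctions hold up to double negation, yields an eigenvector for x or an
-- inverse C of x - H.  The latter is impossible: trace (C (H/x) ^ l) is bounded
-- along l = 2 ^ j, but its decrements t l / x ^ (l + 1) are nonnegative, and at
-- least 1/x at each such l.
module Submission where

import Algebra.Definitions.RawMonoid as RawMonoidOps
import Algebra.Properties.Monoid.Mult
import Algebra.Properties.Monoid.Sum
import Algebra.Properties.Ring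
import Algebra.Properties.Semiring.Exp
import Algebra.Properties.Semiring.Sum
import Algebra.Solver.Ring
open import Algebra.Bundles using (CommutativeRing; Monoid)
open import Algebra.Solver.Ring.AlmostCommutativeRing
  using (fromCommutativeRing; Induced-equivalence; _-Raw-AlmostCommutative⟶_)
open import Data.Fin.Base using (Fin; zero; suc; toℕ; splitAt; join; _↑ˡ_; _↑ʳ_)
import Data.Fin.Permutation as Perm
import Data.Fin.Properties as Fin
open import Data.Integer.Base as ℤ using (+_)
import Data.Integer.Properties as ℤ
open import Data.Maybe.Base as Maybe using (Maybe)
open import Data.Nat.Base as ℕ using (ℕ; zero; suc; NonZero; _∸_)
import Data.Nat.Properties as ℕ
import Data.Nat.Solver
open import Data.Product.Base using (∃; _×_; _,_; proj₁; proj₂)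
open import Data.Rational.Base as ℚ using (ℚ; 0ℚ; 1ℚ; ½)
import Data.Rational.Properties as ℚ
open import Data.Rational.Solver using (module +-*-Solver)
import Data.Rational.Unnormalised.Base as ℚᵘ
import Data.Rational.Unnormalised.Properties as ℚᵘ
open import Data.Sum.Base using (_⊎_; inj₁; inj₂; [_,_]′)
open import Data.Vec.Functional using (Vector; _∷_)
open import Function.Base using (_∘_)
open import Level using (0ℓ)
open import Relation.Nullary using (¬_; yes; no; contradiction)
open import Relation.Nullary.Decidable using (dec⇒maybe)
import Relation.Binary.PropositionalEquality as ≡
import Relation.Binary.Reasoning.Setoid as SetoidReasoning
import Defs

open ≡ using (_≡_)

-- The norm enters only through a number `μ` that has an eigenvector and bounds all real
-- eigenvalues. A lower bound for `μ` therefore needs an actual real number `x` to which maximality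
-- can be applied: the eigenvector of `x` may be double-negated, but `x` itself may not. This rules
-- out choosing `x` by case distinctions, and it is why `x` is squeezed between two explicit
-- sequences. Traces of powers are polynomials in the entries, and the two sequences differ by a
-- factor N^(1/2^j) ≤ 1 + N/2^j, where N is the size of the real matrix, so the limit comes with a
-- rate of convergence. Passing to real matrices doubles both the size and the trace, hence leaves
-- their quotient unchanged.
--
-- For the upper bound, the weights are the entries with the factor r removed: they form an ordinary
-- circulant, each of whose rows and columns is a rearrangement of P_0, ..., P_(n-1).

module CirculantIndex where
  open Data.Nat.Solver.+-*-Solver using (solve; con; _:+_; _:=_)

  regroup : ∀ j i e → suc j ℕ.+ (suc i ℕ.+ e) ℕ.+ j ≡ (suc j ℕ.+ i) ℕ.+ (suc j ℕ.+ e)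
  regroup = solve 3
    (λ j i e → (con 1 :+ j) :+ ((con 1 :+ i) :+ e) :+ j := ((con 1 :+ j) :+ i) :+ ((con 1 :+ j) :+ e))
    ≡.refl

-- Case distinctions between real numbers are available only up to double
-- negation, which ≤-stable removes from inequalities.
record CompleteOrderedField : Set₁ where
  field
    commutativeRing : CommutativeRing 0ℓ 0ℓ

  open CommutativeRing commutativeRing public hiding (zero; _≉_)
  open RawMonoidOps +-rawMonoid public using () renaming (_×_ to _ℕ×_)

  infix 4 _≤_
  infix 8 √_
  field
    _≤_             : Carrier → Carrier → Set
    √_              : Carrier → Carrier
    unitFraction    : ℕ → Carrier
    fromℚ-morphism  : ℚ.+-*-rawRing -Raw-AlmostCommutative⟶ fromCommutativeRing commutativeRing
    ≤-reflexive     : ∀ {x y} → x ≈ y → x ≤ y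
    ≤-trans         : ∀ {x y z} → x ≤ y → y ≤ z → x ≤ z
    ≤-antisym       : ∀ {x y} → x ≤ y → y ≤ x → x ≈ y
    ≤-stable        : ∀ {x y} → ¬ ¬ x ≤ y → x ≤ y
    ≤-total         : ∀ x y → ¬ ¬ (x ≤ y ⊎ y ≤ x)
    1≰0             : ¬ 1# ≤ 0#
    +-monoʳ-≤       : ∀ x {y z} → y ≤ z → x + y ≤ x + z
    0≤x*y           : ∀ {x y} → 0# ≤ x → 0# ≤ y → 0# ≤ x * y
    zero-or-inverse : ∀ x → ¬ ¬ (x ≈ 0# ⊎ ∃ λ y → x * y ≈ 1#)
    0≤√             : ∀ x → 0# ≤ √ x
    √-square        : ∀ {x} → 0# ≤ x → √ x * √ x ≈ x
    √-nonpos        : ∀ {x} → x ≤ 0# → √ x * √ x ≈ 0#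
    unitFraction-*  : ∀ n → (suc n ℕ× 1#) * unitFraction n ≈ 1#
    archimedean     : ∀ x → ∃ λ n → x ≤ n ℕ× 1#
    -- Monotone bounded sequences need not converge constructively; the explicit bound
    -- `c * unitFraction n` on the width supplies the rate from which a limit can be built.
    nestedIntervals : ∀ (lo hi : ℕ → Carrier) c →
      (∀ n → lo n ≤ lo (suc n)) → (∀ n → hi (suc n) ≤ hi n) → (∀ n → lo n ≤ hi n) →
      (∀ n → hi n ≤ lo n + c * unitFraction n) →
      ∃ λ x → (∀ n → lo n ≤ x) × (∀ n → x ≤ hi n)

module LinearAlgebra (F : CompleteOrderedField) where
  open CompleteOrderedField F
  open Algebra.Properties.Semiring.Sum semiring
    using (sum; sum-cong-≋; ∑-distrib-+; ∑-comm; *-distribˡ-sum; *-distribʳ-sum; sum-replicate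
          ; sum-init-last; sum-permute) public
  open Algebra.Properties.Semiring.Exp semiring using (_^_; ^-homo-*)
  open Algebra.Properties.Monoid.Mult +-monoid using (×-homo-+; ×-assocˡ)
  open Algebra.Properties.Ring ring using (-‿involutive)

  ≟-coefficients : ∀ p q → Maybe (Induced-equivalence fromℚ-morphism p q)
  ≟-coefficients p q = Maybe.map (λ { ≡.refl → refl }) (dec⇒maybe (p ℚ.≟ q))

  module Solver = Algebra.Solver.Ring
    ℚ.+-*-rawRing (fromCommutativeRing commutativeRing) fromℚ-morphism ≟-coefficients
  open Solver using (solve; _:=_; _:+_; _:*_; _:-_; :-_; con; _:^_; Polynomial)

  -- The zeroth power evaluates to 1#, whereas con 1ℚ evaluates to the image of 1ℚ.
  :1 : ∀ {n} → Polynomial n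
  :1 = con 1ℚ :^ 0

  -- Inequalities, square roots and the Cauchy-Schwarz inequality.

  module Order where
    ≤-refl : ∀ {x} → x ≤ x
    ≤-refl = ≤-reflexive refl

    ≤-respʳ : ∀ {x y z} → y ≈ z → x ≤ y → x ≤ z
    ≤-respʳ e h = ≤-trans h (≤-reflexive e)

    ≤-respˡ : ∀ {x y z} → y ≈ z → y ≤ x → z ≤ x
    ≤-respˡ e h = ≤-trans (≤-reflexive (sym e)) h

    ¬¬-elim : ∀ {A : Set} {x y} → ¬ ¬ A → (A → x ≤ y) → x ≤ y
    ¬¬-elim ¬¬a f = ≤-stable λ x≰y → ¬¬a (x≰y ∘ f)

    ≤-cases : ∀ a b {x y} → (a ≤ b → x ≤ y) → (b ≤ a → x ≤ y) → x ≤ y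
    ≤-cases a b f g = ¬¬-elim (≤-total a b) [ f , g ]′

    +-monoˡ-≤ : ∀ x {y z} → y ≤ z → y + x ≤ z + x
    +-monoˡ-≤ x h = ≤-respˡ (+-comm x _) (≤-respʳ (+-comm x _) (+-monoʳ-≤ x h))

    +-mono-≤ : ∀ {x y z w} → x ≤ y → z ≤ w → x + z ≤ y + w
    +-mono-≤ h k = ≤-trans (+-monoˡ-≤ _ h) (+-monoʳ-≤ _ k)

    0≤x+y : ∀ {x y} → 0# ≤ x → 0# ≤ y → 0# ≤ x + y
    0≤x+y h k = ≤-respˡ (+-identityˡ 0#) (+-mono-≤ h k)

    x≤x+y : ∀ {x y} → 0# ≤ y → x ≤ x + y
    x≤x+y {x} h = ≤-respˡ (+-identityʳ x) (+-monoʳ-≤ x h)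

    ≤-witness : ∀ {x y s} → 0# ≤ s → x + s ≈ y → x ≤ y
    ≤-witness h e = ≤-respʳ e (x≤x+y h)

    x≤y⇒0≤y-x : ∀ {x y} → x ≤ y → 0# ≤ y - x
    x≤y⇒0≤y-x {x} h = ≤-respˡ (-‿inverseʳ x) (+-monoˡ-≤ (- x) h)

    0≤y-x⇒x≤y : ∀ {x y} → 0# ≤ y - x → x ≤ y
    0≤y-x⇒x≤y {x} {y} h = ≤-witness h (solve 2 (λ x y → x :+ (y :- x) := y) refl x y)

    *-monoʳ-≤ : ∀ {z x y} → 0# ≤ z → x ≤ y → x * z ≤ y * z
    *-monoʳ-≤ {z} {x} {y} 0≤z h = ≤-witness (0≤x*y (x≤y⇒0≤y-x h) 0≤z)
      (solve 3 (λ x y z → x :* z :+ (y :- x) :* z := y :* z) refl x y z)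

    *-monoˡ-≤ : ∀ {z x y} → 0# ≤ z → x ≤ y → z * x ≤ z * y
    *-monoˡ-≤ 0≤z h = ≤-respˡ (*-comm _ _) (≤-respʳ (*-comm _ _) (*-monoʳ-≤ 0≤z h))

    *-mono-≤ : ∀ {x y z w} → 0# ≤ x → x ≤ y → 0# ≤ z → z ≤ w → x * z ≤ y * w
    *-mono-≤ 0≤x x≤y 0≤z z≤w = ≤-trans (*-monoʳ-≤ 0≤z x≤y) (*-monoˡ-≤ (≤-trans 0≤x x≤y) z≤w)

    x≤0⇒0≤-x : ∀ {x} → x ≤ 0# → 0# ≤ - x
    x≤0⇒0≤-x {x} h = ≤-respʳ (+-identityˡ (- x)) (x≤y⇒0≤y-x h)

    0≤x² : ∀ x → 0# ≤ x * x
    0≤x² x = ≤-cases 0# x (λ h → 0≤x*y h h) (λ h → ≤-respʳ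
      (solve 1 (λ x → (:- x) :* (:- x) := x :* x) refl x) (0≤x*y (x≤0⇒0≤-x h) (x≤0⇒0≤-x h)))

    0≤1 : 0# ≤ 1#
    0≤1 = ≤-respʳ (*-identityˡ 1#) (0≤x² 1#)

    0≤n× : ∀ n → 0# ≤ n ℕ× 1#
    0≤n× zero    = ≤-refl
    0≤n× (suc n) = 0≤x+y 0≤1 (0≤n× n)

    n×-* : ∀ n x → n ℕ× x ≈ (n ℕ× 1#) * x
    n×-* zero    x = sym (zeroˡ x)
    n×-* (suc n) x = trans (+-cong (sym (*-identityˡ x)) (n×-* n x)) (sym (distribʳ x 1# (n ℕ× 1#)))

    -- `y` equals `x * (y * y)`, a product of nonnegative factors; no case distinction on the sign
    -- of `y` occurs.
    inverse-nonNeg : ∀ {x y} → 0# ≤ x → x * y ≈ 1# → 0# ≤ y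
    inverse-nonNeg {x} {y} 0≤x e = ≤-respʳ
      (trans (solve 2 (λ x y → x :* (y :* y) := x :* y :* y) refl x y)
        (trans (*-congʳ e) (*-identityˡ y)))
      (0≤x*y 0≤x (0≤x² y))

    -- There is no strict order in the interface, so positivity of `z` is expressed as nonnegativity
    -- together with an inverse `w`.
    *-cancelʳ-≤ : ∀ {x y z w} → 0# ≤ z → z * w ≈ 1# → x * z ≤ y * z → x ≤ y
    *-cancelʳ-≤ {x} {y} {z} {w} 0≤z e h =
      ≤-respˡ (cancel x) (≤-respʳ (cancel y) (*-monoʳ-≤ (inverse-nonNeg 0≤z e) h))
      where
      cancel : ∀ x → x * z * w ≈ x
      cancel x = trans (*-assoc x z w) (trans (*-congˡ e) (*-identityʳ x))

    -- When `y ≤ x`, factor the difference of squares and cancel `x + y`. If `x + y` vanishes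
    -- instead of being invertible, then `x ≤ x + y ≈ 0#`.
    square-cancel-≤ : ∀ {x y} → 0# ≤ y → x * x ≤ y * y → x ≤ y
    square-cancel-≤ {x} {y} 0≤y h = ≤-cases x y (λ x≤y → x≤y) λ y≤x →
      ¬¬-elim (zero-or-inverse (x + y))
        [ (λ x+y≈0 → ≤-trans (≤-witness 0≤y x+y≈0) 0≤y)
        , (λ (w , e) → *-cancelʳ-≤ (0≤x+y (≤-trans 0≤y y≤x) 0≤y) e
            (≤-witness (x≤y⇒0≤y-x h)
              (solve 2 (λ x y → x :* (x :+ y) :+ (y :* y :- x :* x) := y :* (x :+ y)) refl x y)))
        ]′

    square-mono-≤ : ∀ {x y} → 0# ≤ x → x ≤ y → x * x ≤ y * y
    square-mono-≤ 0≤x x≤y = *-mono-≤ 0≤x x≤y 0≤x x≤y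

    √-mono-≤ : ∀ {x y} → x ≤ y → √ x ≤ √ y
    √-mono-≤ {x} {y} x≤y = ≤-cases 0# x
      (λ 0≤x → square-cancel-≤ (0≤√ y)
        (≤-respˡ (sym (√-square 0≤x)) (≤-respʳ (sym (√-square (≤-trans 0≤x x≤y))) x≤y)))
      (λ x≤0 → square-cancel-≤ (0≤√ y) (≤-respˡ (sym (√-nonpos x≤0)) (0≤x² (√ y))))

    √-≤ : ∀ {x y} → 0# ≤ y → x ≤ y * y → √ x ≤ y
    √-≤ {x} {y} 0≤y h = ≤-trans (√-mono-≤ h) (square-cancel-≤ 0≤y (≤-reflexive (√-square (0≤x² y))))

    ≤-√ : ∀ {x y} → 0# ≤ x → x * x ≤ y → x ≤ √ y
    ≤-√ {x} {y} 0≤x h = square-cancel-≤ (0≤√ y) (≤-respʳ (sym (√-square (≤-trans (0≤x² x) h))) h)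

    0≤sum : ∀ {n} {f : Fin n → Carrier} → (∀ i → 0# ≤ f i) → 0# ≤ sum f
    0≤sum {zero}  h = ≤-refl
    0≤sum {suc n} h = 0≤x+y (h zero) (0≤sum (h ∘ suc))

    sum-mono-≤ : ∀ {n} {f g : Fin n → Carrier} → (∀ i → f i ≤ g i) → sum f ≤ sum g
    sum-mono-≤ {zero}  h = ≤-refl
    sum-mono-≤ {suc n} h = +-mono-≤ (h zero) (sum-mono-≤ (h ∘ suc))

    term≤sum : ∀ {n} {f : Fin n → Carrier} → (∀ i → 0# ≤ f i) → ∀ i → f i ≤ sum f
    term≤sum h zero    = x≤x+y (0≤sum (h ∘ suc))
    term≤sum h (suc i) = ≤-trans (term≤sum (h ∘ suc) i) (≤-respʳ (+-comm _ _) (x≤x+y (h zero)))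

    -- The weighted sum of the squares (a y - b x)² expanded, with the cross terms moved to the left
    -- so that both sides are free of subtracted sums.
    quadratic-sum : ∀ {n} (w a b : Fin n → Carrier) x y →
      sum (λ i → w i * ((a i * y - b i * x) * (a i * y - b i * x)))
        + (sum (λ i → w i * (a i * b i)) * (x * y) + sum (λ i → w i * (a i * b i)) * (x * y))
      ≈ sum (λ i → w i * (a i * a i)) * (y * y) + sum (λ i → w i * (b i * b i)) * (x * x)
    quadratic-sum {zero} w a b x y = begin
      0# + (0# * (x * y) + 0# * (x * y))
        ≈⟨ +-identityˡ _ ⟩
      0# * (x * y) + 0# * (x * y)
        ≈⟨ +-cong (trans (zeroˡ _) (sym (zeroˡ _))) (trans (zeroˡ _) (sym (zeroˡ _))) ⟩
      0# * (y * y) + 0# * (x * x) ∎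
      where open SetoidReasoning setoid
    quadratic-sum {suc n} w a b x y = begin
      w₀ * ((a₀ * y - b₀ * x) * (a₀ * y - b₀ * x)) + Q
        + ((w₀ * (a₀ * b₀) + C) * (x * y) + (w₀ * (a₀ * b₀) + C) * (x * y))
        ≈⟨ solve 7 (λ w a b x y Q C →
             w :* ((a :* y :- b :* x) :* (a :* y :- b :* x)) :+ Q :+ ((w :* (a :* b) :+ C) :*
               (x :* y) :+ (w :* (a :* b) :+ C) :* (x :* y))
             := w :* (a :* a) :* (y :* y) :+ w :* (b :* b) :* (x :* x) :+
               (Q :+ (C :* (x :* y) :+ C :* (x :* y))))
             refl w₀ a₀ b₀ x y Q C ⟩
      w₀ * (a₀ * a₀) * (y * y) + w₀ * (b₀ * b₀) * (x * x) + (Q + (C * (x * y) + C * (x * y)))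
        ≈⟨ +-congˡ (quadratic-sum (w ∘ suc) (a ∘ suc) (b ∘ suc) x y) ⟩
      w₀ * (a₀ * a₀) * (y * y) + w₀ * (b₀ * b₀) * (x * x) + (A * (y * y) + B * (x * x))
        ≈⟨ solve 6 (λ p q x y A B →
             p :* y :+ q :* x :+ (A :* y :+ B :* x) := (p :+ A) :* y :+ (q :+ B) :* x)
             refl (w₀ * (a₀ * a₀)) (w₀ * (b₀ * b₀)) (x * x) (y * y) A B ⟩
      (w₀ * (a₀ * a₀) + A) * (y * y) + (w₀ * (b₀ * b₀) + B) * (x * x) ∎
      where
      open SetoidReasoning setoid
      w₀ = w zero
      a₀ = a zero
      b₀ = b zero
      Q = sum (λ i → w (suc i) * ((a (suc i) * y - b (suc i) * x) * (a (suc i) * y - b (suc i) * x)))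
      A = sum (λ i → w (suc i) * (a (suc i) * a (suc i)))
      B = sum (λ i → w (suc i) * (b (suc i) * b (suc i)))
      C = sum (λ i → w (suc i) * (a (suc i) * b (suc i)))

    -- Lagrange's identity by induction: a new term enlarges the difference of the two sides by w₀ Σ
    -- wᵢ (aᵢ b₀ - bᵢ a₀)². No division is involved.
    cauchy-schwarz : ∀ {n} (w a b : Fin n → Carrier) → (∀ i → 0# ≤ w i) →
      sum (λ i → w i * (a i * b i)) * sum (λ i → w i * (a i * b i))
      ≤ sum (λ i → w i * (a i * a i)) * sum (λ i → w i * (b i * b i))
    cauchy-schwarz {zero}  w a b 0≤w = ≤-refl
    cauchy-schwarz {suc n} w a b 0≤w = ≤-witness
      (0≤x+y (x≤y⇒0≤y-x (cauchy-schwarz (w ∘ suc) (a ∘ suc) (b ∘ suc) (0≤w ∘ suc)))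
        (0≤x*y (0≤w zero) (0≤sum (λ i → 0≤x*y (0≤w (suc i)) (0≤x² (a (suc i) * b₀ - b (suc i) * a₀))))))
      (begin
        (w₀ * (a₀ * b₀) + C) * (w₀ * (a₀ * b₀) + C) + (A * B - C * C + w₀ * Q)
          ≈⟨ solve 7 (λ w a b A B C Q →
               (w :* (a :* b) :+ C) :* (w :* (a :* b) :+ C) :+ (A :* B :- C :* C :+ w :* Q)
               := w :* (a :* a) :* (w :* (b :* b)) :+ A :* B :+ w :* (Q :+ (C :* (a :* b) :+ C :*
                 (a :* b))))
               refl w₀ a₀ b₀ A B C Q ⟩
        w₀ * (a₀ * a₀) * (w₀ * (b₀ * b₀)) + A * B + w₀ * (Q + (C * (a₀ * b₀) + C * (a₀ * b₀)))
          ≈⟨ +-congˡ (*-congˡ (quadratic-sum (w ∘ suc) (a ∘ suc) (b ∘ suc) a₀ b₀)) ⟩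
        w₀ * (a₀ * a₀) * (w₀ * (b₀ * b₀)) + A * B + w₀ * (A * (b₀ * b₀) + B * (a₀ * a₀))
          ≈⟨ solve 5 (λ w a b A B →
               w :* (a :* a) :* (w :* (b :* b)) :+ A :* B :+ w :* (A :* (b :* b) :+ B :* (a :* a))
               := (w :* (a :* a) :+ A) :* (w :* (b :* b) :+ B)) refl w₀ a₀ b₀ A B ⟩
        (w₀ * (a₀ * a₀) + A) * (w₀ * (b₀ * b₀) + B) ∎)
      where
      open SetoidReasoning setoid
      w₀ = w zero
      a₀ = a zero
      b₀ = b zero
      Q = sum (λ i → w (suc i) * ((a (suc i) * b₀ - b (suc i) * a₀)
                                * (a (suc i) * b₀ - b (suc i) * a₀)))
      A = sum (λ i → w (suc i) * (a (suc i) * a (suc i)))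
      B = sum (λ i → w (suc i) * (b (suc i) * b (suc i)))
      C = sum (λ i → w (suc i) * (a (suc i) * b (suc i)))

  open Order

  -- Growth rate of a sequence along powers of two.

  module GrowthRate where
    pow2 : ℕ → ℕ
    pow2 zero    = 1
    pow2 (suc j) = pow2 j ℕ.+ pow2 j

    -- The root of order `pow2 j`. Square roots are the only roots provided, which is why exponents
    -- are restricted to powers of two.
    iterRoot : ℕ → Carrier → Carrier
    iterRoot zero    x = x
    iterRoot (suc j) x = iterRoot j (√ x)

    iterRoot-mono : ∀ j {x y} → x ≤ y → iterRoot j x ≤ iterRoot j y
    iterRoot-mono zero    h = h
    iterRoot-mono (suc j) h = iterRoot-mono j (√-mono-≤ h)

    0≤iterRoot : ∀ j {x} → 0# ≤ x → 0# ≤ iterRoot j x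
    0≤iterRoot zero    h = h
    0≤iterRoot (suc j) h = 0≤iterRoot j (0≤√ _)

    0≤^ : ∀ {x} → 0# ≤ x → ∀ n → 0# ≤ x ^ n
    0≤^ h zero    = 0≤1
    0≤^ h (suc n) = 0≤x*y h (0≤^ h n)

    ^-pow2-suc : ∀ x j → x ^ pow2 (suc j) ≈ x ^ pow2 j * x ^ pow2 j
    ^-pow2-suc x j = ^-homo-* x (pow2 j) (pow2 j)

    ≤iterRoot⇒^≤ : ∀ j {x y} → 0# ≤ x → 0# ≤ y → x ≤ iterRoot j y → x ^ pow2 j ≤ y
    ≤iterRoot⇒^≤ zero    0≤x 0≤y h = ≤-respˡ (sym (*-identityʳ _)) h
    ≤iterRoot⇒^≤ (suc j) 0≤x 0≤y h = ≤-respˡ (sym (^-pow2-suc _ j)) (≤-respʳ (√-square 0≤y)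
      (square-mono-≤ (0≤^ 0≤x (pow2 j)) (≤iterRoot⇒^≤ j 0≤x (0≤√ _) h)))

    iterRoot≤⇒≤^ : ∀ j {x y} → 0# ≤ y → iterRoot j y ≤ x → y ≤ x ^ pow2 j
    iterRoot≤⇒≤^ zero    0≤y h = ≤-respʳ (sym (*-identityʳ _)) h
    iterRoot≤⇒≤^ (suc j) 0≤y h = ≤-respʳ (sym (^-pow2-suc _ j)) (≤-respˡ (√-square 0≤y)
      (square-mono-≤ (0≤√ _) (iterRoot≤⇒≤^ j (0≤√ _) h)))

    ½# : Carrier
    ½# = unitFraction 1

    ½+½ : ½# + ½# ≈ 1#
    -- `unitFraction-* 1` has the factor `1# + (1# + 0#)`; its `0#` is obtained from `1# - 1#`.
    ½+½ = trans (solve 1 (λ h → h :+ h := (:1 :+ (:1 :+ (:1 :- :1))) :* h) refl ½#)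
      (trans (*-congʳ (+-congˡ (+-congˡ (-‿inverseʳ 1#)))) (unitFraction-* 1))

    0≤unitFraction : ∀ n → 0# ≤ unitFraction n
    0≤unitFraction n = inverse-nonNeg (0≤n× (suc n)) (unitFraction-* n)

    0≤½ : 0# ≤ ½#
    0≤½ = 0≤unitFraction 1

    n×½^n≤1 : ∀ n → (suc n ℕ× 1#) * ½# ^ n ≤ 1#
    n×½^n≤1 zero    = ≤-reflexive (trans (*-identityʳ _) (+-identityʳ 1#))
    n×½^n≤1 (suc n) = ≤-trans
      (≤-witness (0≤x*y 0≤½ (0≤x*y (0≤n× n) (0≤^ 0≤½ n))) (begin
        (1# + (1# + k)) * (½# * p) + ½# * (k * p)
          ≈⟨ solve 3 (λ k p h → (:1 :+ (:1 :+ k)) :* (h :* p) :+ h :* (k :* p)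
               := (h :+ h) :* ((:1 :+ k) :* p)) refl k p ½# ⟩
        (½# + ½#) * ((1# + k) * p)   ≈⟨ *-congʳ ½+½ ⟩
        1# * ((1# + k) * p)          ≈⟨ *-identityˡ _ ⟩
        (1# + k) * p                 ∎))
      (n×½^n≤1 n)
      where
      open SetoidReasoning setoid
      k = n ℕ× 1#
      p = ½# ^ n

    -- Weakens geometric convergence to the harmonic rate in which `nestedIntervals` is phrased.
    ½^n≤unitFraction : ∀ n → ½# ^ n ≤ unitFraction n
    ½^n≤unitFraction n = *-cancelʳ-≤ (0≤n× (suc n)) (unitFraction-* n)
      (≤-respˡ (*-comm _ _) (≤-respʳ (trans (sym (unitFraction-* n)) (*-comm _ _)) (n×½^n≤1 n)))

    -- Iterates √(1 + x) ≤ 1 + x/2, which holds because the square of the right side exceeds 1 + x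
    -- by (x/2)².
    iterRoot-growth : ∀ j {x u} → 0# ≤ x → 0# ≤ u →
      iterRoot j ((1# + x) * u) ≤ (1# + x * ½# ^ j) * iterRoot j u
    iterRoot-growth zero {x} 0≤x 0≤u = ≤-reflexive (*-congʳ (+-congˡ (sym (*-identityʳ x))))
    iterRoot-growth (suc j) {x} {u} 0≤x 0≤u = ≤-trans
      (iterRoot-mono j (√-≤ (0≤x*y (0≤x+y 0≤1 0≤xh) (0≤√ u))
        (≤-witness (0≤x*y (0≤x² (x * ½#)) 0≤u) (begin
          (1# + x) * u + x * ½# * (x * ½#) * u
            ≈⟨ +-congʳ (*-congʳ (+-congˡ (trans (sym (*-identityʳ x)) (*-congˡ (sym ½+½))))) ⟩
          (1# + x * (½# + ½#)) * u + x * ½# * (x * ½#) * u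
            ≈⟨ solve 3 (λ x u h → (:1 :+ x :* (h :+ h)) :* u :+ x :* h :* (x :* h) :* u
                 := (:1 :+ x :* h) :* (:1 :+ x :* h) :* u) refl x u ½# ⟩
          (1# + x * ½#) * (1# + x * ½#) * u
            ≈⟨ *-congˡ (sym (√-square 0≤u)) ⟩
          (1# + x * ½#) * (1# + x * ½#) * (√ u * √ u)
            ≈⟨ solve 2 (λ a s → a :* a :* (s :* s) := a :* s :* (a :* s)) refl (1# + x * ½#) (√ u) ⟩
          (1# + x * ½#) * √ u * ((1# + x * ½#) * √ u) ∎))))
      (≤-respʳ (*-congʳ (+-congˡ (*-assoc x ½# (½# ^ j)))) (iterRoot-growth j 0≤xh (0≤√ u)))
      where
      open SetoidReasoning setoid
      0≤xh : 0# ≤ x * ½#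
      0≤xh = 0≤x*y 0≤x 0≤½

    -- The numbers t(2^j) ^ 2^-j decrease and (t(2^j) / N) ^ 2^-j increase, and
    -- their ratios N ^ 2^-j tend to 1.
    growthRate : ∀ (t : ℕ → Carrier) N N⁻¹ → 1# ≤ N → N * N⁻¹ ≈ 1# →
      (∀ l → 0# ≤ t l) →
      (∀ l → t (l ℕ.+ l) ≤ t l * t l) →
      (∀ l → t l * t l ≤ N * t (l ℕ.+ l)) →
      ∃ λ x → N⁻¹ * t 1 ≤ x × (∀ j → x ^ pow2 j ≤ t (pow2 j)) × (∀ j → t (pow2 j) ≤ N * x ^ pow2 j)
    growthRate t N N⁻¹ 1≤N NN⁻¹≈1 0≤t t-sub t-super =
      let x , lo≤x , x≤hi = nestedIntervals lo hi (N * hi 0) lo-mono hi-anti lo≤hi width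
          0≤x = ≤-trans (0≤lo 0) (lo≤x 0)
      in x , lo≤x 0
       , (λ j → ≤iterRoot⇒^≤ j 0≤x (0≤t (pow2 j)) (x≤hi j))
       , (λ j → ≤-respˡ (N*N⁻¹* (t (pow2 j)))
           (*-monoˡ-≤ 0≤N (iterRoot≤⇒≤^ j (0≤u (pow2 j)) (lo≤x j))))
      where
      open SetoidReasoning setoid
      u : ℕ → Carrier
      u l = N⁻¹ * t l
      0≤N : 0# ≤ N
      0≤N = ≤-trans 0≤1 1≤N
      0≤N⁻¹ : 0# ≤ N⁻¹
      0≤N⁻¹ = inverse-nonNeg 0≤N NN⁻¹≈1
      N⁻¹≤1 : N⁻¹ ≤ 1#
      N⁻¹≤1 = ≤-respˡ (*-identityˡ N⁻¹) (≤-respʳ NN⁻¹≈1 (*-monoʳ-≤ 0≤N⁻¹ 1≤N))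
      0≤u : ∀ l → 0# ≤ u l
      0≤u l = 0≤x*y 0≤N⁻¹ (0≤t l)
      N*N⁻¹* : ∀ y → N * (N⁻¹ * y) ≈ y
      N*N⁻¹* y = trans (sym (*-assoc N N⁻¹ y)) (trans (*-congʳ NN⁻¹≈1) (*-identityˡ y))
      lo hi : ℕ → Carrier
      lo j = iterRoot j (u (pow2 j))
      hi j = iterRoot j (t (pow2 j))
      0≤lo : ∀ j → 0# ≤ lo j
      0≤lo j = 0≤iterRoot j (0≤u (pow2 j))
      hi-anti : ∀ j → hi (suc j) ≤ hi j
      hi-anti j = iterRoot-mono j (√-≤ (0≤t (pow2 j)) (t-sub (pow2 j)))
      lo-mono : ∀ j → lo j ≤ lo (suc j)
      lo-mono j = iterRoot-mono j (≤-√ (0≤u (pow2 j)) (≤-respˡ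
        (solve 2 (λ n t → n :* n :* (t :* t) := n :* t :* (n :* t)) refl N⁻¹ (t (pow2 j)))
        (≤-respʳ (begin
          N⁻¹ * N⁻¹ * (N * t (pow2 (suc j)))    ≈⟨ *-assoc N⁻¹ N⁻¹ _ ⟩
          N⁻¹ * (N⁻¹ * (N * t (pow2 (suc j))))
             ≈⟨ *-congˡ (trans (solve 3 (λ a b t → a :* (b :* t) := b :* (a :* t)) refl N⁻¹ N
               (t (pow2 (suc j)))) (N*N⁻¹* _)) ⟩
          N⁻¹ * t (pow2 (suc j))                ∎)
        (*-monoˡ-≤ (0≤x² N⁻¹) (t-super (pow2 j))))))
      lo≤hi : ∀ j → lo j ≤ hi j
      lo≤hi j = iterRoot-mono j (≤-respʳ (*-identityˡ _) (*-monoʳ-≤ (0≤t (pow2 j)) N⁻¹≤1))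
      hi≤hi0 : ∀ j → hi j ≤ hi 0
      hi≤hi0 zero    = ≤-refl
      hi≤hi0 (suc j) = ≤-trans (hi-anti j) (hi≤hi0 j)
      -- Here t = N u is enlarged to (1 + N) u, so that `iterRoot-growth` gives hi ≤ (1 + N/2^j) lo;
      -- the factor `lo j` of the error is then bounded by `hi 0`.
      width : ∀ j → hi j ≤ lo j + N * hi 0 * unitFraction j
      width j = ≤-trans
        (iterRoot-mono j (≤-respˡ (N*N⁻¹* _) (*-monoʳ-≤ (0≤u (pow2 j)) (≤-respʳ (+-comm N 1#)
          (x≤x+y 0≤1)))))
        (≤-trans (iterRoot-growth j 0≤N (0≤u (pow2 j)))
        (≤-respˡ (solve 3 (λ n h l → l :+ n :* (h :* l) := (:1 :+ n :* h) :* l) refl N (½# ^ j) (lo j))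
        (+-monoʳ-≤ (lo j) (≤-respʳ
          (solve 3 (λ n e h → n :* (e :* h) := n :* h :* e) refl N (unitFraction j) (hi 0))
          (*-monoˡ-≤ 0≤N (*-mono-≤ (0≤^ 0≤½ j) (½^n≤unitFraction j) (0≤lo j) (≤-trans (lo≤hi j)
            (hi≤hi0 j))))))))

  open GrowthRate

  -- Real matrices and Gaussian elimination up to double negation.

  module RealMatrices where
    open SetoidReasoning setoid

    Mat : ℕ → ℕ → Set
    Mat m n = Fin m → Fin n → Carrier

    dot : ∀ {n} → (f g : Fin n → Carrier) → Carrier
    dot f g = sum (λ i → f i * g i)

    dot-cong : ∀ {n} {f f′ g g′ : Fin n → Carrier} → (∀ i → f i ≈ f′ i) → (∀ i → g i ≈ g′ i) →
               dot f g ≈ dot f′ g′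
    dot-cong h k = sum-cong-≋ (λ i → *-cong (h i) (k i))

    dot-comm : ∀ {n} (f g : Fin n → Carrier) → dot f g ≈ dot g f
    dot-comm f g = sum-cong-≋ (λ i → *-comm (f i) (g i))

    sum-neg : ∀ {n} (f : Fin n → Carrier) → sum (λ i → - f i) ≈ - sum f
    sum-neg {zero}  f = trans (sym (-‿inverseʳ 0#)) (+-identityˡ (- 0#))
    sum-neg {suc n} f = trans (+-congˡ (sum-neg (f ∘ suc)))
      (solve 2 (λ a s → (:- a) :+ (:- s) := :- (a :+ s)) refl (f zero) (sum (f ∘ suc)))

    sum-sub : ∀ {n} (f g : Fin n → Carrier) → sum (λ i → f i - g i) ≈ sum f - sum g
    sum-sub f g = trans (∑-distrib-+ f (λ i → - g i)) (+-congˡ (sum-neg g))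

    dot-sub : ∀ {n} (f g z : Fin n → Carrier) → dot (λ i → f i - g i) z ≈ dot f z - dot g z
    dot-sub f g z = trans
      (sum-cong-≋ (λ i → solve 3 (λ f g z → (f :- g) :* z := f :* z :- g :* z) refl (f i) (g i) (z i)))
      (sum-sub (λ i → f i * z i) (λ i → g i * z i))

    dot-subʳ : ∀ {n} (z f g : Fin n → Carrier) → dot z (λ i → f i - g i) ≈ dot z f - dot z g
    dot-subʳ z f g = trans (dot-comm z _)
      (trans (dot-sub f g z) (+-cong (dot-comm f z) (-‿cong (dot-comm g z))))

    dot-scale : ∀ {n} s (f z : Fin n → Carrier) → dot (λ i → s * f i) z ≈ s * dot f z
    dot-scale s f z = trans (sum-cong-≋ (λ i → *-assoc s (f i) (z i)))
      (sym (*-distribˡ-sum s (λ i → f i * z i)))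

    dot-scaleʳ : ∀ {n} s (z f : Fin n → Carrier) → dot z (λ i → s * f i) ≈ s * dot z f
    dot-scaleʳ s z f = trans (dot-comm z _) (trans (dot-scale s f z) (*-congˡ (dot-comm f z)))

    dot-assoc : ∀ {m n} (f : Fin m → Carrier) (G : Mat m n) (h : Fin n → Carrier) →
                dot (λ l → dot f (λ k → G k l)) h ≈ dot f (λ k → dot (G k) h)
    dot-assoc f G h = begin
      sum (λ l → sum (λ k → f k * G k l) * h l)
        ≈⟨ sum-cong-≋ (λ l → trans (*-distribʳ-sum (h l) (λ k → f k * G k l))
             (sum-cong-≋ (λ k → *-assoc (f k) (G k l) (h l)))) ⟩
      sum (λ l → sum (λ k → f k * (G k l * h l)))
        ≈⟨ ∑-comm (λ l k → f k * (G k l * h l)) ⟩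
      sum (λ k → sum (λ l → f k * (G k l * h l)))
        ≈⟨ sum-cong-≋ (λ k → sym (*-distribˡ-sum (f k) (λ l → G k l * h l))) ⟩
      sum (λ k → f k * sum (λ l → G k l * h l)) ∎

    δ : ∀ {n} → Mat n n
    δ zero    zero    = 1#
    δ zero    (suc j) = 0#
    δ (suc i) zero    = 0#
    δ (suc i) (suc j) = δ i j

    δ-sym : ∀ {n} (i j : Fin n) → δ i j ≈ δ j i
    δ-sym zero    zero    = refl
    δ-sym zero    (suc j) = refl
    δ-sym (suc i) zero    = refl
    δ-sym (suc i) (suc j) = δ-sym i j

    dot-zeroˡ : ∀ {n} (z : Fin n → Carrier) → dot (λ _ → 0#) z ≈ 0#
    dot-zeroˡ {zero}  z = refl
    dot-zeroˡ {suc n} z = trans (+-cong (zeroˡ _) (dot-zeroˡ (z ∘ suc))) (+-identityˡ 0#)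

    dot-δ : ∀ {n} i (z : Fin n → Carrier) → dot (δ i) z ≈ z i
    dot-δ zero    z = trans (+-cong (*-identityˡ _) (dot-zeroˡ (z ∘ suc))) (+-identityʳ _)
    dot-δ (suc i) z = trans (+-cong (zeroˡ _) (dot-δ i (z ∘ suc))) (+-identityˡ _)

    dot-δʳ : ∀ {n} i (z : Fin n → Carrier) → dot z (λ j → δ j i) ≈ z i
    dot-δʳ i z = trans (dot-comm z _) (trans (dot-cong (λ j → δ-sym j i) (λ _ → refl)) (dot-δ i z))

    zeros-or-inverse : ∀ {n} (w : Fin n → Carrier) →
      ¬ ¬ ((∀ i → w i ≈ 0#) ⊎ ∃ λ i → ∃ λ y → w i * y ≈ 1#)
    zeros-or-inverse {zero}  w k = k (inj₁ λ ())
    zeros-or-inverse {suc n} w k = zero-or-inverse (w zero)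
      [ (λ w₀≈0 → zeros-or-inverse (w ∘ suc)
          [ (λ h → k (inj₁ λ { zero → w₀≈0 ; (suc i) → h i }))
          , (λ (i , h) → k (inj₂ (suc i , h)))
          ]′)
      , (λ h → k (inj₂ (zero , h)))
      ]′

    -- Nontriviality is recorded as an entry equal to `1#`, positive information that is preserved
    -- when the vector is padded with a zero.
    HasKernel : ∀ {m n} → Mat m n → Set
    HasKernel {n = n} B = ∃ λ (v : Fin n → Carrier) → (∃ λ j → v j ≈ 1#) × (∀ i → dot (B i) v ≈ 0#)

    HasLeftInverse : ∀ {m n} → Mat m n → Set
    HasLeftInverse {m} {n} B = ∃ λ (C : Mat n m) → ∀ a b → dot (C a) (λ i → B i b) ≈ δ a b

    -- Adjoin the first column a to the remaining columns B, which have a left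
    -- inverse C: the residual w = a - B C a is orthogonal to the rows of C, and
    -- vanishes exactly when a depends linearly on B.
    adjoinColumn : ∀ {m n} (B : Mat m (suc n)) → HasLeftInverse (λ i j → B i (suc j)) →
                   ¬ ¬ (HasKernel B ⊎ HasLeftInverse B)
    adjoinColumn {m} {n} B (C , CB≈δ) k = zeros-or-inverse w
      [ (λ w≈0 → k (inj₁ (1# ∷ (λ j → - Ca j) , (zero , refl) , λ i → begin
          B i zero * 1# + dot (B′ i) (λ j → - Ca j)
            ≈⟨ +-cong (*-identityʳ (B i zero)) (trans
                 (sum-cong-≋ (λ j → solve 2 (λ b c → b :* (:- c) := :- (b :* c)) refl (B′ i j) (Ca j)))
                 (sum-neg (λ j → B′ i j * Ca j))) ⟩
          w i
            ≈⟨ w≈0 i ⟩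
          0# ∎)))
      , (λ (r , y , wy≈1) → k (inj₂ (leftInverse r y wy≈1)))
      ]′
      where
      a : Fin m → Carrier
      a i = B i zero
      B′ : Mat m n
      B′ i j = B i (suc j)
      Ca : Fin n → Carrier
      Ca j = dot (C j) a
      w : Fin m → Carrier
      w i = a i - dot (B′ i) Ca
      leftInverse : ∀ r y → w r * y ≈ 1# → HasLeftInverse B
      leftInverse r y wy≈1 = D , λ
        { zero zero       → D₀a≈1
        ; zero (suc b)    → D₀B≈0 b
        ; (suc j) zero    → trans (rest j a)
          (trans (+-congˡ (-‿cong (trans (*-congˡ D₀a≈1) (*-identityʳ (Ca j))))) (-‿inverseʳ (Ca j)))
        ; (suc j) (suc b) → trans (rest j (λ i → B′ i b)) (trans
            (+-cong (CB≈δ j b) (-‿cong (trans (*-congˡ (D₀B≈0 b)) (zeroʳ (Ca j)))))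
            (trans (+-congˡ (trans (sym (+-identityˡ (- 0#))) (-‿inverseʳ 0#))) (+-identityʳ (δ j b))))
        }
        where
        -- As a functional, `D₀` takes z to `y` times the r-th coordinate of z - B′ C z. It kills
        -- the columns of `B′` because C B′ is the identity, and sends `a` to `y * w r`, that is, to
        -- 1. The rows of `C` are then corrected by multiples of `D₀` so as to kill `a`.
        D₀ : Fin m → Carrier
        D₀ i = y * (δ r i - dot (B′ r) (λ j → C j i))
        D : Mat (suc n) m
        D zero    i = D₀ i
        D (suc j) i = C j i - Ca j * D₀ i
        first : ∀ z → dot D₀ z ≈ y * (z r - dot (B′ r) (λ j → dot (C j) z))
        first z = trans (dot-scale y _ z) (*-congˡ (trans (dot-sub (δ r) _ z)
          (+-cong (dot-δ r z) (-‿cong (dot-assoc (B′ r) C z)))))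
        D₀a≈1 : dot D₀ a ≈ 1#
        D₀a≈1 = trans (first a) (trans (*-comm y (w r)) wy≈1)
        D₀B≈0 : ∀ b → dot D₀ (λ i → B′ i b) ≈ 0#
        D₀B≈0 b = begin
          dot D₀ (λ i → B′ i b)
            ≈⟨ first (λ i → B′ i b) ⟩
          y * (B′ r b - dot (B′ r) (λ j → dot (C j) (λ i → B′ i b)))
            ≈⟨ *-congˡ (+-congˡ (-‿cong (trans (dot-cong (λ _ → refl) (λ j → CB≈δ j b))
              (dot-δʳ b (B′ r))))) ⟩
          y * (B′ r b - B′ r b)
            ≈⟨ trans (*-congˡ (-‿inverseʳ (B′ r b))) (zeroʳ y) ⟩
          0# ∎
        rest : ∀ j z → dot (D (suc j)) z ≈ dot (C j) z - Ca j * dot D₀ z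
        rest j z = trans (dot-sub (C j) (λ i → Ca j * D₀ i) z)
          (+-congˡ (-‿cong (dot-scale (Ca j) D₀ z)))

    -- Induction on the columns: a kernel vector of the later columns is padded with zero, and a
    -- left inverse of them is handed to `adjoinColumn`.
    kernel-or-leftInverse : ∀ {m n} (B : Mat m n) → ¬ ¬ (HasKernel B ⊎ HasLeftInverse B)
    kernel-or-leftInverse {n = zero}  B k = k (inj₂ ((λ ()) , λ ()))
    kernel-or-leftInverse {n = suc n} B k = kernel-or-leftInverse (λ i j → B i (suc j))
      [ (λ (v , (j , vj≈1) , Bv≈0) → k (inj₁ (0# ∷ v , (suc j , vj≈1) ,
          λ i → trans (+-cong (zeroʳ (B i zero)) (Bv≈0 i)) (+-identityˡ 0#))))
      , (λ C → adjoinColumn B C k)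
      ]′

    infixl 7 _⊗_
    _⊗_ : ∀ {l m n} → Mat l m → Mat m n → Mat l n
    (A ⊗ B) i j = dot (A i) (λ k → B k j)

    transpose : ∀ {m n} → Mat m n → Mat n m
    transpose A i j = A j i

    -- Multiples in this monoid are matrix powers, so the homomorphism law for multiples becomes the
    -- law of exponents for `l ↑ H`.
    matrixMonoid : ℕ → Monoid 0ℓ 0ℓ
    matrixMonoid n = record
      { Carrier = Mat n n
      ; _≈_ = λ A B → ∀ i j → A i j ≈ B i j
      ; _∙_ = _⊗_
      ; ε = δ
      ; isMonoid = record
        { isSemigroup = record
          { isMagma = record
            { isEquivalence = record
              { refl = λ i j → refl
              ; sym = λ h i j → sym (h i j)
              ; trans = λ h k i j → trans (h i j) (k i j)
              }
            ; ∙-cong = λ h k i j → dot-cong (h i) (λ l → k l j)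
            }
          ; assoc = λ A B C i j → dot-assoc (A i) B (λ l → C l j)
          }
        ; identity = (λ A i j → dot-δ i (λ l → A l j)) , (λ A i j → dot-δʳ j (A i))
        }
      }

    trace : ∀ {n} → Mat n n → Carrier
    trace A = sum (λ i → A i i)

    normSq : ∀ {m n} → Mat m n → Carrier
    normSq A = sum (λ i → sum (λ j → A i j * A i j))

    cauchy-schwarz-dot : ∀ {n} (f g : Fin n → Carrier) → dot f g * dot f g ≤ dot f f * dot g g
    cauchy-schwarz-dot f g = ≤-respˡ (*-cong (unit f g) (unit f g))
      (≤-respʳ (*-cong (unit f f) (unit g g))
      (cauchy-schwarz (λ _ → 1#) f g (λ _ → 0≤1)))
      where
      unit : ∀ {n} (f g : Fin n → Carrier) → sum (λ i → 1# * (f i * g i)) ≈ dot f g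
      unit f g = sum-cong-≋ (λ i → *-identityˡ (f i * g i))

    sum-* : ∀ {m n} (f : Fin m → Carrier) (g : Fin n → Carrier) →
            sum (λ i → sum (λ j → f i * g j)) ≈ sum f * sum g
    sum-* f g = trans (sum-cong-≋ (λ i → sym (*-distribˡ-sum (f i) g))) (sym (*-distribʳ-sum (sum g) f))

  open RealMatrices

  -- The largest eigenvalue of H = AᵀA, as the limit of trace (H ^ 2^j) ^ 2^-j.
  module GramMatrix (d : ℕ) (A : RealMatrices.Mat d d) where
    private
      module M = Monoid (matrixMonoid d)
    open Algebra.Properties.Monoid.Mult (matrixMonoid d)
      using () renaming (_×_ to _↑_; ×-homo-+ to ↑-homo-+)

    H : Mat d d
    H = transpose A ⊗ A

    powerTrace : ℕ → Carrier
    powerTrace l = trace (l ↑ H)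

    -- Since H is symmetric, H (GᵀG) H = (GH)ᵀ(GH); hence induction in steps of two, from δ and A.
    -- This yields symmetry and positive semidefiniteness of every power without any spectral
    -- theory.
    gram : ∀ l → ∃ λ G → l ↑ H M.≈ transpose G ⊗ G
    gram 0 = δ , λ i j → sym (trans (dot-cong {g = λ k → δ k j} (λ k → δ-sym k i) (λ _ → refl))
      (dot-δ i (λ k → δ k j)))
    gram 1 = A , M.identityʳ H
    gram (suc (suc l)) with gram l
    ... | G , h = G ⊗ H , (begin
      H ⊗ (H ⊗ (l ↑ H))
        ≈⟨ M.∙-congˡ {H} H-comm ⟩
      H ⊗ ((l ↑ H) ⊗ H)
        ≈⟨ M.∙-congˡ {H} (M.∙-congʳ {H} h) ⟩
      H ⊗ ((transpose G ⊗ G) ⊗ H)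
        ≈⟨ M.∙-congˡ {H} (M.assoc (transpose G) G H) ⟩
      H ⊗ (transpose G ⊗ (G ⊗ H))
        ≈⟨ M.sym (M.assoc H (transpose G) (G ⊗ H)) ⟩
      (H ⊗ transpose G) ⊗ (G ⊗ H)
        ≈⟨ M.∙-congʳ {G ⊗ H} transposed ⟩
      transpose (G ⊗ H) ⊗ (G ⊗ H) ∎)
      where
      open SetoidReasoning M.setoid
      H-comm : H ⊗ (l ↑ H) M.≈ (l ↑ H) ⊗ H
      H-comm = M.trans (M.reflexive (≡.cong (_↑ H) (ℕ.+-comm 1 l)))
        (M.trans (↑-homo-+ H l 1) (M.∙-congˡ {l ↑ H} (M.identityʳ H)))
      transposed : H ⊗ transpose G M.≈ transpose (G ⊗ H)
      transposed i j = trans (dot-comm _ (G j)) (dot-cong {f = G j} (λ _ → refl) (λ k → dot-comm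
        (λ x → A x i) (λ x → A x k)))

    power-symmetric : ∀ l i j → (l ↑ H) i j ≈ (l ↑ H) j i
    power-symmetric l i j = let G , h = gram l in
      trans (h i j) (trans (dot-comm (λ k → G k i) (λ k → G k j)) (sym (h j i)))

    powerTrace-double : ∀ l → powerTrace (l ℕ.+ l) ≈ normSq (l ↑ H)
    powerTrace-double l = sum-cong-≋ (λ i → trans (↑-homo-+ H l l i i)
      (dot-cong {f = (l ↑ H) i} (λ _ → refl) (λ k → power-symmetric l k i)))

    0≤powerTrace : ∀ l → 0# ≤ powerTrace l
    0≤powerTrace l = let G , h = gram l in
      0≤sum (λ i → ≤-respʳ (sym (h i i)) (0≤sum (λ k → 0≤x² (G k i))))

    -- With K = GᵀG the l-th power, Cauchy-Schwarz for the columns of G gives Kᵢⱼ² ≤ Kᵢᵢ Kⱼⱼ; sum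
    -- over i and j.
    powerTrace-sub : ∀ l → powerTrace (l ℕ.+ l) ≤ powerTrace l * powerTrace l
    powerTrace-sub l = let G , h = gram l ; K = l ↑ H in
      ≤-respˡ (sym (powerTrace-double l))
      (≤-respʳ (sum-* (λ i → K i i) (λ j → K j j))
        (sum-mono-≤ λ i → sum-mono-≤ λ j →
          ≤-respˡ (sym (*-cong (h i j) (h i j))) (≤-respʳ (sym (*-cong (h i i) (h j j)))
            (cauchy-schwarz-dot (λ k → G k i) (λ k → G k j)))))

    -- Cauchy-Schwarz for the diagonal against the constant vector 1, after which the squares of the
    -- diagonal are bounded by those of all entries.
    powerTrace-super : ∀ l → powerTrace l * powerTrace l ≤ (d ℕ× 1#) * powerTrace (l ℕ.+ l)
    powerTrace-super l = let K = l ↑ H in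
      ≤-respˡ (*-cong (unit (λ i → K i i)) (unit (λ i → K i i)))
      (≤-trans (cauchy-schwarz-dot (λ _ → 1#) (λ i → K i i))
      (≤-respˡ (*-congʳ (sym (trans (unit {d} (λ _ → 1#)) (sum-replicate d))))
      (*-monoˡ-≤ (0≤n× d) (≤-respʳ (sym (powerTrace-double l))
        (sum-mono-≤ (λ i → term≤sum {f = λ j → K i j * K i j} (λ j → 0≤x² (K i j)) i))))))
      where
      unit : ∀ {n} (f : Fin n → Carrier) → dot (λ _ → 1#) f ≈ sum f
      unit f = sum-cong-≋ (λ i → *-identityˡ (f i))

    module _ (x ι : Carrier) (0≤x : 0# ≤ x) (xι≈1 : x * ι ≈ 1#)
      (lower : ∀ j → x ^ pow2 j ≤ powerTrace (pow2 j))
      (upper : ∀ j → powerTrace (pow2 j) ≤ (d ℕ× 1#) * x ^ pow2 j) where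
      open SetoidReasoning setoid

      private
        N = d ℕ× 1#
        0≤ι : 0# ≤ ι
        0≤ι = inverse-nonNeg 0≤x xι≈1

      ι^*x^ : ∀ l → ι ^ l * x ^ l ≈ 1#
      ι^*x^ zero    = *-identityˡ 1#
      ι^*x^ (suc l) = trans
        (solve 4 (λ i p x q → (i :* p) :* (x :* q) := (x :* i) :* (p :* q)) refl ι (ι ^ l) x (x ^ l))
        (trans (*-cong xι≈1 (ι^*x^ l)) (*-identityˡ 1#))

      shifted : Mat d d
      shifted i j = x * δ i j - H i j

      -- With C = (x - H)⁻¹, the numbers σ l = trace (C (H/x)^l) satisfy
      -- σ l - σ (l + 1) = trace ((H/x)^l) / x, which is at least 1/x at the powers
      -- of two, although σ is bounded there.
      not-leftInvertible : ¬ HasLeftInverse shifted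
      -- Multiplying `drops-bounded (suc n)` by `x` gives n + 1 ≤ c x, whereas `n` was chosen with c
      -- x ≤ n.
      not-leftInvertible (C , CB≈δ) = 1≰0 (≤-respˡ cancel-n (≤-respʳ (-‿inverseʳ n1) (+-monoˡ-≤ (- n1)
          (≤-trans (≤-respˡ (trans (*-assoc (suc n ℕ× 1#) ι x)
            (trans (*-congˡ (trans (*-comm ι x) xι≈1)) (*-identityʳ _)))
            (*-monoʳ-≤ 0≤x (drops-bounded (suc n)))) c≤n))))
        where
        s σ : ℕ → Carrier
        s l = trace (C ⊗ (l ↑ H))
        σ l = ι ^ l * s l
        shifted-⊗ : ∀ (X : Mat d d) i j → (shifted ⊗ X) i j ≈ x * X i j - (H ⊗ X) i j
        shifted-⊗ X i j = trans (dot-sub (λ k → x * δ i k) (H i) (λ k → X k j))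
          (+-congʳ (trans (dot-scale x (δ i) (λ k → X k j)) (*-congˡ (dot-δ i (λ k → X k j)))))
        -- Insert C (x - H) in front of the power, reassociate and expand; H times the l-th power is
        -- by definition the next one.
        s-step : ∀ l → powerTrace l ≈ x * s l - s (suc l)
        s-step l = begin
          trace X
            ≈⟨ sum-cong-≋ (λ i → sym (M.trans (M.∙-congʳ {X} CB≈δ) (M.identityˡ X) i i)) ⟩
          trace ((C ⊗ shifted) ⊗ X)
            ≈⟨ sum-cong-≋ (λ i → M.assoc C shifted X i i) ⟩
          trace (C ⊗ (shifted ⊗ X))
            ≈⟨ sum-cong-≋ (λ i → dot-cong {f = C i} (λ _ → refl) (λ k → shifted-⊗ X k i)) ⟩
          sum (λ i → dot (C i) (λ k → x * X k i - (H ⊗ X) k i))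
            ≈⟨ sum-cong-≋ (λ i → trans (dot-subʳ (C i) (λ k → x * X k i) (λ k → (H ⊗ X) k i))
                 (+-congʳ (dot-scaleʳ x (C i) (λ k → X k i)))) ⟩
          sum (λ i → x * (C ⊗ X) i i - (C ⊗ (H ⊗ X)) i i)
            ≈⟨ sum-sub (λ i → x * (C ⊗ X) i i) (λ i → (C ⊗ (H ⊗ X)) i i) ⟩
          sum (λ i → x * (C ⊗ X) i i) - s (suc l)
            ≈⟨ +-congʳ (sym (*-distribˡ-sum x (λ i → (C ⊗ X) i i))) ⟩
          x * s l - s (suc l) ∎
          where X = l ↑ H
        σ-step : ∀ l → σ (suc l) + ι * (ι ^ l * powerTrace l) ≈ σ l
        σ-step l = begin
          ι * ι ^ l * s (suc l) + ι * (ι ^ l * powerTrace l)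
            ≈⟨ +-congˡ (*-congˡ (*-congˡ (s-step l))) ⟩
          ι * ι ^ l * s (suc l) + ι * (ι ^ l * (x * s l - s (suc l)))
            ≈⟨ solve 5 (λ i p a b x → i :* p :* b :+ i :* (p :* (x :* a :- b)) := x :* i :* (p :* a))
                 refl ι (ι ^ l) (s l) (s (suc l)) x ⟩
          x * ι * σ l
            ≈⟨ trans (*-congʳ xι≈1) (*-identityˡ (σ l)) ⟩
          σ l ∎
        σ-anti : ∀ l → σ (suc l) ≤ σ l
        σ-anti l = ≤-witness (0≤x*y 0≤ι (0≤x*y (0≤^ 0≤ι l) (0≤powerTrace l))) (σ-step l)
        σ-anti′ : ∀ {k l} → k ℕ.≤′ l → σ l ≤ σ k
        σ-anti′ ℕ.≤′-refl = ≤-refl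
        σ-anti′ (ℕ.≤′-step {l} h) = ≤-trans (σ-anti l) (σ-anti′ h)
        -- Only the first step after 2^j is counted: `lower j` makes it lose at least `ι`, and the
        -- steps up to 2^(j+1) cannot increase `σ`.
        σ-drop : ∀ j → σ (pow2 (suc j)) + ι ≤ σ (pow2 j)
        σ-drop j = ≤-respʳ (σ-step (pow2 j)) (+-mono-≤
          (σ-anti′ (ℕ.≤⇒≤′ (ℕ.+-monoˡ-≤ (pow2 j) (1≤pow2 j))))
          (≤-respˡ (*-identityʳ ι) (*-monoˡ-≤ 0≤ι (≤-respˡ (ι^*x^ (pow2 j))
            (*-monoˡ-≤ (0≤^ 0≤ι (pow2 j)) (lower j))))))
          where
          1≤pow2 : ∀ j → 1 ℕ.≤ pow2 j
          1≤pow2 zero    = ℕ.≤-refl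
          1≤pow2 (suc j) = ℕ.≤-trans (1≤pow2 j) (ℕ.m≤m+n (pow2 j) (pow2 j))
        σ-drops : ∀ j → σ (pow2 j) + (j ℕ× 1#) * ι ≤ σ 1
        σ-drops zero    = ≤-reflexive (trans (+-congˡ (zeroˡ ι)) (+-identityʳ (σ 1)))
        σ-drops (suc j) = ≤-trans (≤-respˡ
          (solve 3 (λ a i k → a :+ i :+ k :* i := a :+ (:1 :+ k) :* i) refl (σ (pow2 (suc j))) ι
            (j ℕ× 1#))
          (+-monoˡ-≤ ((j ℕ× 1#) * ι) (σ-drop j))) (σ-drops j)
        -- Expand the squared Frobenius norm of C + q X, where X is the power and q = ι^p. The cross
        -- term is 2 q trace (C X) because X is symmetric, and q² ‖X‖² is q² times the trace of the
        -- next doubled power, at most N by `upper`.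
        σ-bounded : ∀ j → 0# ≤ normSq C + N + (σ (pow2 j) + σ (pow2 j))
        σ-bounded j = ≤-trans
          (0≤sum (λ a → 0≤sum (λ b → 0≤x² (C a b + q * X a b))))
          (≤-respˡ (sym expand) (+-monoˡ-≤ (σ p + σ p) (+-monoʳ-≤ (normSq C)
            (≤-respʳ N-cancel (*-monoˡ-≤ (0≤x² q) (≤-respˡ (powerTrace-double p) (upper (suc j))))))))
          where
          p = pow2 j
          X = p ↑ H
          q = ι ^ p
          N-cancel : q * q * (N * x ^ pow2 (suc j)) ≈ N
          N-cancel = begin
            q * q * (N * x ^ pow2 (suc j))
              ≈⟨ *-congˡ (*-congˡ (^-pow2-suc x j)) ⟩
            q * q * (N * (x ^ p * x ^ p))
              ≈⟨ solve 3 (λ q n y → q :* q :* (n :* (y :* y)) := n :* ((q :* y) :* (q :* y))) refl q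
                N (x ^ p) ⟩
            N * ((q * x ^ p) * (q * x ^ p))
              ≈⟨ *-congˡ (trans (*-cong (ι^*x^ p) (ι^*x^ p)) (*-identityˡ 1#)) ⟩
            N * 1#
              ≈⟨ *-identityʳ N ⟩
            N ∎
          expand : sum (λ a → sum (λ b → (C a b + q * X a b) * (C a b + q * X a b)))
                   ≈ normSq C + q * q * normSq X + (σ p + σ p)
          expand = begin
            sum (λ a → sum (λ b → (C a b + q * X a b) * (C a b + q * X a b)))
              ≈⟨ sum-cong-≋ (λ a → trans (sum-cong-≋ (λ b → trans
                   (solve 3 (λ c q x → (c :+ q :* x) :* (c :+ q :* x)
                     := c :* c :+ q :* q :* (x :* x) :+ (q :+ q) :* (c :* x)) refl (C a b) q (X a b))
                   (+-congˡ (*-congˡ (*-congˡ (power-symmetric p a b))))))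
                   (trans (∑-distrib-+ (λ b → C a b * C a b + q * q * (X a b * X a b))
                     (λ b → (q + q) * (C a b * X b a)))
                     (+-cong (trans (∑-distrib-+ (λ b → C a b * C a b) (λ b → q * q * (X a b * X a b)))
                       (+-congˡ (sym (*-distribˡ-sum (q * q) (λ b → X a b * X a b)))))
                       (sym (*-distribˡ-sum (q + q) (λ b → C a b * X b a)))))) ⟩
            sum (λ a → dot (C a) (C a) + q * q * dot (X a) (X a) + (q + q) * (C ⊗ X) a a)
              ≈⟨ trans (∑-distrib-+ (λ a → dot (C a) (C a) + q * q * dot (X a) (X a))
                (λ a → (q + q) * (C ⊗ X) a a))
                   (+-cong (trans (∑-distrib-+ (λ a → dot (C a) (C a)) (λ a → q * q * dot (X a) (X a)))
                     (+-congˡ (sym (*-distribˡ-sum (q * q) (λ a → dot (X a) (X a))))))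
                     (sym (*-distribˡ-sum (q + q) (λ a → (C ⊗ X) a a)))) ⟩
            normSq C + q * q * normSq X + (q + q) * s p
              ≈⟨ +-congˡ (distribʳ (s p) q q) ⟩
            normSq C + q * q * normSq X + (σ p + σ p) ∎
        -- The drops j ι total at most σ 1 - σ (2^j), and -2 σ (2^j) ≤ ‖C‖² + N. So `c` bounds even
        -- twice j ι, and one copy is discarded.
        c : Carrier
        c = normSq C + N + (σ 1 + σ 1)
        drops-bounded : ∀ j → (j ℕ× 1#) * ι ≤ c
        drops-bounded j = ≤-witness (0≤x+y (0≤x*y (0≤n× j) 0≤ι) (0≤x+y (σ-bounded j) (0≤x+y gap gap)))
          (solve 4 (λ k t a b → k :+ (k :+ (t :+ (a :+ a) :+ (b :- (a :+ k) :+ (b :- (a :+ k))))) :=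
            t :+ (b :+ b))
            refl ((j ℕ× 1#) * ι) (normSq C + N) (σ (pow2 j)) (σ 1))
          where gap = x≤y⇒0≤y-x (σ-drops j)
        n : ℕ
        n = proj₁ (archimedean (c * x))
        n1 : Carrier
        n1 = n ℕ× 1#
        c≤n : c * x ≤ n1
        c≤n = proj₂ (archimedean (c * x))
        cancel-n : (suc n ℕ× 1#) - n1 ≈ 1#
        cancel-n = solve 1 (λ k → :1 :+ k :- k := :1) refl n1

    -- Here `y` is the mean of the diagonal of H. Its invertibility excludes x ≈ 0, and thereby
    -- provides the inverse of `x` on which the argument against a left inverse of x - H rests. Only
    -- the eigenvector is double-negated.
    largeEigenvalue : ∀ N⁻¹ → 1# ≤ d ℕ× 1# → (d ℕ× 1#) * N⁻¹ ≈ 1# →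
      ∀ y → 0# ≤ y → (∃ λ z → y * z ≈ 1#) → (d ℕ× 1#) * y ≈ normSq A →
      ∃ λ x → y ≤ x × ¬ ¬ (∃ λ (v : Fin d → Carrier) → (∃ λ j → v j ≈ 1#) × ∀ i → dot (H i) v ≈ x * v i)
    largeEigenvalue N⁻¹ 1≤N NN⁻¹≈1 y 0≤y (z , yz≈1) Ny≈‖A‖ = x , y≤x , λ k → zero-or-inverse x
      [ (λ x≈0 → 1≰0 (≤-respˡ yz≈1 (≤-respʳ (trans (*-congʳ x≈0) (zeroˡ z))
        (*-monoʳ-≤ (inverse-nonNeg 0≤y yz≈1) y≤x))))
      , (λ (ι , xι≈1) → kernel-or-leftInverse (shifted x ι 0≤x xι≈1 lower upper)
          [ (λ (v , nz , Bv≈0) → k (v , nz , λ i → begin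
              dot (H i) v
                ≈⟨ solve 2 (λ a b → b := a :- (a :- b)) refl (x * v i) (dot (H i) v) ⟩
              x * v i - (x * v i - dot (H i) v)
                ≈⟨ +-congˡ (-‿cong (trans (sym (trans (dot-sub (λ j → x * δ i j) (H i) v)
                     (+-congʳ (trans (dot-scale x (δ i) v) (*-congˡ (dot-δ i v)))))) (Bv≈0 i))) ⟩
              x * v i - 0#
                ≈⟨ trans (+-congˡ (trans (sym (+-identityˡ (- 0#))) (-‿inverseʳ 0#))) (+-identityʳ _) ⟩
              x * v i ∎))
          , not-leftInvertible x ι 0≤x xι≈1 lower upper
          ]′)
      ]′
      where
      open SetoidReasoning setoid
      N = d ℕ× 1#
      rate = growthRate powerTrace N N⁻¹ 1≤N NN⁻¹≈1
               0≤powerTrace powerTrace-sub powerTrace-super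
      x = proj₁ rate
      lower = proj₁ (proj₂ (proj₂ rate))
      upper = proj₂ (proj₂ (proj₂ rate))
      trace≈ : powerTrace 1 ≈ normSq A
      trace≈ = trans (sum-cong-≋ (λ i → M.identityʳ H i i)) (∑-comm (λ i k → A k i * A k i))
      y≤x : y ≤ x
      y≤x = ≤-respˡ (begin
        N⁻¹ * powerTrace 1   ≈⟨ *-congˡ (trans trace≈ (sym Ny≈‖A‖)) ⟩
        N⁻¹ * (N * y)        ≈⟨ trans (sym (*-assoc _ _ _)) (*-congʳ (trans (*-comm _ _) NN⁻¹≈1)) ⟩
        1# * y                              ≈⟨ *-identityˡ y ⟩
        y                                   ∎)
        (proj₁ (proj₂ rate))
      0≤x : 0# ≤ x
      0≤x = ≤-trans 0≤y y≤x

  -- Complex matrices as real ones of twice the size; Schur's test.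

  module Realification where
    open SetoidReasoning setoid

    sum-++ : ∀ m {n} (f : Fin (m ℕ.+ n) → Carrier) →
             sum f ≈ sum (λ i → f (i ↑ˡ n)) + sum (λ j → f (m ↑ʳ j))
    sum-++ zero    f = sym (+-identityˡ (sum f))
    sum-++ (suc m) f = trans (+-congˡ (sum-++ m (f ∘ suc))) (sym (+-assoc _ _ _))

    sum-join : ∀ {n} (f : Fin n ⊎ Fin n → Carrier) →
               sum (f ∘ splitAt n) ≈ sum (f ∘ inj₁) + sum (f ∘ inj₂)
    sum-join {n} f = trans (sum-++ n (f ∘ splitAt n)) (+-cong
      (sum-cong-≋ (λ i → reflexive (≡.cong f (Fin.splitAt-↑ˡ n i n))))
      (sum-cong-≋ (λ j → reflexive (≡.cong f (Fin.splitAt-↑ʳ n n j)))))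

    energy : ∀ {n} (a b : Fin n → Carrier) → Carrier
    energy a b = sum (λ i → a i * a i + b i * b i)

    module _ {n} (X Y : Mat n n) where

      -- The real 2n × 2n matrix of v ↦ (X + iY) v on ℝⁿ ⊕ iℝⁿ.
      blocks : Fin n ⊎ Fin n → Fin n ⊎ Fin n → Carrier
      blocks (inj₁ i) (inj₁ j) = X i j
      blocks (inj₁ i) (inj₂ j) = - Y i j
      blocks (inj₂ i) (inj₁ j) = Y i j
      blocks (inj₂ i) (inj₂ j) = X i j

      realify : Mat (n ℕ.+ n) (n ℕ.+ n)
      realify I J = blocks (splitAt n I) (splitAt n J)

      -- Real and imaginary part of AᴴA for A = X + iY, left in the shape to which `conj` and `_*ᶜ_`
      -- unfold. For the same reason the products with `0#` stay in the eigenvector equations.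
      gramRe gramIm : Mat n n
      gramRe i j = sum (λ l → X l i * X l j - (- Y l i) * Y l j)
      gramIm i j = sum (λ l → X l i * Y l j + (- Y l i) * X l j)

      IsComplexEigenvector : Carrier → (a b : Fin n → Carrier) → Set
      IsComplexEigenvector μ a b = ∀ i →
        sum (λ j → gramRe i j * a j - gramIm i j * b j) ≈ μ * a i - 0# * b i ×
        sum (λ j → gramRe i j * b j + gramIm i j * a j) ≈ μ * b i + 0# * a i

      private
        -- The entries of the Gram matrix of `realify`, indexed by blocks. Computing its four blocks
        -- shows that it is the realification of AᴴA.
        K : Fin n ⊎ Fin n → Fin n ⊎ Fin n → Carrier
        K p q = sum (λ l → blocks (inj₁ l) p * blocks (inj₁ l) q) + sum (λ l → blocks (inj₂ l) p *
          blocks (inj₂ l) q)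

        K₁₁ : ∀ i j → K (inj₁ i) (inj₁ j) ≈ gramRe i j
        K₁₁ i j = trans (sym (∑-distrib-+ (λ l → X l i * X l j) (λ l → Y l i * Y l j)))
          (sum-cong-≋ (λ l → solve 4 (λ a b c d → a :* b :+ c :* d := a :* b :- (:- c) :* d) refl
            (X l i) (X l j) (Y l i) (Y l j)))

        K₁₂ : ∀ i j → K (inj₁ i) (inj₂ j) ≈ - gramIm i j
        K₁₂ i j = trans (sym (∑-distrib-+ (λ l → X l i * (- Y l j)) (λ l → Y l i * X l j)))
          (trans (sum-cong-≋ (λ l → solve 4 (λ a b c d → a :* (:- d) :+ c :* b := :-
            (a :* d :+ (:- c) :* b)) refl (X l i) (X l j) (Y l i) (Y l j)))
            (sum-neg (λ l → X l i * Y l j + (- Y l i) * X l j)))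

        K₂₁ : ∀ i j → K (inj₂ i) (inj₁ j) ≈ gramIm i j
        K₂₁ i j = trans (sym (∑-distrib-+ (λ l → (- Y l i) * X l j) (λ l → X l i * Y l j)))
          (sum-cong-≋ (λ l → +-comm (- Y l i * X l j) (X l i * Y l j)))

        K₂₂ : ∀ i j → K (inj₂ i) (inj₂ j) ≈ gramRe i j
        K₂₂ i j = trans (sym (∑-distrib-+ (λ l → (- Y l i) * (- Y l j)) (λ l → X l i * X l j)))
          (sum-cong-≋ (λ l → solve 4 (λ a b c d → (:- c) :* (:- d) :+ a :* b := a :* b :- (:- c) :*
            d) refl (X l i) (X l j) (Y l i) (Y l j)))

      pair : (a b : Fin n → Carrier) → Fin (n ℕ.+ n) → Carrier
      pair a b I = [ a , b ]′ (splitAt n I)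

      private
        gram-row : ∀ (a b : Fin n → Carrier) I → dot ((transpose realify ⊗ realify) I) (pair a b)
          ≈ sum (λ j → K (splitAt n I) (inj₁ j) * a j) + sum (λ j → K (splitAt n I) (inj₂ j) * b j)
        gram-row a b I = trans
          (sum-cong-≋ (λ J → *-congʳ (sum-join (λ s → blocks s (splitAt n I) * blocks s
            (splitAt n J)))))
          (sum-join (λ q → K (splitAt n I) q * [ a , b ]′ q))

        row₁ : ∀ (a b : Fin n → Carrier) i →
               sum (λ j → K (inj₁ i) (inj₁ j) * a j) + sum (λ j → K (inj₁ i) (inj₂ j) * b j)
               ≈ sum (λ j → gramRe i j * a j - gramIm i j * b j)
        row₁ a b i = trans (+-cong (sum-cong-≋ (λ j → *-congʳ (K₁₁ i j)))
            (sum-cong-≋ (λ j → trans (*-congʳ (K₁₂ i j)) (solve 2 (λ g b → (:- g) :* b := :-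
              (g :* b)) refl (gramIm i j) (b j)))))
          (sym (∑-distrib-+ (λ j → gramRe i j * a j) (λ j → - (gramIm i j * b j))))

        row₂ : ∀ (a b : Fin n → Carrier) i →
               sum (λ j → K (inj₂ i) (inj₁ j) * a j) + sum (λ j → K (inj₂ i) (inj₂ j) * b j)
               ≈ sum (λ j → gramRe i j * b j + gramIm i j * a j)
        row₂ a b i = trans (+-cong (sum-cong-≋ (λ j → *-congʳ (K₂₁ i j)))
          (sum-cong-≋ (λ j → *-congʳ (K₂₂ i j))))
          (trans (+-comm _ _) (sym (∑-distrib-+ (λ j → gramRe i j * b j) (λ j → gramIm i j * a j))))

        x-0y : ∀ x y → x - 0# * y ≈ x
        x-0y x y = trans (+-congˡ (-‿cong (trans (zeroˡ y) (sym (-‿inverseʳ 0#)))))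
          (trans (solve 2 (λ x z → x :- (z :- z) := x) refl x 0#) refl)

        x+0y : ∀ x y → x + 0# * y ≈ x
        x+0y x y = trans (+-congˡ (zeroˡ y)) (+-identityʳ x)

      realEigen⇒complexEigen : ∀ μ (v : Fin (n ℕ.+ n) → Carrier) →
        (∀ I → dot ((transpose realify ⊗ realify) I) v ≈ μ * v I) →
        IsComplexEigenvector μ (λ i → v (i ↑ˡ n)) (λ i → v (n ↑ʳ i))
      realEigen⇒complexEigen μ v h i =
        trans (sym (row₁ a b i)) (trans (at (inj₁ i)) (sym (x-0y _ _))) ,
        trans (sym (row₂ a b i)) (trans (at (inj₂ i)) (sym (x+0y _ _)))
        where
        a = λ i → v (i ↑ˡ n)
        b = λ i → v (n ↑ʳ i)
        v≡pair : ∀ I → pair a b I ≡.≡ v I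
        v≡pair I = ≡.trans (go (splitAt n I)) (≡.cong v (Fin.join-splitAt n n I))
          where
          go : ∀ s → [ a , b ]′ s ≡.≡ v (join n n s)
          go (inj₁ i) = ≡.refl
          go (inj₂ i) = ≡.refl
        at : ∀ s → sum (λ j → K s (inj₁ j) * a j) + sum (λ j → K s (inj₂ j) * b j) ≈ μ * v (join n n s)
        at s = begin
          sum (λ j → K s (inj₁ j) * a j) + sum (λ j → K s (inj₂ j) * b j)
            ≡⟨ ≡.cong (λ s → sum (λ j → K s (inj₁ j) * a j) + sum (λ j → K s (inj₂ j) * b j))
              (Fin.splitAt-join n n s) ⟨
          sum (λ j → K s′ (inj₁ j) * a j) + sum (λ j → K s′ (inj₂ j) * b j)
            ≈⟨ gram-row a b (join n n s) ⟨
          dot ((transpose realify ⊗ realify) (join n n s)) (pair a b)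
            ≈⟨ dot-cong {f = (transpose realify ⊗ realify) (join n n s)} (λ _ → refl)
              (λ I → reflexive (v≡pair I)) ⟩
          dot ((transpose realify ⊗ realify) (join n n s)) v
            ≈⟨ h (join n n s) ⟩
          μ * v (join n n s) ∎
          where s′ = splitAt n (join n n s)

      complexEigen⇒realEigen : ∀ μ a b → IsComplexEigenvector μ a b →
        ∀ I → dot ((transpose realify ⊗ realify) I) (pair a b) ≈ μ * pair a b I
      complexEigen⇒realEigen μ a b h I = trans (gram-row a b I) (at (splitAt n I))
        where
        at : ∀ s → sum (λ j → K s (inj₁ j) * a j) + sum (λ j → K s (inj₂ j) * b j) ≈ μ * [ a , b ]′ s
        at (inj₁ i) = trans (row₁ a b i) (trans (proj₁ (h i)) (x-0y _ _))
        at (inj₂ i) = trans (row₂ a b i) (trans (proj₂ (h i)) (x+0y _ _))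

      -- Each entry of X and Y occurs in two blocks, up to sign.
      normSq-realify : normSq realify ≈ sum (λ i → sum (λ j → X i j * X i j + Y i j * Y i j))
                                        + sum (λ i → sum (λ j → X i j * X i j + Y i j * Y i j))
      normSq-realify = trans
        (sum-cong-≋ (λ I → sum-join (λ q → blocks (splitAt n I) q * blocks (splitAt n I) q)))
        (trans (sum-join (λ p → sum (λ j → blocks p (inj₁ j) * blocks p (inj₁ j)) + sum
          (λ j → blocks p (inj₂ j) * blocks p (inj₂ j))))
          (+-cong
            (sum-cong-≋ (λ i → trans (sym (∑-distrib-+ (λ j → X i j * X i j) (λ j → (- Y i j) *
              (- Y i j))))
              (sum-cong-≋ (λ j → +-congˡ (solve 1 (λ y → (:- y) :* (:- y) := y :* y) refl (Y i j))))))
            (sum-cong-≋ (λ i → trans (+-comm _ _) (sym (∑-distrib-+ (λ j → X i j * X i j)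
              (λ j → Y i j * Y i j)))))))

      applyRe applyIm : (a b : Fin n → Carrier) → Fin n → Carrier
      applyRe a b i = sum (λ j → X i j * a j - Y i j * b j)
      applyIm a b i = sum (λ j → X i j * b j + Y i j * a j)

      eigen-energy : ∀ μ a b → IsComplexEigenvector μ a b →
        μ * energy a b ≈ energy (applyRe a b) (applyIm a b)
      eigen-energy μ a b h = begin
        μ * energy a b
          ≈⟨ *-congˡ (trans (∑-distrib-+ (λ i → a i * a i) (λ i → b i * b i))
            (sym (sum-join (λ s → [ a , b ]′ s * [ a , b ]′ s)))) ⟩
        μ * dot u u
          ≈⟨ dot-scaleʳ μ u u ⟨
        dot u (λ I → μ * u I)
          ≈⟨ dot-cong {f = u} (λ _ → refl) (λ I → complexEigen⇒realEigen μ a b h I) ⟨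
        dot u (λ I → dot ((transpose A ⊗ A) I) u)
          ≈⟨ dot-cong {f = u} (λ _ → refl) (λ I → dot-assoc (transpose A I) A u) ⟩
        dot u (λ I → dot (transpose A I) Au)
          ≈⟨ dot-assoc u (transpose A) Au ⟨
        dot (λ L → dot u (λ I → A L I)) Au
          ≈⟨ dot-cong {g = Au} (λ L → dot-comm u (A L)) (λ _ → refl) ⟩
        dot Au Au
          ≈⟨ dot-cong (λ L → apply (splitAt n L)) (λ L → apply (splitAt n L)) ⟩
        dot (pair (applyRe a b) (applyIm a b)) (pair (applyRe a b) (applyIm a b))
          ≈⟨ sum-join (λ s → [ applyRe a b , applyIm a b ]′ s * [ applyRe a b , applyIm a b ]′ s) ⟩
        sum (λ i → applyRe a b i * applyRe a b i) + sum (λ i → applyIm a b i * applyIm a b i)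
          ≈⟨ ∑-distrib-+ (λ i → applyRe a b i * applyRe a b i) (λ i → applyIm a b i * applyIm a b i) ⟨
        energy (applyRe a b) (applyIm a b) ∎
        where
        A = realify
        u = pair a b
        Au : Fin (n ℕ.+ n) → Carrier
        Au L = dot (A L) u
        apply : ∀ s → sum (λ J → blocks s (splitAt n J) * u J) ≈ [ applyRe a b , applyIm a b ]′ s
        apply (inj₁ i) = trans (sum-join (λ q → blocks (inj₁ i) q * [ a , b ]′ q))
          (trans (+-congˡ (sum-cong-≋ (λ j → solve 2 (λ y b → (:- y) :* b := :- (y :* b)) refl
            (Y i j) (b j))))
            (sym (∑-distrib-+ (λ j → X i j * a j) (λ j → - (Y i j * b j)))))
        apply (inj₂ i) = trans (sum-join (λ q → blocks (inj₂ i) q * [ a , b ]′ q))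
          (trans (+-comm _ _) (sym (∑-distrib-+ (λ j → X i j * b j) (λ j → Y i j * a j))))

    square≤0⇒≈0 : ∀ {x} → x * x ≤ 0# → x ≈ 0#
    square≤0⇒≈0 {x} h = ≤-antisym
      (square-cancel-≤ ≤-refl (≤-respʳ (sym (zeroˡ 0#)) h))
      (0≤y-x⇒x≤y (≤-respʳ (sym (+-congˡ -0≈0)) (≤-respʳ (sym (+-identityʳ x))
        (≤-respʳ (-‿involutive x) (x≤0⇒0≤-x (square-cancel-≤ ≤-refl (≤-respʳ (sym (zeroˡ 0#))
          (≤-respˡ (solve 1 (λ x → x :* x := (:- x) :* (:- x)) refl x) h))))))))
      where
      -0≈0 : - 0# ≈ 0#
      -0≈0 = trans (sym (+-identityˡ (- 0#))) (-‿inverseʳ 0#)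

    -- Schur's test, for the complex matrix with entries p (cx + i cy).
    schurTest : ∀ {n} (X Y p cx cy : Mat n n) S M² →
      (∀ i j → X i j ≈ p i j * cx i j) → (∀ i j → Y i j ≈ p i j * cy i j) →
      (∀ i j → 0# ≤ p i j) → 0# ≤ S →
      (∀ i → sum (λ j → p i j) ≤ S) → (∀ j → sum (λ i → p i j) ≤ S) →
      (∀ i j → cx i j * cx i j + cy i j * cy i j ≤ M²) →
      ∀ a b → energy (applyRe X Y a b) (applyIm X Y a b) ≤ S * (S * M²) * energy a b
    schurTest {n} X Y p cx cy S M² X≈ Y≈ 0≤p 0≤S rows cols c≤ a b =
      -- The row sums enter through `row-bound`; exchanging the order of summation leaves the column
      -- sums.
      ≤-trans (sum-mono-≤ row-bound)
        (≤-respˡ (*-distribˡ-sum S (λ i → sum (λ j → p i j * (M² * e j))))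
          (≤-respʳ (sym (*-assoc S (S * M²) _)) (*-monoˡ-≤ 0≤S
        (≤-respˡ (sym (∑-comm (λ i j → p i j * (M² * e j)))) (≤-respʳ (sym (*-distribˡ-sum (S * M²) e))
          (sum-mono-≤ (λ j → ≤-respˡ (*-distribʳ-sum (M² * e j) (λ i → p i j))
            (≤-respʳ (sym (*-assoc S M² (e j)))
            (*-monoʳ-≤ (0≤x*y (0≤M² j) (0≤e j)) (cols j))))))))))
      where
      e : Fin n → Carrier
      e j = a j * a j + b j * b j
      0≤e : ∀ j → 0# ≤ e j
      0≤e j = 0≤x+y (0≤x² (a j)) (0≤x² (b j))
      -- Nonnegativity is read off from the diagonal coefficient at `j`, so an index has to be
      -- supplied.
      0≤M² : ∀ (j : Fin n) → 0# ≤ M²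
      0≤M² j = ≤-trans (0≤x+y (0≤x² (cx j j)) (0≤x² (cy j j))) (c≤ j j)
      -- Cauchy-Schwarz with weights `p i` for the vectors 1 and `z`; the factor belonging to 1 is a
      -- row sum.
      weighted : ∀ i (z : Fin n → Carrier) →
        sum (λ j → p i j * z j) * sum (λ j → p i j * z j) ≤ S * sum (λ j → p i j * (z j * z j))
      weighted i z = ≤-respˡ (*-cong one-z one-z) (≤-trans (cauchy-schwarz (p i) (λ _ → 1#) z (0≤p i))
        (*-monoʳ-≤ (0≤sum (λ j → 0≤x*y (0≤p i j) (0≤x² (z j))))
          (≤-respˡ (sum-cong-≋ (λ j → sym (trans (*-congˡ (*-identityˡ 1#)) (*-identityʳ (p i j)))))
            (rows i))))
        where
        one-z : sum (λ j → p i j * (1# * z j)) ≈ sum (λ j → p i j * z j)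
        one-z = sum-cong-≋ (λ j → *-congˡ (*-identityˡ (z j)))
      re im : Fin n → Fin n → Carrier
      re i j = cx i j * a j - cy i j * b j
      im i j = cx i j * b j + cy i j * a j
      applyRe≈ : ∀ i → applyRe X Y a b i ≈ sum (λ j → p i j * re i j)
      applyRe≈ i = sum-cong-≋ (λ j → trans (+-cong (*-congʳ (X≈ i j)) (-‿cong (*-congʳ (Y≈ i j))))
        (solve 5 (λ p c d a b → p :* c :* a :- p :* d :* b := p :* (c :* a :- d :* b)) refl (p i j)
          (cx i j) (cy i j) (a j) (b j)))
      applyIm≈ : ∀ i → applyIm X Y a b i ≈ sum (λ j → p i j * im i j)
      applyIm≈ i = sum-cong-≋ (λ j → trans (+-cong (*-congʳ (X≈ i j)) (*-congʳ (Y≈ i j)))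
        (solve 5 (λ p c d a b → p :* c :* b :+ p :* d :* a := p :* (c :* b :+ d :* a)) refl (p i j)
          (cx i j) (cy i j) (a j) (b j)))
      row-bound : ∀ i → applyRe X Y a b i * applyRe X Y a b i + applyIm X Y a b i * applyIm X Y a b i
                  ≤ S * sum (λ j → p i j * (M² * e j))
      row-bound i = ≤-trans
        (+-mono-≤ (≤-respˡ (sym (*-cong (applyRe≈ i) (applyRe≈ i))) (weighted i (re i)))
                  (≤-respˡ (sym (*-cong (applyIm≈ i) (applyIm≈ i))) (weighted i (im i))))
        (≤-respˡ (trans (*-congˡ (∑-distrib-+ (λ j → p i j * (re i j * re i j)) (λ j → p i j *
          (im i j * im i j)))) (distribˡ S _ _))
          (*-monoˡ-≤ 0≤S (sum-mono-≤ (λ j → ≤-respˡ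
            -- Multiplicativity of the squared modulus, in real coordinates.
            (solve 5 (λ p c d a b → p :* ((c :* c :+ d :* d) :* (a :* a :+ b :* b))
              := p :* ((c :* a :- d :* b) :* (c :* a :- d :* b)) :+ p :* ((c :* b :+ d :* a) :*
                (c :* b :+ d :* a)))
              refl (p i j) (cx i j) (cy i j) (a j) (b j))
            (*-monoˡ-≤ (0≤p i j) (*-monoʳ-≤ (0≤e j) (c≤ i j)))))))

    -- Divide `eigen-energy` by the energy of the eigenvector, which could vanish only if the vector
    -- did.
    eigenvalue-≤ : ∀ {n} (X Y : Mat n n) c →
      (∀ a b → energy (applyRe X Y a b) (applyIm X Y a b) ≤ c * energy a b) →
      ∀ μ a b → ¬ (∀ i → a i ≈ 0# × b i ≈ 0#) → IsComplexEigenvector X Y μ a b → μ ≤ c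
    eigenvalue-≤ X Y c h μ a b nz eig = ¬¬-elim (zero-or-inverse (energy a b))
      [ (λ E≈0 → contradiction (λ i →
          square≤0⇒≈0 (≤-trans (x≤x+y (0≤x² (b i))) (≤-respʳ E≈0 (term≤sum 0≤e i))) ,
          square≤0⇒≈0 (≤-trans (≤-respʳ (+-comm _ _) (x≤x+y (0≤x² (a i))))
            (≤-respʳ E≈0 (term≤sum 0≤e i)))) nz)
      , (λ (w , e) → *-cancelʳ-≤ (0≤sum 0≤e) e (≤-respˡ (sym (eigen-energy X Y μ a b eig)) (h a b)))
      ]′
      where
      0≤e : ∀ i → 0# ≤ a i * a i + b i * b i
      0≤e i = 0≤x+y (0≤x² (a i)) (0≤x² (b i))

  open Realification

  -- Row, column and total sums of circulant arrays.

  module CirculantSums where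
    open SetoidReasoning setoid

    ∑< : ℕ → (ℕ → Carrier) → Carrier
    ∑< n f = sum {n} (f ∘ toℕ)

    ∑<-cong : ∀ n {f g} → (∀ i → i ℕ.< n → f i ≈ g i) → ∑< n f ≈ ∑< n g
    ∑<-cong n h = sum-cong-≋ (λ i → h (toℕ i) (Fin.toℕ<n i))

    ∑<-+ : ∀ m n f → ∑< (m ℕ.+ n) f ≈ ∑< m f + ∑< n (λ j → f (m ℕ.+ j))
    ∑<-+ m n f = trans (sum-++ m (f ∘ toℕ)) (+-cong
      (sum-cong-≋ {m} (λ i → reflexive (≡.cong f (Fin.toℕ-↑ˡ i n))))
      (sum-cong-≋ {n} (λ j → reflexive (≡.cong f (Fin.toℕ-↑ʳ m j)))))

    ∑<-const : ∀ n x → ∑< n (λ _ → x) ≈ (n ℕ× 1#) * x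
    ∑<-const n x = trans (sum-replicate n) (n×-* n x)

    ∑<-reverse : ∀ n f → ∑< n (λ i → f (n ∸ suc i)) ≈ ∑< n f
    ∑<-reverse n f = sym (trans (sum-permute {n} {n} (f ∘ toℕ) Perm.reverse)
      (sum-cong-≋ {n} (λ i → reflexive (≡.cong f (Fin.opposite-prop i)))))

    -- The values below the diagonal form a separate sequence `h`, and the type is arbitrary, so
    -- that one shape covers the complex entries, their parts and squares, and the weights and
    -- coefficients of Schur's test.
    circEntry : ∀ {A : Set} → ℕ → (f h : ℕ → A) → ℕ → ℕ → A
    circEntry n f h i j with i ℕ.≤? j
    ... | yes _ = f (j ∸ i)
    ... | no  _ = h (n ℕ.+ j ∸ i)

    circEntry-≤ : ∀ {A : Set} n (f h : ℕ → A) {i j} → i ℕ.≤ j → circEntry n f h i j ≡ f (j ∸ i)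
    circEntry-≤ n f h {i} {j} i≤j with i ℕ.≤? j
    ... | yes _   = ≡.refl
    ... | no  i≰j = contradiction i≤j i≰j

    circEntry-> : ∀ {A : Set} n (f h : ℕ → A) {i j} → j ℕ.< i → circEntry n f h i j ≡ h (n ℕ.+ j ∸ i)
    circEntry-> n f h {i} {j} j<i with i ℕ.≤? j
    ... | yes i≤j = contradiction i≤j (ℕ.<⇒≱ j<i)
    ... | no  _   = ≡.refl

    -- Row i of the circulant holds f l at the offsets l < n - i, and h l elsewhere.
    offset : ℕ → (f h : ℕ → Carrier) → ℕ → ℕ → Carrier
    offset n f h i l with l ℕ.+ i ℕ.<? n
    ... | yes _ = f l
    ... | no  _ = h l

    offset-< : ∀ n f h {i l} → l ℕ.+ i ℕ.< n → offset n f h i l ≡ f l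
    offset-< n f h {i} {l} l+i<n with l ℕ.+ i ℕ.<? n
    ... | yes _     = ≡.refl
    ... | no  l+i≮n = contradiction l+i<n l+i≮n

    offset-≥ : ∀ n f h {i l} → n ℕ.≤ l ℕ.+ i → offset n f h i l ≡ h l
    offset-≥ n f h {i} {l} n≤l+i with l ℕ.+ i ℕ.<? n
    ... | yes l+i<n = contradiction n≤l+i (ℕ.<⇒≱ l+i<n)
    ... | no  _     = ≡.refl

    -- For n = i + d the row is a rotation: its first i entries have offsets d, ..., n - 1 and the
    -- other d have offsets 0, ..., d - 1.
    rowSum : ∀ n f h i → i ℕ.≤ n → ∑< n (circEntry n f h i) ≈ ∑< n (offset n f h i)
    rowSum n f h i i≤n with ℕ.m≤n⇒∃[o]m+o≡n i≤n
    ... | d , ≡.refl = begin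
      ∑< (i ℕ.+ d) (circEntry n f h i)
        ≈⟨ ∑<-+ i d (circEntry n f h i) ⟩
      ∑< i (circEntry n f h i) + ∑< d (λ j → circEntry n f h i (i ℕ.+ j))
        ≈⟨ +-cong
             (∑<-cong i (λ j j<i → reflexive (≡.trans (circEntry-> n f h j<i)
               (≡.trans (≡.cong h (≡.trans (≡.cong (_∸ i) (ℕ.+-assoc i d j)) (ℕ.m+n∸m≡n i (d ℕ.+ j))))
                 (≡.sym (offset-≥ n f h (ℕ.≤-trans (ℕ.≤-reflexive (ℕ.+-comm i d)) (ℕ.+-monoˡ-≤ i
                   (ℕ.m≤m+n d j)))))))))
             (∑<-cong d (λ j j<d → reflexive (≡.trans (circEntry-≤ n f h (ℕ.m≤m+n i j))
               (≡.trans (≡.cong f (ℕ.m+n∸m≡n i j))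
                 (≡.sym (offset-< n f h (ℕ.≤-trans (ℕ.+-monoˡ-< i j<d) (ℕ.≤-reflexive
                   (ℕ.+-comm d i))))))))) ⟩
      ∑< i (λ j → offset n f h i (d ℕ.+ j)) + ∑< d (offset n f h i)
        ≈⟨ +-comm _ _ ⟩
      ∑< d (offset n f h i) + ∑< i (λ j → offset n f h i (d ℕ.+ j))
        ≈⟨ ∑<-+ d i (offset n f h i) ⟨
      ∑< (d ℕ.+ i) (offset n f h i)
        ≡⟨ ≡.cong (λ m → ∑< m (offset n f h i)) (ℕ.+-comm d i) ⟩
      ∑< (i ℕ.+ d) (offset n f h i) ∎

    offset-same : ∀ n f i l → offset n f f i l ≡ f l
    offset-same n f i l with l ℕ.+ i ℕ.<? n
    ... | yes _ = ≡.refl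
    ... | no  _ = ≡.refl

    rowSum-same : ∀ n f i → i ℕ.≤ n → ∑< n (circEntry n f f i) ≈ ∑< n f
    rowSum-same n f i i≤n = trans (rowSum n f f i i≤n) (∑<-cong n (λ l _ → reflexive (offset-same n
      f i l)))

    -- Down the column the offsets are j, ..., 0 followed by n - 1, ..., j + 1; each of the two runs
    -- is reversed.
    columnSum-same : ∀ n f j → j ℕ.< n → ∑< n (λ i → circEntry n f f i j) ≈ ∑< n f
    columnSum-same n f j j<n with ℕ.m≤n⇒∃[o]m+o≡n j<n
    ... | d , ≡.refl = begin
      ∑< (suc j ℕ.+ d) (λ i → circEntry n f f i j)
        ≈⟨ ∑<-+ (suc j) d (λ i → circEntry n f f i j) ⟩
      ∑< (suc j) (λ i → circEntry n f f i j) + ∑< d (λ i → circEntry n f f (suc j ℕ.+ i) j)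
        ≈⟨ +-cong
             (trans (∑<-cong (suc j) (λ i i<j → reflexive (circEntry-≤ n f f (ℕ.≤-pred i<j))))
               (∑<-reverse (suc j) f))
             (trans (∑<-cong d (λ i i<d → reflexive
               (≡.trans (circEntry-> n f f (ℕ.s≤s (ℕ.m≤m+n j i))) (≡.cong f (index i i<d)))))
               (∑<-reverse d (λ i → f (suc j ℕ.+ i)))) ⟩
      ∑< (suc j) f + ∑< d (λ i → f (suc j ℕ.+ i))
        ≈⟨ ∑<-+ (suc j) d f ⟨
      ∑< (suc j ℕ.+ d) f ∎
      where
      index : ∀ i → i ℕ.< d → (suc j ℕ.+ d) ℕ.+ j ∸ (suc j ℕ.+ i) ≡ suc j ℕ.+ (d ∸ suc i)
      index i i<d with ℕ.m≤n⇒∃[o]m+o≡n i<d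
      ... | e , ≡.refl = ≡.trans (≡.cong (_∸ (suc j ℕ.+ i)) regroup)
        (≡.trans (ℕ.m+n∸m≡n (suc j ℕ.+ i) (suc j ℕ.+ e)) (≡.cong (suc j ℕ.+_)
          (≡.sym (ℕ.m+n∸m≡n (suc i) e))))
        where
        regroup : suc j ℕ.+ (suc i ℕ.+ e) ℕ.+ j ≡ (suc j ℕ.+ i) ℕ.+ (suc j ℕ.+ e)
        regroup = CirculantIndex.regroup j i e

    -- Summation by diagonals: the offset l occurs in n - l rows without wrapping and in l rows
    -- after wrapping. This is the origin of the index weights in `W²`.
    totalSum : ∀ n f h → ∑< n (λ i → ∑< n (circEntry n f h i))
               ≈ ∑< n (λ l → ((n ∸ l) ℕ× 1#) * f l + (l ℕ× 1#) * h l)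
    totalSum n f h = begin
      ∑< n (λ i → ∑< n (circEntry n f h i))
        ≈⟨ ∑<-cong n (λ i i<n → rowSum n f h i (ℕ.<⇒≤ i<n)) ⟩
      ∑< n (λ i → ∑< n (offset n f h i))
        ≈⟨ ∑-comm {n} {n} (λ i l → offset n f h (toℕ i) (toℕ l)) ⟩
      ∑< n (λ l → ∑< n (λ i → offset n f h i l))
        ≈⟨ ∑<-cong n (λ l l<n → column l (ℕ.<⇒≤ l<n)) ⟩
      ∑< n (λ l → ((n ∸ l) ℕ× 1#) * f l + (l ℕ× 1#) * h l) ∎
      where
      column : ∀ l → l ℕ.≤ n → ∑< n (λ i → offset n f h i l) ≈ ((n ∸ l) ℕ× 1#) * f l + (l ℕ× 1#) * h l
      column l l≤n with ℕ.m≤n⇒∃[o]m+o≡n l≤n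
      ... | d , ≡.refl = begin
        ∑< (l ℕ.+ d) (λ i → offset n f h i l)
          ≡⟨ ≡.cong (λ m → ∑< m (λ i → offset n f h i l)) (ℕ.+-comm l d) ⟩
        ∑< (d ℕ.+ l) (λ i → offset n f h i l)
          ≈⟨ ∑<-+ d l (λ i → offset n f h i l) ⟩
        ∑< d (λ i → offset n f h i l) + ∑< l (λ i → offset n f h (d ℕ.+ i) l)
          ≈⟨ +-cong
               (∑<-cong d (λ i i<d → reflexive (offset-< n f h (ℕ.+-monoʳ-< l i<d))))
               (∑<-cong l (λ i i<l → reflexive (offset-≥ n f h (ℕ.+-monoʳ-≤ l (ℕ.m≤m+n d i))))) ⟩
        ∑< d (λ _ → f l) + ∑< l (λ _ → h l)
          ≈⟨ +-cong (∑<-const d (f l)) (∑<-const l (h l)) ⟩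
        (d ℕ× 1#) * f l + (l ℕ× 1#) * h l
          ≡⟨ ≡.cong (λ m → (m ℕ× 1#) * f l + (l ℕ× 1#) * h l) (≡.sym (ℕ.m+n∸m≡n l d)) ⟩
        ((l ℕ.+ d ∸ l) ℕ× 1#) * f l + (l ℕ× 1#) * h l ∎

    nat : ℕ → Carrier
    nat n = n ℕ× 1#

    nat-+ : ∀ m n → nat (m ℕ.+ n) ≈ nat m + nat n
    nat-+ m n = ×-homo-+ 1# m n

    nat-* : ∀ m n → nat (m ℕ.* n) ≈ nat m * nat n
    nat-* m n = trans (sym (×-assocˡ 1# m n)) (n×-* m (nat n))

    nat-² : ∀ m → nat (m ℕ.^ 2) ≈ nat m * nat m
    nat-² m = trans (nat-* m (m ℕ.* 1)) (*-congˡ (reflexive (≡.cong nat (ℕ.*-identityʳ m))))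

    ∑<-∑≤ : ∀ m f → ∑< (suc m) (nat ∘ f) ≈ nat (Defs.∑≤ m f)
    ∑<-∑≤ zero    f = +-identityʳ (nat (f 0))
    ∑<-∑≤ (suc m) f = trans (sum-init-last (nat ∘ f ∘ toℕ {suc (suc m)}))
      (trans (+-cong
        (trans (sum-cong-≋ {suc m} (λ i → reflexive (≡.cong (nat ∘ f) (Fin.toℕ-inject₁ i))))
          (∑<-∑≤ m f))
        (reflexive (≡.cong (nat ∘ f) (Fin.toℕ-fromℕ (suc m)))))
        (sym (nat-+ (Defs.∑≤ m f) (f (suc m)))))

    ∑<-nat : ∀ m (f : ℕ → ℕ) (g : ℕ → Carrier) {x} →
      x ≈ nat (Defs.∑≤ m f) → (∀ l → nat (f l) ≈ g l) → x ≈ ∑< (suc m) g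
    ∑<-nat m f g e h = trans e (trans (sym (∑<-∑≤ m f)) (∑<-cong (suc m) (λ l _ → h l)))

    circEntry-op : ∀ {A B C : Set} (op : A → B → C) n f h f′ h′ i j →
      op (circEntry n f h i j) (circEntry n f′ h′ i j) ≡ circEntry n (λ l → op (f l) (f′ l))
        (λ l → op (h l) (h′ l)) i j
    circEntry-op op n f h f′ h′ i j with i ℕ.≤? j
    ... | yes _ = ≡.refl
    ... | no  _ = ≡.refl

    -- Besides comparing two arrays, this proves entrywise predicates, by a relation that ignores
    -- its second argument.
    circEntry-rel : ∀ {A B : Set} (R : A → B → Set) n {f h f′ h′} →
      (∀ l → R (f l) (f′ l)) → (∀ l → R (h l) (h′ l)) →
      ∀ i j → R (circEntry n f h i j) (circEntry n f′ h′ i j)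
    circEntry-rel R n hf hh i j with i ℕ.≤? j
    ... | yes _ = hf (j ∸ i)
    ... | no  _ = hh (n ℕ.+ j ∸ i)

  open CirculantSums

  -- Both norm bounds, with `ρ` for |r| and `M` for max(|r|, 1).

  module CirculantNorm (n : ℕ) (p : ℕ → ℕ) (rx ry ρ M : Carrier)
    (0≤ρ : 0# ≤ ρ) (ρ²≈ : ρ * ρ ≈ rx * rx + ry * ry) (ρ≤M : ρ ≤ M) (1≤M : 1# ≤ M) (X Y : Mat n n)
    (X≈ : ∀ i j → X i j ≈ circEntry n (λ l → nat (p l)) (λ l → rx * nat (p l)) (toℕ i) (toℕ j))
    (Y≈ : ∀ i j → Y i j ≈ circEntry n (λ l → 0#) (λ l → ry * nat (p l)) (toℕ i) (toℕ j))
    (S¹ S² W² : Carrier) (S¹≈ : S¹ ≈ ∑< n (λ l → nat (p l)))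
    (S²≈ : S² ≈ ∑< n (λ l → nat (p l) * nat (p l)))
    (W²≈ : W² ≈ ∑< n (λ l → nat l * (nat (p l) * nat (p l)))) where
    open SetoidReasoning setoid

    private
      q q² ρ²q² : ℕ → Carrier
      q l = nat (p l)
      q² l = q l * q l
      ρ²q² l = ρ * ρ * q² l

      0≤M : 0# ≤ M
      0≤M = ≤-trans 0≤1 1≤M

      0≤S¹ : 0# ≤ S¹
      0≤S¹ = ≤-respʳ (sym S¹≈) (0≤sum {n} (λ i → 0≤n× (p (toℕ i))))

      -- The factorisation for Schur's test: nonnegative weights `w` without the factor r, and
      -- complex coefficients equal to 1 on and above the diagonal and to r below it.
      w cx cy : Mat n n
      w i j = circEntry n q q (toℕ i) (toℕ j)
      cx i j = circEntry n (λ _ → 1#) (λ _ → rx) (toℕ i) (toℕ j)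
      cy i j = circEntry n (λ _ → 0#) (λ _ → ry) (toℕ i) (toℕ j)

      X≈w*cx : ∀ i j → X i j ≈ w i j * cx i j
      X≈w*cx i j = trans (X≈ i j) (trans
        (circEntry-rel _≈_ n (λ l → sym (*-identityʳ (q l))) (λ l → *-comm rx (q l)) (toℕ i) (toℕ j))
        (reflexive (≡.sym (circEntry-op _*_ n q q (λ _ → 1#) (λ _ → rx) (toℕ i) (toℕ j)))))

      Y≈w*cy : ∀ i j → Y i j ≈ w i j * cy i j
      Y≈w*cy i j = trans (Y≈ i j) (trans
        (circEntry-rel _≈_ n (λ l → sym (zeroʳ (q l))) (λ l → *-comm ry (q l)) (toℕ i) (toℕ j))
        (reflexive (≡.sym (circEntry-op _*_ n q q (λ _ → 0#) (λ _ → ry) (toℕ i) (toℕ j)))))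

      c≤M² : ∀ i j → cx i j * cx i j + cy i j * cy i j ≤ M * M
      c≤M² i j = ≤-respˡ (reflexive (≡.sym (circEntry-op (λ a b → a * a + b * b) n (λ _ → 1#)
        (λ _ → rx) (λ _ → 0#) (λ _ → ry) (toℕ i) (toℕ j))))
        (circEntry-rel (λ a _ → a ≤ M * M) n {f′ = λ _ → 0#} {h′ = λ _ → 0#}
          (λ l → ≤-respˡ (sym (trans (+-congˡ (zeroˡ 0#)) (+-identityʳ (1# * 1#)))) (square-mono-≤
            0≤1 1≤M))
          (λ l → ≤-respˡ ρ²≈ (square-mono-≤ 0≤ρ ρ≤M)) (toℕ i) (toℕ j))

      0≤w : ∀ i j → 0# ≤ w i j
      0≤w i j = circEntry-rel (λ a _ → 0# ≤ a) n {f′ = λ _ → 0#} {h′ = λ _ → 0#}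
        (λ l → 0≤n× (p l)) (λ l → 0≤n× (p l)) (toℕ i) (toℕ j)

    Eigenpair : Carrier → Set
    Eigenpair μ = ∃ λ (a : Fin n → Carrier) → ∃ λ (b : Fin n → Carrier) →
      ¬ (∀ i → a i ≈ 0# × b i ≈ 0#) × IsComplexEigenvector X Y μ a b

    upperBound : ∀ σ μ → σ ≈ √ μ → ¬ ¬ Eigenpair μ → σ ≤ M * S¹
    upperBound σ μ σ≈√μ ¬¬pair = ≤-respˡ (sym σ≈√μ) (√-≤ (0≤x*y 0≤M 0≤S¹)
      (≤-respʳ (solve 2 (λ s m → s :* (s :* (m :* m)) := m :* s :* (m :* s)) refl S¹ M)
        (¬¬-elim ¬¬pair λ (a , b , nz , eig) →
          eigenvalue-≤ X Y (S¹ * (S¹ * (M * M)))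
            (schurTest X Y w cx cy S¹ (M * M) X≈w*cx Y≈w*cy 0≤w 0≤S¹
              (λ i → ≤-reflexive (trans (rowSum-same n q (toℕ i) (ℕ.<⇒≤ (Fin.toℕ<n i))) (sym S¹≈)))
              (λ j → ≤-reflexive (trans (columnSum-same n q (toℕ j) (Fin.toℕ<n j)) (sym S¹≈)))
              c≤M²)
            μ a b nz eig)))

    -- The offset l contributes (n - l) q² + l ρ² q², which regroups as n q² + (ρ² - 1) l q².
    frobenius : sum (λ i → sum (λ j → X i j * X i j + Y i j * Y i j)) ≈ nat n * S² + (ρ * ρ - 1#) * W²
    frobenius = begin
      sum (λ i → sum (λ j → X i j * X i j + Y i j * Y i j))
        ≈⟨ sum-cong-≋ (λ i → sum-cong-≋ (λ j → entry i j)) ⟩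
      ∑< n (λ i → ∑< n (circEntry n q² ρ²q² i))
        ≈⟨ totalSum n q² ρ²q² ⟩
      ∑< n (λ l → nat (n ∸ l) * q² l + nat l * ρ²q² l)
        ≈⟨ ∑<-cong n (λ l l<n → weight l (ℕ.<⇒≤ l<n)) ⟩
      ∑< n (λ l → nat n * q² l + (ρ * ρ - 1#) * (nat l * q² l))
        ≈⟨ ∑-distrib-+ {n} (λ l → nat n * q² (toℕ l)) (λ l → (ρ * ρ - 1#) * (nat (toℕ l) * q²
          (toℕ l))) ⟩
      ∑< n (λ l → nat n * q² l) + ∑< n (λ l → (ρ * ρ - 1#) * (nat l * q² l))
        ≈⟨ +-cong (trans (*-congˡ S²≈) (*-distribˡ-sum {n} (nat n) (q² ∘ toℕ)))
                  (trans (*-congˡ W²≈) (*-distribˡ-sum {n} (ρ * ρ - 1#) (λ l → nat (toℕ l) * q²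
                    (toℕ l)))) ⟨
      nat n * S² + (ρ * ρ - 1#) * W² ∎
      where
      entry : ∀ i j → X i j * X i j + Y i j * Y i j ≈ circEntry n q² ρ²q² (toℕ i) (toℕ j)
      entry i j = trans (+-cong (*-cong (X≈ i j) (X≈ i j)) (*-cong (Y≈ i j) (Y≈ i j)))
        (trans (reflexive (circEntry-op (λ a b → a * a + b * b) n q (λ l → rx * q l) (λ _ → 0#)
          (λ l → ry * q l) (toℕ i) (toℕ j)))
          (circEntry-rel _≈_ n
            (λ l → trans (+-congˡ (zeroˡ 0#)) (+-identityʳ (q² l)))
            (λ l → trans (solve 3 (λ x y q → x :* q :* (x :* q) :+ y :* q :* (y :* q) :=
              (x :* x :+ y :* y) :* (q :* q)) refl rx ry (q l))
              (*-congʳ (sym ρ²≈)))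
            (toℕ i) (toℕ j)))
      weight : ∀ l → l ℕ.≤ n →
        nat (n ∸ l) * q² l + nat l * ρ²q² l ≈ nat n * q² l + (ρ * ρ - 1#) * (nat l * q² l)
      weight l l≤n = begin
        nat (n ∸ l) * q² l + nat l * (ρ * ρ * q² l)
          ≈⟨ solve 4 (λ a b r f → a :* f :+ b :* (r :* f) := (a :+ b) :* f :+ (r :- :1) :* (b :* f))
            refl (nat (n ∸ l)) (nat l) (ρ * ρ) (q² l) ⟩
        (nat (n ∸ l) + nat l) * q² l + (ρ * ρ - 1#) * (nat l * q² l)
          ≈⟨ +-congʳ (*-congʳ (trans (sym (nat-+ (n ∸ l) l))
            (reflexive (≡.cong nat (ℕ.m∸n+n≡m l≤n))))) ⟩
        nat n * q² l + (ρ * ρ - 1#) * (nat l * q² l) ∎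

    -- Maximality of `μ` is applied to the number from `largeEigenvalue`. That lemma requires an
    -- invertible nonnegative `y`; when `y ≤ 0#` the root of `y` is zero and the claim is immediate.
    lowerBound : ∀ m → n ≡ suc m → ∀ n⁻¹ → nat n * n⁻¹ ≈ 1# →
      ∀ σ μ → σ ≈ √ μ → (∀ ν → ¬ ¬ Eigenpair ν → ν ≤ μ) →
      √ (S² + (ρ * ρ - 1#) * n⁻¹ * W²) ≤ σ
    lowerBound m n≡1+m n⁻¹ nn⁻¹≈1 σ μ σ≈√μ largest = ≤-respʳ (sym σ≈√μ) (≤-cases 0# y
      (λ 0≤y → ¬¬-elim (zero-or-inverse y)
        [ (λ y≈0 → √y≤√μ-if-nonpos (≤-reflexive y≈0))
        , (λ inv → let x , y≤x , ¬¬v = largeEigenvalue N⁻¹ 1≤N NN⁻¹≈1 y 0≤y inv Ny≈‖A‖ in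
            √-mono-≤ (≤-trans y≤x (largest x (λ k → ¬¬v (λ (v , (j , vj≈1) , Hv≈xv) →
              k ((λ i → v (i ↑ˡ n)) , (λ i → v (n ↑ʳ i)) , nonzero v j vj≈1 , realEigen⇒complexEigen
                X Y x v Hv≈xv))))))
        ]′)
      √y≤√μ-if-nonpos)
      where
      N⁻¹ : Carrier
      -- `unitFraction l` is 1/(l + 1), and the real dimension 2n is one more than `m + suc m`.
      N⁻¹ = unitFraction (m ℕ.+ suc m)
      n+n≡ : n ℕ.+ n ≡ suc (m ℕ.+ suc m)
      n+n≡ = ≡.cong₂ ℕ._+_ n≡1+m n≡1+m
      NN⁻¹≈1 : nat (n ℕ.+ n) * N⁻¹ ≈ 1#
      NN⁻¹≈1 = trans (*-congʳ (reflexive (≡.cong nat n+n≡))) (unitFraction-* (m ℕ.+ suc m))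
      1≤N : 1# ≤ nat (n ℕ.+ n)
      1≤N = ≤-respʳ (reflexive (≡.cong nat (≡.sym n+n≡))) (x≤x+y (0≤n× (m ℕ.+ suc m)))
      y : Carrier
      y = S² + (ρ * ρ - 1#) * n⁻¹ * W²
      √y≤√μ-if-nonpos : y ≤ 0# → √ y ≤ √ μ
      √y≤√μ-if-nonpos y≤0 = square-cancel-≤ (0≤√ μ) (≤-respˡ (sym (√-nonpos y≤0)) (0≤x² (√ μ)))
      open GramMatrix (n ℕ.+ n) (realify X Y) using (largeEigenvalue)
      Ny≈‖A‖ : nat (n ℕ.+ n) * y ≈ normSq (realify X Y)
      Ny≈‖A‖ = begin
        nat (n ℕ.+ n) * y
          ≈⟨ trans (*-congʳ (nat-+ n n)) (distribʳ y (nat n) (nat n)) ⟩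
        nat n * y + nat n * y
          ≈⟨ +-cong ny ny ⟩
        sum (λ i → sum (λ j → X i j * X i j + Y i j * Y i j)) + sum (λ i → sum (λ j → X i j * X i
          j + Y i j * Y i j))
          ≈⟨ normSq-realify X Y ⟨
        normSq (realify X Y) ∎
        where
        ny : nat n * y ≈ sum (λ i → sum (λ j → X i j * X i j + Y i j * Y i j))
        ny = begin
          nat n * (S² + (ρ * ρ - 1#) * n⁻¹ * W²)
            ≈⟨ solve 5 (λ n s r i w → n :* (s :+ r :* i :* w) := n :* s :+ n :* i :* (r :* w)) refl
              (nat n) S² (ρ * ρ - 1#) n⁻¹ W² ⟩
          nat n * S² + nat n * n⁻¹ * ((ρ * ρ - 1#) * W²)
            ≈⟨ +-congˡ (trans (*-congʳ nn⁻¹≈1) (*-identityˡ _)) ⟩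
          nat n * S² + (ρ * ρ - 1#) * W²
            ≈⟨ frobenius ⟨
          sum (λ i → sum (λ j → X i j * X i j + Y i j * Y i j)) ∎
      nonzero : ∀ v j → v j ≈ 1# → ¬ (∀ i → v (i ↑ˡ n) ≈ 0# × v (n ↑ʳ i) ≈ 0#)
      nonzero v j vj≈1 h = 1≰0 (≤-reflexive (trans (sym vj≈1)
        (trans (reflexive (≡.cong v (≡.sym (Fin.join-splitAt n n j)))) (at (splitAt n j)))))
        where
        at : ∀ s → v (join n n s) ≈ 0#
        at (inj₁ i) = proj₁ (h i)
        at (inj₂ i) = proj₂ (h i)

open ≡ using (refl; sym; trans; cong; cong₂; subst)

-- Inequalities between rational numbers.

module RationalFacts where
  open +-*-Solver using (solve; _:=_; _:+_; _:*_; _:-_; :-_; con)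

  0≤q-p⇒p≤q : ∀ p q → 0ℚ ℚ.≤ q ℚ.- p → p ℚ.≤ q
  0≤q-p⇒p≤q p q h = begin
    p                  ≡⟨ ℚ.+-identityʳ p ⟨
    p ℚ.+ 0ℚ           ≤⟨ ℚ.+-monoʳ-≤ p h ⟩
    p ℚ.+ (q ℚ.- p)    ≡⟨ solve 2 (λ p q → p :+ (q :- p) := q) refl p q ⟩
    q                  ∎
    where open ℚ.≤-Reasoning

  p≤q⇒0≤q-p : ∀ p q → p ℚ.≤ q → 0ℚ ℚ.≤ q ℚ.- p
  p≤q⇒0≤q-p p q h = begin
    0ℚ                 ≡⟨ ℚ.+-inverseʳ p ⟨
    p ℚ.- p            ≤⟨ ℚ.+-monoˡ-≤ (ℚ.- p) h ⟩
    q ℚ.- p            ∎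
    where open ℚ.≤-Reasoning

  +-nonNeg : ∀ {p q} → 0ℚ ℚ.≤ p → 0ℚ ℚ.≤ q → 0ℚ ℚ.≤ p ℚ.+ q
  +-nonNeg = ℚ.+-mono-≤

  *-nonNeg : ∀ {p q} → 0ℚ ℚ.≤ p → 0ℚ ℚ.≤ q → 0ℚ ℚ.≤ p ℚ.* q
  *-nonNeg {p} {q} 0≤p 0≤q = ℚ.≤-trans (ℚ.≤-reflexive (sym (ℚ.*-zeroʳ p)))
    (ℚ.*-monoˡ-≤-nonNeg p {{ℚ.nonNegative 0≤p}} 0≤q)

  *-monoˡ-nonNeg : ∀ p q r → 0ℚ ℚ.≤ p → q ℚ.≤ r → p ℚ.* q ℚ.≤ p ℚ.* r
  *-monoˡ-nonNeg p q r 0≤p q≤r = ℚ.*-monoˡ-≤-nonNeg p {{ℚ.nonNegative 0≤p}} {q} {r} q≤r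

  *-monoʳ-nonNeg : ∀ p q r → 0ℚ ℚ.≤ p → q ℚ.≤ r → q ℚ.* p ℚ.≤ r ℚ.* p
  *-monoʳ-nonNeg p q r 0≤p q≤r = ℚ.*-monoʳ-≤-nonNeg p {{ℚ.nonNegative 0≤p}} {q} {r} q≤r

  *-pos : ∀ {p q} → 0ℚ ℚ.< p → 0ℚ ℚ.< q → 0ℚ ℚ.< p ℚ.* q
  *-pos {p} {q} 0<p 0<q = ℚ.≤-<-trans (ℚ.≤-reflexive (sym (ℚ.*-zeroʳ p)))
    (ℚ.*-monoʳ-<-pos p {{ℚ.positive 0<p}} 0<q)

  divide : ∀ p q → 0ℚ ℚ.< p → 0ℚ ℚ.< q → ∃ λ d → 0ℚ ℚ.< d × d ℚ.* q ≡ p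
  divide p q 0<p 0<q = p ℚ.* ℚ.1/ q
    , *-pos 0<p (ℚ.positive⁻¹ (ℚ.1/ q) {{ℚ.1/pos⇒pos q}})
    , trans (ℚ.*-assoc p (ℚ.1/ q) q) (trans (cong (p ℚ.*_) (ℚ.*-inverseˡ q)) (ℚ.*-identityʳ p))
    where
    instance
      q-pos : ℚ.Positive q
      q-pos = ℚ.positive 0<q
      q≢0 : ℚ.NonZero q
      q≢0 = ℚ.pos⇒nonZero q

  0<½ : 0ℚ ℚ.< ½
  0<½ = ℚ.positive⁻¹ ½

  half-pos : ∀ {ε} → 0ℚ ℚ.< ε → 0ℚ ℚ.< ½ ℚ.* ε
  half-pos = *-pos 0<½

  p≤∣p∣ : ∀ p → p ℚ.≤ ℚ.∣ p ∣
  p≤∣p∣ p with ℚ.≤-total 0ℚ p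
  ... | inj₁ 0≤p = ℚ.≤-reflexive (sym (ℚ.0≤p⇒∣p∣≡p 0≤p))
  ... | inj₂ p≤0 = ℚ.≤-trans p≤0 (ℚ.0≤∣p∣ p)

  ∣p-q∣≤r⇒p≤q+r : ∀ p q r → ℚ.∣ p ℚ.- q ∣ ℚ.≤ r → p ℚ.≤ q ℚ.+ r
  ∣p-q∣≤r⇒p≤q+r p q r h = 0≤q-p⇒p≤q p (q ℚ.+ r) (subst (0ℚ ℚ.≤_)
    (solve 3 (λ p q r → r :- (p :- q) := q :+ r :- p) refl p q r)
    (p≤q⇒0≤q-p (p ℚ.- q) r (ℚ.≤-trans (p≤∣p∣ (p ℚ.- q)) h)))

  ∣p-q∣≤r⇒q≤p+r : ∀ p q r → ℚ.∣ p ℚ.- q ∣ ℚ.≤ r → q ℚ.≤ p ℚ.+ r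
  ∣p-q∣≤r⇒q≤p+r p q r h = ∣p-q∣≤r⇒p≤q+r q p r (ℚ.≤-trans (ℚ.≤-reflexive
    (trans (sym (ℚ.∣-p∣≡∣p∣ (q ℚ.- p)))
      (cong ℚ.∣_∣ (solve 2 (λ p q → :- (q :- p) := p :- q) refl p q)))) h)

  p≤q+r⇒∣p-q∣≤r : ∀ p q r → p ℚ.≤ q ℚ.+ r → q ℚ.≤ p ℚ.+ r → ℚ.∣ p ℚ.- q ∣ ℚ.≤ r
  p≤q+r⇒∣p-q∣≤r p q r h₁ h₂ with ℚ.∣p∣≡p∨∣p∣≡-p (p ℚ.- q)
  ... | inj₁ e = ℚ.≤-trans (ℚ.≤-reflexive e) (0≤q-p⇒p≤q (p ℚ.- q) r (subst (0ℚ ℚ.≤_)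
    (solve 3 (λ p q r → q :+ r :- p := r :- (p :- q)) refl p q r) (p≤q⇒0≤q-p p (q ℚ.+ r) h₁)))
  ... | inj₂ e = ℚ.≤-trans (ℚ.≤-reflexive e) (0≤q-p⇒p≤q (ℚ.- (p ℚ.- q)) r (subst (0ℚ ℚ.≤_)
    (solve 3 (λ p q r → p :+ r :- q := r :- (:- (p :- q))) refl p q r) (p≤q⇒0≤q-p q (p ℚ.+ r) h₂)))

  p≤p+q : ∀ p q → 0ℚ ℚ.≤ q → p ℚ.≤ p ℚ.+ q
  p≤p+q p q h = ℚ.≤-trans (ℚ.≤-reflexive (sym (ℚ.+-identityʳ p))) (ℚ.+-monoʳ-≤ p h)

  ½p+½p≡p : ∀ p → ½ ℚ.* p ℚ.+ ½ ℚ.* p ≡ p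
  ½p+½p≡p p = solve 1 (λ p → con ½ :* p :+ con ½ :* p := p) refl p

  toℚᵘ-/ : ∀ i d → ℚ.toℚᵘ (i ℚ./ suc d) ℚᵘ.≃ ℚᵘ.mkℚᵘ i d
  toℚᵘ-/ i d = ℚ.toℚᵘ-fromℚᵘ (ℚᵘ.mkℚᵘ i d)

  1/-archimedean : ∀ {p} → 0ℚ ℚ.< p → ∃ λ N → ∀ n → N ℕ.≤ n → + 1 ℚ./ suc n ℚ.≤ p
  1/-archimedean {ℚ.mkℚ (+ zero) _ _} 0<p with ℚ.positive 0<p
  ... | ()
  1/-archimedean {ℚ.mkℚ (ℤ.-[1+ _ ]) _ _} 0<p with ℚ.positive 0<p
  ... | ()
  -- The stored `d` is the denominator minus one, and a positive fraction is at least 1/(d + 1).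
  1/-archimedean {ℚ.mkℚ (+ suc a) d _} _ = d , λ n d≤n → ℚ.toℚᵘ-cancel-≤
    (ℚᵘ.≤-respˡ-≃ (ℚᵘ.≃-sym (toℚᵘ-/ (+ 1) n)) (ℚᵘ.*≤* (ℤ.+≤+
      (ℕ.≤-trans (ℕ.≤-reflexive (ℕ.*-identityˡ (suc d)))
        (ℕ.≤-trans (ℕ.s≤s d≤n) (ℕ.m≤n*m (suc n) (suc a)))))))

  p≤∣↥p∣/1 : ∀ p → p ℚ.≤ + ℤ.∣ ℚ.↥ p ∣ ℚ./ 1
  p≤∣↥p∣/1 (ℚ.mkℚ i d _) = ℚ.toℚᵘ-cancel-≤
    (ℚᵘ.≤-respʳ-≃ (ℚᵘ.≃-sym (toℚᵘ-/ (+ ℤ.∣ i ∣) 0)) (ℚᵘ.*≤*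
      (ℤ.≤-trans (ℤ.≤-reflexive (ℤ.*-identityʳ i))
      (ℤ.≤-trans (i≤∣i∣ i)
      (ℤ.≤-trans (ℤ.+≤+ (ℕ.m≤m*n ℤ.∣ i ∣ (suc d))) (ℤ.≤-reflexive (ℤ.pos-* ℤ.∣ i ∣ (suc d))))))))
    where
    i≤∣i∣ : ∀ i → i ℤ.≤ + ℤ.∣ i ∣
    i≤∣i∣ (+ n)        = ℤ.≤-refl
    i≤∣i∣ (ℤ.-[1+ n ]) = ℤ.-≤+

  suc/1 : ∀ n → + suc n ℚ./ 1 ≡ 1ℚ ℚ.+ (+ n ℚ./ 1)
  suc/1 n = ℚ.toℚᵘ-injective
    (ℚᵘ.≃-trans (toℚᵘ-/ (+ suc n) 0)
    (ℚᵘ.≃-trans (ℚᵘ.*≡* (cong (ℤ._* + 1) (sym (cong (λ i → + 1 ℤ.+ i) (ℤ.*-identityʳ (+ n))))))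
    (ℚᵘ.≃-sym (ℚᵘ.≃-trans (ℚ.toℚᵘ-homo-+ 1ℚ (+ n ℚ./ 1)) (ℚᵘ.+-cong {ℚ.toℚᵘ 1ℚ} {ℚᵘ.1ℚᵘ} ℚᵘ.≃-refl
      (toℚᵘ-/ (+ n) 0))))))

  n/1*1/n : ∀ n → (+ suc n ℚ./ 1) ℚ.* (+ 1 ℚ./ suc n) ≡ 1ℚ
  n/1*1/n n = ℚ.toℚᵘ-injective
    (ℚᵘ.≃-trans (ℚ.toℚᵘ-homo-* (+ suc n ℚ./ 1) (+ 1 ℚ./ suc n))
    (ℚᵘ.≃-trans (ℚᵘ.*-cong (toℚᵘ-/ (+ suc n) 0) (toℚᵘ-/ (+ 1) n))
      (ℚᵘ.*≡* (cong +_ (cong suc e)))))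
    where
    e : n ℕ.* 1 ℕ.* 1 ≡ n ℕ.+ 0 ℕ.+ 0
    e = trans (ℕ.*-identityʳ (n ℕ.* 1)) (trans (ℕ.*-identityʳ n)
      (sym (trans (ℕ.+-identityʳ (n ℕ.+ 0)) (ℕ.+-identityʳ n))))

  0≤1/ : ∀ n → 0ℚ ℚ.≤ + 1 ℚ./ suc n
  0≤1/ n = ℚ.nonNegative⁻¹ (+ 1 ℚ./ suc n) {{ℚ.normalize-nonNeg 1 (suc n)}}

open import Defs

-- Arithmetic and order of Cauchy reals.

module RealFacts where
  open RationalFacts
  open +-*-Solver using (solve; _:=_; _:+_; _:*_; _:-_; :-_; con)
  open ℚ.≤-Reasoning

  Eventually : (ℕ → Set) → Set
  Eventually Q = ∃ λ N → ∀ n → N ℕ.≤ n → Q n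

  ev-map₂ : ∀ {Q R S : ℕ → Set} → (∀ n → Q n → R n → S n) →
            Eventually Q → Eventually R → Eventually S
  ev-map₂ f (M , hM) (N , hN) = M ℕ.⊔ N , λ n h →
    f n (hM n (ℕ.m⊔n≤o⇒m≤o M N h)) (hN n (ℕ.m⊔n≤o⇒n≤o M N h))

  ev-map : ∀ {Q R : ℕ → Set} → (∀ n → Q n → R n) → Eventually Q → Eventually R
  ev-map f (N , hN) = N , λ n h → f n (hN n h)

  ev-const : ∀ {Q : Set} → Eventually (λ _ → Q) → Q
  ev-const (N , hN) = hN N ℕ.≤-refl

  ≤-pointwise : ∀ x y → (∀ n → seq x n ℚ.≤ seq y n) → x ≤ y
  ≤-pointwise x y h ε 0<ε = 0 , λ n _ → ℚ.≤-trans (h n) (p≤p+q (seq y n) ε (ℚ.<⇒≤ 0<ε))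

  ≤-antisym : ∀ x y → x ≤ y → y ≤ x → x ≈ y
  ≤-antisym x y x≤y y≤x ε 0<ε = ev-map₂ (λ n → p≤q+r⇒∣p-q∣≤r (seq x n) (seq y n) ε) (x≤y ε 0<ε)
    (y≤x ε 0<ε)

  ≈⇒≤ : ∀ x y → x ≈ y → x ≤ y
  ≈⇒≤ x y x≈y ε 0<ε = ev-map (λ n → ∣p-q∣≤r⇒p≤q+r (seq x n) (seq y n) ε) (x≈y ε 0<ε)

  ≈⇒≥ : ∀ x y → x ≈ y → y ≤ x
  ≈⇒≥ x y x≈y ε 0<ε = ev-map (λ n → ∣p-q∣≤r⇒q≤p+r (seq x n) (seq y n) ε) (x≈y ε 0<ε)

  ≈-pointwise : ∀ x y → (∀ n → seq x n ≡ seq y n) → x ≈ y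
  ≈-pointwise x y h = ≤-antisym x y
    (≤-pointwise x y (λ n → ℚ.≤-reflexive (h n)))
    (≤-pointwise y x (λ n → ℚ.≤-reflexive (sym (h n))))

  ≤-trans : ∀ x y z → x ≤ y → y ≤ z → x ≤ z
  ≤-trans x y z x≤y y≤z ε 0<ε = ev-map₂
    (λ n h₁ h₂ → begin
      seq x n                                 ≤⟨ h₁ ⟩
      seq y n ℚ.+ ½ ℚ.* ε                     ≤⟨ ℚ.+-monoˡ-≤ (½ ℚ.* ε) h₂ ⟩
      seq z n ℚ.+ ½ ℚ.* ε ℚ.+ ½ ℚ.* ε         ≡⟨ ℚ.+-assoc (seq z n) (½ ℚ.* ε) (½ ℚ.* ε) ⟩
      seq z n ℚ.+ (½ ℚ.* ε ℚ.+ ½ ℚ.* ε)       ≡⟨ cong (seq z n ℚ.+_) (½p+½p≡p ε) ⟩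
      seq z n ℚ.+ ε                           ∎)
    (x≤y (½ ℚ.* ε) (half-pos 0<ε)) (y≤z (½ ℚ.* ε) (half-pos 0<ε))

  ≈-refl : ∀ x → x ≈ x
  ≈-refl x = ≈-pointwise x x (λ _ → refl)

  ≈-sym : ∀ x y → x ≈ y → y ≈ x
  ≈-sym x y x≈y = ≤-antisym y x (≈⇒≥ x y x≈y) (≈⇒≤ x y x≈y)

  ≈-trans : ∀ x y z → x ≈ y → y ≈ z → x ≈ z
  ≈-trans x y z x≈y y≈z = ≤-antisym x z
    (≤-trans x y z (≈⇒≤ x y x≈y) (≈⇒≤ y z y≈z))
    (≤-trans z y x (≈⇒≥ y z y≈z) (≈⇒≥ x y x≈y))

  +-monoʳ-≤ : ∀ x y z → y ≤ z → x + y ≤ x + z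
  +-monoʳ-≤ x y z y≤z ε 0<ε = ev-map
    (λ n h → ℚ.≤-trans (ℚ.+-monoʳ-≤ (seq x n) h)
      (ℚ.≤-reflexive (sym (ℚ.+-assoc (seq x n) (seq z n) ε))))
    (y≤z ε 0<ε)

  +-monoˡ-≤ : ∀ x y z → y ≤ z → y + x ≤ z + x
  +-monoˡ-≤ x y z y≤z = ≤-trans (y + x) (x + y) (z + x)
    (≤-pointwise (y + x) (x + y) (λ n → ℚ.≤-reflexive (ℚ.+-comm (seq y n) (seq x n))))
    (≤-trans (x + y) (x + z) (z + x) (+-monoʳ-≤ x y z y≤z)
      (≤-pointwise (x + z) (z + x) (λ n → ℚ.≤-reflexive (ℚ.+-comm (seq x n) (seq z n)))))

  +-cong : ∀ x x′ y y′ → x ≈ x′ → y ≈ y′ → x + y ≈ x′ + y′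
  +-cong x x′ y y′ x≈x′ y≈y′ = ≤-antisym (x + y) (x′ + y′)
    (≤-trans (x + y) (x′ + y) (x′ + y′) (+-monoˡ-≤ y x x′ (≈⇒≤ x x′ x≈x′)) (+-monoʳ-≤ x′ y y′
      (≈⇒≤ y y′ y≈y′)))
    (≤-trans (x′ + y′) (x′ + y) (x + y) (+-monoʳ-≤ x′ y′ y (≈⇒≥ y y′ y≈y′)) (+-monoˡ-≤ y x′ x
      (≈⇒≥ x x′ x≈x′)))

  neg-antimono : ∀ x y → x ≤ y → - y ≤ - x
  neg-antimono x y x≤y ε 0<ε = ev-map
    (λ n h → 0≤q-p⇒p≤q (ℚ.- seq y n) (ℚ.- seq x n ℚ.+ ε) (subst (0ℚ ℚ.≤_)
      (solve 3 (λ x y e → y :+ e :- x := :- x :+ e :- (:- y)) refl (seq x n) (seq y n) ε)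
      (p≤q⇒0≤q-p (seq x n) (seq y n ℚ.+ ε) h)))
    (x≤y ε 0<ε)

  neg-cong : ∀ x y → x ≈ y → - x ≈ - y
  neg-cong x y x≈y = ≤-antisym (- x) (- y)
    (neg-antimono y x (≈⇒≥ x y x≈y)) (neg-antimono x y (≈⇒≤ x y x≈y))

  bounded : ∀ x → ∃ λ K → 0ℚ ℚ.< K × Eventually (λ n → ℚ.∣ seq x n ∣ ℚ.≤ K)
  bounded x = let N , hN = cauchy x 1ℚ (ℚ.positive⁻¹ 1ℚ) in
    ℚ.∣ seq x N ∣ ℚ.+ 1ℚ , ℚ.+-mono-≤-< (ℚ.0≤∣p∣ (seq x N)) (ℚ.positive⁻¹ 1ℚ) , N , λ n N≤n → begin
      ℚ.∣ seq x n ∣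
        ≡⟨ cong ℚ.∣_∣ (solve 2 (λ a b → a := b :+ (a :- b)) refl (seq x n) (seq x N)) ⟩
      ℚ.∣ seq x N ℚ.+ (seq x n ℚ.- seq x N) ∣
        ≤⟨ ℚ.∣p+q∣≤∣p∣+∣q∣ (seq x N) (seq x n ℚ.- seq x N) ⟩
      ℚ.∣ seq x N ∣ ℚ.+ ℚ.∣ seq x n ℚ.- seq x N ∣
        ≤⟨ ℚ.+-monoʳ-≤ ℚ.∣ seq x N ∣ (hN n N N≤n ℕ.≤-refl) ⟩
      ℚ.∣ seq x N ∣ ℚ.+ 1ℚ ∎

  *-congʳ : ∀ x y z → y ≈ z → y * x ≈ z * x
  *-congʳ x y z y≈z ε 0<ε = let
      K , 0<K , hK = bounded x
      δ , 0<δ , δ*K≡ε = divide ε K 0<ε 0<K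
    in ev-map₂ (λ n → bound (seq x n) (seq y n) (seq z n) K δ (ℚ.<⇒≤ 0<K) δ*K≡ε) hK (y≈z δ 0<δ)
    where
    bound : ∀ x y z K δ → 0ℚ ℚ.≤ K → δ ℚ.* K ≡ ε → ℚ.∣ x ∣ ℚ.≤ K → ℚ.∣ y ℚ.- z ∣ ℚ.≤ δ →
            ℚ.∣ y ℚ.* x ℚ.- z ℚ.* x ∣ ℚ.≤ ε
    bound x y z K δ 0≤K δ*K≡ε h₁ h₂ = begin
      ℚ.∣ y ℚ.* x ℚ.- z ℚ.* x ∣
        ≡⟨ cong ℚ.∣_∣ (solve 3 (λ x y z → y :* x :- z :* x := (y :- z) :* x) refl x y z) ⟩
      ℚ.∣ (y ℚ.- z) ℚ.* x ∣
        ≡⟨ ℚ.∣p*q∣≡∣p∣*∣q∣ (y ℚ.- z) x ⟩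
      ℚ.∣ y ℚ.- z ∣ ℚ.* ℚ.∣ x ∣
        ≤⟨ *-monoˡ-nonNeg ℚ.∣ y ℚ.- z ∣ ℚ.∣ x ∣ K (ℚ.0≤∣p∣ (y ℚ.- z)) h₁ ⟩
      ℚ.∣ y ℚ.- z ∣ ℚ.* K
        ≤⟨ *-monoʳ-nonNeg K ℚ.∣ y ℚ.- z ∣ δ 0≤K h₂ ⟩
      δ ℚ.* K
        ≡⟨ δ*K≡ε ⟩
      ε ∎

  *-comm : ∀ x y → x * y ≈ y * x
  *-comm x y = ≈-pointwise (x * y) (y * x) (λ n → ℚ.*-comm (seq x n) (seq y n))

  *-cong : ∀ x x′ y y′ → x ≈ x′ → y ≈ y′ → x * y ≈ x′ * y′
  *-cong x x′ y y′ x≈x′ y≈y′ = ≈-trans (x * y) (x′ * y) (x′ * y′) (*-congʳ y x x′ x≈x′)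
    (≈-trans (x′ * y) (y * x′) (x′ * y′) (*-comm x′ y)
    (≈-trans (y * x′) (y′ * x′) (x′ * y′) (*-congʳ x′ y y′ y≈y′) (*-comm y′ x′)))

  x≤x⊔y : ∀ x y → x ≤ x ⊔ y
  x≤x⊔y x y = ≤-pointwise x (x ⊔ y) (λ n → ℚ.p≤p⊔q (seq x n) (seq y n))

  y≤x⊔y : ∀ x y → y ≤ x ⊔ y
  y≤x⊔y x y = ≤-pointwise y (x ⊔ y) (λ n → ℚ.p≤q⊔p (seq x n) (seq y n))

  ⊔-lub : ∀ x y z → x ≤ z → y ≤ z → x ⊔ y ≤ z
  ⊔-lub x y z x≤z y≤z ε 0<ε = ev-map₂ (λ n → ℚ.⊔-lub {seq z n ℚ.+ ε} {seq x n} {seq y n})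
    (x≤z ε 0<ε) (y≤z ε 0<ε)

  0≤x⇒x≈x⊔0 : ∀ x → 0ℝ ≤ x → x ≈ x ⊔ 0ℝ
  0≤x⇒x≈x⊔0 x 0≤x = ≤-antisym x (x ⊔ 0ℝ) (x≤x⊔y x 0ℝ)
    (⊔-lub x 0ℝ x (≈⇒≤ x x (≈-refl x)) 0≤x)

  -- The terms of a nonnegative real may be negative. Replacing `x` by the equal real `x ⊔ 0ℝ`, and
  -- likewise `y`, makes the claim hold termwise.
  0≤x*y : ∀ x y → 0ℝ ≤ x → 0ℝ ≤ y → 0ℝ ≤ x * y
  0≤x*y x y 0≤x 0≤y = ≤-trans 0ℝ ((x ⊔ 0ℝ) * (y ⊔ 0ℝ)) (x * y)
    (≤-pointwise 0ℝ ((x ⊔ 0ℝ) * (y ⊔ 0ℝ))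
      (λ n → *-nonNeg {seq x n ℚ.⊔ 0ℚ} {seq y n ℚ.⊔ 0ℚ} (ℚ.p≤q⊔p (seq x n) 0ℚ) (ℚ.p≤q⊔p (seq y n) 0ℚ)))
    (≈⇒≥ (x * y) ((x ⊔ 0ℝ) * (y ⊔ 0ℝ))
      (*-cong x (x ⊔ 0ℝ) y (y ⊔ 0ℝ) (0≤x⇒x≈x⊔0 x 0≤x) (0≤x⇒x≈x⊔0 y 0≤y)))

  -- The strict order y < x in its informative form, with a rational distance.
  Gap : ℝ → ℝ → Set
  Gap y x = ∃ λ δ → 0ℚ ℚ.< δ × Eventually (λ n → seq y n ℚ.+ δ ℚ.≤ seq x n)

  quintuple : ∀ ε → 0ℚ ℚ.< ε → ∃ λ η → 0ℚ ℚ.< η × η ℚ.+ η ℚ.+ η ℚ.+ η ℚ.+ η ℚ.≤ ε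
  quintuple ε 0<ε = η , 0<η , (begin
      η ℚ.+ η ℚ.+ η ℚ.+ η ℚ.+ η
        ≤⟨ p≤p+q (η ℚ.+ η ℚ.+ η ℚ.+ η ℚ.+ η) (η ℚ.+ η ℚ.+ η) (+-nonNeg (+-nonNeg 0≤η 0≤η) 0≤η) ⟩
      η ℚ.+ η ℚ.+ η ℚ.+ η ℚ.+ η ℚ.+ (η ℚ.+ η ℚ.+ η)
        ≡⟨ solve 1 (λ h → h :+ h :+ h :+ h :+ h :+ (h :+ h :+ h) := (h :+ h :+ (h :+ h)) :+
          (h :+ h :+ (h :+ h))) refl η ⟩
      (η ℚ.+ η ℚ.+ (η ℚ.+ η)) ℚ.+ (η ℚ.+ η ℚ.+ (η ℚ.+ η))
        ≡⟨ cong (λ a → (a ℚ.+ a) ℚ.+ (a ℚ.+ a)) (½p+½p≡p (½ ℚ.* (½ ℚ.* ε))) ⟩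
      (½ ℚ.* (½ ℚ.* ε) ℚ.+ ½ ℚ.* (½ ℚ.* ε)) ℚ.+ (½ ℚ.* (½ ℚ.* ε) ℚ.+ ½ ℚ.* (½ ℚ.* ε))
        ≡⟨ cong (λ a → a ℚ.+ a) (½p+½p≡p (½ ℚ.* ε)) ⟩
      ½ ℚ.* ε ℚ.+ ½ ℚ.* ε
        ≡⟨ ½p+½p≡p ε ⟩
      ε ∎)
    where
    η = ½ ℚ.* (½ ℚ.* (½ ℚ.* ε))
    0<η = half-pos (half-pos (half-pos 0<ε))
    0≤η = ℚ.<⇒≤ 0<η

  -- Decided by one rational comparison, at a late index N with threshold 3η. Moving to other
  -- indices costs η for each of `x` and `y`, which leaves either the bound 5η ≤ ε or a gap of η.
  ≤-or-gap : ∀ x y ε → 0ℚ ℚ.< ε → Eventually (λ n → seq x n ℚ.≤ seq y n ℚ.+ ε) ⊎ Gap y x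
  ≤-or-gap x y ε 0<ε = let
      η , 0<η , 5η≤ε = quintuple ε 0<ε
      M , hM = oneSided x η 0<η
      N , hN = oneSided y η 0<η
    in compare η 0<η 5η≤ε (M ℕ.⊔ N)
      (λ m n h₁ h₂ → hM m n (ℕ.m⊔n≤o⇒m≤o M N h₁) (ℕ.m⊔n≤o⇒m≤o M N h₂))
      (λ m n h₁ h₂ → hN m n (ℕ.m⊔n≤o⇒n≤o M N h₁) (ℕ.m⊔n≤o⇒n≤o M N h₂))
    where
    compare : ∀ η → 0ℚ ℚ.< η → η ℚ.+ η ℚ.+ η ℚ.+ η ℚ.+ η ℚ.≤ ε → ∀ N →
      (∀ m n → N ℕ.≤ m → N ℕ.≤ n → seq x m ℚ.≤ seq x n ℚ.+ η) →
      (∀ m n → N ℕ.≤ m → N ℕ.≤ n → seq y m ℚ.≤ seq y n ℚ.+ η) →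
      Eventually (λ n → seq x n ℚ.≤ seq y n ℚ.+ ε) ⊎ Gap y x
    compare η 0<η 5η≤ε N hx hy with seq x N ℚ.≤? seq y N ℚ.+ (η ℚ.+ η ℚ.+ η)
    ... | yes h = inj₁ (N , λ n N≤n → begin
      seq x n
        ≤⟨ hx n N N≤n ℕ.≤-refl ⟩
      seq x N ℚ.+ η
        ≤⟨ ℚ.+-monoˡ-≤ η {seq x N} {seq y N ℚ.+ (η ℚ.+ η ℚ.+ η)} h ⟩
      seq y N ℚ.+ (η ℚ.+ η ℚ.+ η) ℚ.+ η
        ≤⟨ ℚ.+-monoˡ-≤ η {seq y N ℚ.+ (η ℚ.+ η ℚ.+ η)} {seq y n ℚ.+ η ℚ.+ (η ℚ.+ η ℚ.+ η)}
             (ℚ.+-monoˡ-≤ (η ℚ.+ η ℚ.+ η) {seq y N} {seq y n ℚ.+ η} (hy N n ℕ.≤-refl N≤n)) ⟩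
      seq y n ℚ.+ η ℚ.+ (η ℚ.+ η ℚ.+ η) ℚ.+ η
        ≡⟨ solve 2 (λ y h → y :+ h :+ (h :+ h :+ h) :+ h := y :+ (h :+ h :+ h :+ h :+ h)) refl
          (seq y n) η ⟩
      seq y n ℚ.+ (η ℚ.+ η ℚ.+ η ℚ.+ η ℚ.+ η)
        ≤⟨ ℚ.+-monoʳ-≤ (seq y n) 5η≤ε ⟩
      seq y n ℚ.+ ε ∎)
    ... | no h = inj₂ (η , 0<η , N , λ n N≤n → 0≤q-p⇒p≤q (seq y n ℚ.+ η) (seq x n) (subst (0ℚ ℚ.≤_)
      (solve 5 (λ x xN y yN h →
        xN :- (yN :+ (h :+ h :+ h)) :+ (x :+ h :- xN) :+ (yN :+ h :- y)
        := x :- (y :+ h)) refl (seq x n) (seq x N) (seq y n) (seq y N) η)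
      (+-nonNeg (+-nonNeg
        (p≤q⇒0≤q-p (seq y N ℚ.+ (η ℚ.+ η ℚ.+ η)) (seq x N) (ℚ.<⇒≤ (ℚ.≰⇒> h)))
        (p≤q⇒0≤q-p (seq x N) (seq x n ℚ.+ η) (hx N n ℕ.≤-refl N≤n)))
        (p≤q⇒0≤q-p (seq y n) (seq y N ℚ.+ η) (hy n N N≤n ℕ.≤-refl)))))

  gap⇒≰ : ∀ x y → Gap y x → ¬ x ≤ y
  gap⇒≰ x y (δ , 0<δ , y+δ≤x) x≤y = (λ p q → ℚ.<-irrefl refl (ℚ.<-≤-trans p q)) (begin-strict
      ½ ℚ.* δ                   ≡⟨ ℚ.+-identityʳ (½ ℚ.* δ) ⟨
      ½ ℚ.* δ ℚ.+ 0ℚ            <⟨ ℚ.+-monoʳ-< (½ ℚ.* δ) (half-pos 0<δ) ⟩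
      ½ ℚ.* δ ℚ.+ ½ ℚ.* δ       ≡⟨ ½p+½p≡p δ ⟩
      δ                         ∎)
    (ev-const (ev-map₂ (λ n h₁ h₂ → 0≤q-p⇒p≤q δ (½ ℚ.* δ) (subst (0ℚ ℚ.≤_)
      (solve 4 (λ x y d h → x :- (y :+ d) :+ (y :+ h :- x) := h :- d) refl (seq x n) (seq y n) δ
        (½ ℚ.* δ))
      (+-nonNeg (p≤q⇒0≤q-p (seq y n ℚ.+ δ) (seq x n) h₁) (p≤q⇒0≤q-p (seq x n) (seq y n ℚ.+ ½ ℚ.* δ)
        h₂)))) y+δ≤x (x≤y (½ ℚ.* δ) (half-pos 0<δ))))

  gap⇒≤ : ∀ x y → Gap y x → y ≤ x
  gap⇒≤ x y (δ , 0<δ , y+δ≤x) ε 0<ε = ev-map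
    (λ n h → ℚ.≤-trans (p≤p+q (seq y n) δ (ℚ.<⇒≤ 0<δ)) (ℚ.≤-trans h (p≤p+q (seq x n) ε
      (ℚ.<⇒≤ 0<ε)))) y+δ≤x

  ≰⇒¬¬gap : ∀ x y → ¬ x ≤ y → ¬ ¬ Gap y x
  ≰⇒¬¬gap x y x≰y ¬gap = x≰y λ ε 0<ε →
    [ (λ h → h) , (λ g → contradiction g ¬gap) ]′ (≤-or-gap x y ε 0<ε)

  ≤-stable : ∀ x y → ¬ ¬ x ≤ y → x ≤ y
  ≤-stable x y ¬¬x≤y ε 0<ε =
    [ (λ h → h) , (λ g → contradiction (gap⇒≰ x y g) ¬¬x≤y) ]′ (≤-or-gap x y ε 0<ε)

  ≤-total : ∀ x y → ¬ ¬ (x ≤ y ⊎ y ≤ x)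
  ≤-total x y ¬total = ≰⇒¬¬gap x y (λ h → ¬total (inj₁ h)) (λ g → ¬total (inj₂ (gap⇒≤ x y g)))

  -- Early terms of `x` may vanish, so the terms `seq x n ⊔ δ` are inverted; they agree with those
  -- of `x` from the gap onwards.
  pos⇒inverse : ∀ x → Gap 0ℝ x → ∃ λ y → x * y ≈ 1ℝ
  pos⇒inverse x (δ , 0<δ , hδ) = y , (λ ε 0<ε → ev-map
    (λ n h → ℚ.≤-trans (ℚ.≤-reflexive (cong ℚ.∣_∣ (trans
        (cong (λ a → a ℚ.* inv n ℚ.- 1ℚ)
          (sym (ℚ.p≥q⇒p⊔q≡p (ℚ.≤-trans (ℚ.≤-reflexive (sym (ℚ.+-identityˡ δ))) h))))
        (trans (cong (ℚ._- 1ℚ) (ℚ.*-inverseʳ (b n))) (ℚ.+-inverseʳ 1ℚ)))))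
      (ℚ.<⇒≤ 0<ε)) hδ)
    where
    b : ℕ → ℚ
    b n = seq x n ℚ.⊔ δ
    δ≤b : ∀ n → δ ℚ.≤ b n
    δ≤b n = ℚ.p≤q⊔p (seq x n) δ
    instance
      b-pos : ∀ {n} → ℚ.Positive (b n)
      b-pos {n} = ℚ.positive (ℚ.<-≤-trans 0<δ (δ≤b n))
      b≢0 : ∀ {n} → ℚ.NonZero (b n)
      b≢0 {n} = ℚ.pos⇒nonZero (b n)
    inv : ℕ → ℚ
    inv n = ℚ.1/ b n
    0≤inv : ∀ n → 0ℚ ℚ.≤ inv n
    0≤inv n = ℚ.<⇒≤ (ℚ.positive⁻¹ (inv n) {{ℚ.1/pos⇒pos (b n)}})
    δ*inv≤1 : ∀ n → δ ℚ.* inv n ℚ.≤ 1ℚ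
    δ*inv≤1 n = ℚ.≤-trans (*-monoʳ-nonNeg (inv n) δ (b n) (0≤inv n) (δ≤b n))
      (ℚ.≤-reflexive (ℚ.*-inverseʳ (b n)))
    -- The tolerance carries δ² because the difference of inverses is divided by `b m * b n`, which
    -- is at least δ².
    inv-bound : ∀ m n ε → 0ℚ ℚ.≤ ε → b n ℚ.≤ b m ℚ.+ ε ℚ.* (δ ℚ.* δ) → inv m ℚ.≤ inv n ℚ.+ ε
    inv-bound m n ε 0≤ε h = begin
      inv m
        ≡⟨ ℚ.*-identityʳ (inv m) ⟨
      inv m ℚ.* 1ℚ
        ≡⟨ cong (inv m ℚ.*_) (ℚ.*-inverseʳ (b n)) ⟨
      inv m ℚ.* (b n ℚ.* inv n)
        ≤⟨ *-monoˡ-nonNeg (inv m) (b n ℚ.* inv n) ((b m ℚ.+ ε ℚ.* (δ ℚ.* δ)) ℚ.* inv n) (0≤inv m)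
             (*-monoʳ-nonNeg (inv n) (b n) (b m ℚ.+ ε ℚ.* (δ ℚ.* δ)) (0≤inv n) h) ⟩
      inv m ℚ.* ((b m ℚ.+ ε ℚ.* (δ ℚ.* δ)) ℚ.* inv n)
        ≡⟨ solve 5 (λ im bm e d i → im :* ((bm :+ e :* (d :* d)) :* i)
             := (bm :* im) :* i :+ e :* ((d :* im) :* (d :* i))) refl (inv m) (b m) ε δ (inv n) ⟩
      (b m ℚ.* inv m) ℚ.* inv n ℚ.+ ε ℚ.* ((δ ℚ.* inv m) ℚ.* (δ ℚ.* inv n))
        ≡⟨ cong (λ a → a ℚ.* inv n ℚ.+ ε ℚ.* ((δ ℚ.* inv m) ℚ.* (δ ℚ.* inv n))) (ℚ.*-inverseʳ (b m)) ⟩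
      1ℚ ℚ.* inv n ℚ.+ ε ℚ.* ((δ ℚ.* inv m) ℚ.* (δ ℚ.* inv n))
        ≤⟨ ℚ.+-monoʳ-≤ (1ℚ ℚ.* inv n) {ε ℚ.* ((δ ℚ.* inv m) ℚ.* (δ ℚ.* inv n))} {ε ℚ.* (1ℚ ℚ.* 1ℚ)}
             (*-monoˡ-nonNeg ε ((δ ℚ.* inv m) ℚ.* (δ ℚ.* inv n)) (1ℚ ℚ.* 1ℚ) 0≤ε
               (ℚ.≤-trans (*-monoˡ-nonNeg (δ ℚ.* inv m) (δ ℚ.* inv n) 1ℚ (*-nonNeg {δ} {inv m}
                 (ℚ.<⇒≤ 0<δ) (0≤inv m)) (δ*inv≤1 n))
               (*-monoʳ-nonNeg 1ℚ (δ ℚ.* inv m) 1ℚ (ℚ.<⇒≤ (ℚ.positive⁻¹ 1ℚ)) (δ*inv≤1 m)))) ⟩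
      1ℚ ℚ.* inv n ℚ.+ ε ℚ.* (1ℚ ℚ.* 1ℚ)
        ≡⟨ solve 2 (λ i e → con 1ℚ :* i :+ e :* (con 1ℚ :* con 1ℚ) := i :+ e) refl (inv n) ε ⟩
      inv n ℚ.+ ε ∎
    inv-cauchy : OneSidedCauchy inv
    inv-cauchy ε 0<ε = let
        N , hN = oneSided (x ⊔ fromℚ δ) (ε ℚ.* (δ ℚ.* δ)) (*-pos 0<ε (*-pos 0<δ 0<δ))
      in N , λ m n N≤m N≤n → inv-bound m n ε (ℚ.<⇒≤ 0<ε) (hN n m N≤n N≤m)
    y : ℝ
    y = fromOneSided inv inv-cauchy

  zero-or-inverse : ∀ x → ¬ ¬ (x ≈ 0ℝ ⊎ (∃ λ y → x * y ≈ 1ℝ))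
  zero-or-inverse x h = ≰⇒¬¬gap x 0ℝ x≰0 (λ g → h (inj₂ (pos⇒inverse x g)))
    where
    neg-inverse : (∃ λ y → - x * y ≈ 1ℝ) → ∃ λ y → x * y ≈ 1ℝ
    neg-inverse (y , e) = - y , ≈-trans (x * - y) (- x * y) 1ℝ (≈-pointwise (x * - y) (- x * y)
      (λ n → solve 2 (λ x y → x :* (:- y) := (:- x) :* y) refl (seq x n) (seq y n))) e
    x≰0 : ¬ x ≤ 0ℝ
    x≰0 x≤0 = ≰⇒¬¬gap 0ℝ x (λ 0≤x → h (inj₁ (≤-antisym x 0ℝ x≤0 0≤x))) (λ (δ , 0<δ , hδ) →
      h (inj₂ (neg-inverse (pos⇒inverse (- x) (δ , 0<δ , ev-map (λ n h → 0≤q-p⇒p≤q (0ℚ ℚ.+ δ)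
        (ℚ.- seq x n) (subst (0ℚ ℚ.≤_)
        (solve 2 (λ x d → con 0ℚ :- (x :+ d) := :- x :- (con 0ℚ :+ d)) refl (seq x n) δ)
          (p≤q⇒0≤q-p (seq x n ℚ.+ δ) 0ℚ h))) hδ)))))

  unitFraction : ℕ → ℝ
  unitFraction n = fromℚ (+ 1 ℚ./ suc n)

  0≤√ : ∀ x → 0ℝ ≤ √ x
  0≤√ x = ≤-pointwise 0ℝ (√ x) (λ n → ratRoot-nonNeg (seq x n ℚ.⊔ 0ℚ) n)

  -- The resolution 1/(n+1) of the n-th grid is itself a real number, equal to 0,
  -- so x ≤ (√ x + resolution)² holds termwise.
  √-square-⊔ : ∀ x → √ x * √ x ≈ x ⊔ 0ℝ
  √-square-⊔ x = ≤-antisym (√ x * √ x) (x ⊔ 0ℝ)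
    (≤-pointwise (√ x * √ x) (x ⊔ 0ℝ)
      (λ n → ratRoot-lower (seq x n ℚ.⊔ 0ℚ) n (ℚ.p≤q⊔p (seq x n) 0ℚ)))
    (≤-trans (x ⊔ 0ℝ) (s * s) (√ x * √ x)
      (≤-pointwise (x ⊔ 0ℝ) (s * s) (λ n → ratRoot-upper (seq x n ℚ.⊔ 0ℚ) n))
      (≈⇒≤ (s * s) (√ x * √ x) (*-cong s (√ x) s (√ x) s≈√x s≈√x)))
    where
    resolution : ℝ
    resolution = fromOneSided (λ n → + 1 ℚ./ suc n) λ ε 0<ε →
      let N , hN = 1/-archimedean 0<ε in N , λ m n N≤m N≤n →
      ℚ.≤-trans (hN m N≤m) (ℚ.≤-trans (p≤p+q ε (+ 1 ℚ./ suc n) (0≤1/ n)) (ℚ.≤-reflexive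
        (ℚ.+-comm ε (+ 1 ℚ./ suc n))))
    resolution≈0 : resolution ≈ 0ℝ
    resolution≈0 = ≤-antisym resolution 0ℝ
      (λ ε 0<ε → let N , hN = 1/-archimedean 0<ε in N , λ n N≤n →
        ℚ.≤-trans (hN n N≤n) (ℚ.≤-reflexive (sym (ℚ.+-identityˡ ε))))
      (≤-pointwise 0ℝ resolution (λ n → 0≤1/ n))
    s : ℝ
    s = √ x + resolution
    s≈√x : s ≈ √ x
    s≈√x = ≈-trans s (√ x + 0ℝ) (√ x)
      (+-cong (√ x) (√ x) resolution 0ℝ (≈-refl (√ x)) resolution≈0)
      (≈-pointwise (√ x + 0ℝ) (√ x) (λ n → ℚ.+-identityʳ (root x n)))

  √-square : ∀ x → 0ℝ ≤ x → √ x * √ x ≈ x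
  √-square x 0≤x = ≈-trans (√ x * √ x) (x ⊔ 0ℝ) x (√-square-⊔ x) (≈-sym x (x ⊔ 0ℝ) (0≤x⇒x≈x⊔0 x 0≤x))

  √-nonpos : ∀ x → x ≤ 0ℝ → √ x * √ x ≈ 0ℝ
  √-nonpos x x≤0 = ≈-trans (√ x * √ x) (x ⊔ 0ℝ) 0ℝ (√-square-⊔ x)
    (≤-antisym (x ⊔ 0ℝ) 0ℝ (⊔-lub x 0ℝ 0ℝ x≤0 (≈⇒≤ 0ℝ 0ℝ (≈-refl 0ℝ))) (y≤x⊔y x 0ℝ))

-- Completeness in the form of nested intervals.

module NestedIntervals where
  open RationalFacts
  open RealFacts
  open +-*-Solver using (solve; _:=_; _:+_; _:*_; _:-_; :-_; con)
  open ℚ.≤-Reasoning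

  infixl 6 _⊞_
  _⊞_ : ℝ → ℚ → ℝ
  x ⊞ ε = x + fromℚ ε

  ⊞-mono : ∀ x y ε → x ≤ y → x ⊞ ε ≤ y ⊞ ε
  ⊞-mono x y ε = +-monoˡ-≤ (fromℚ ε) x y

  ⊞-assoc-≤ : ∀ x δ ε → x ⊞ δ ⊞ ε ≤ x ⊞ (δ ℚ.+ ε)
  ⊞-assoc-≤ x δ ε = ≤-pointwise (x ⊞ δ ⊞ ε) (x ⊞ (δ ℚ.+ ε))
    (λ n → ℚ.≤-reflexive (ℚ.+-assoc (seq x n) δ ε))

  ⊞-trans : ∀ x y z δ ε → x ≤ y ⊞ ε → y ≤ z ⊞ δ → x ≤ z ⊞ (δ ℚ.+ ε)
  ⊞-trans x y z δ ε h₁ h₂ = ≤-trans x (y ⊞ ε) (z ⊞ (δ ℚ.+ ε)) h₁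
    (≤-trans (y ⊞ ε) (z ⊞ δ ⊞ ε) (z ⊞ (δ ℚ.+ ε)) (⊞-mono y (z ⊞ δ) ε h₂) (⊞-assoc-≤ z δ ε))

  ⊞-weaken : ∀ x y δ ε → δ ℚ.≤ ε → x ≤ y ⊞ δ → x ≤ y ⊞ ε
  ⊞-weaken x y δ ε δ≤ε h = ≤-trans x (y ⊞ δ) (y ⊞ ε) h
    (≤-pointwise (y ⊞ δ) (y ⊞ ε) (λ n → ℚ.+-monoʳ-≤ (seq y n) δ≤ε))

  ∀⊞⇒≤ : ∀ x y → (∀ ε → 0ℚ ℚ.< ε → x ≤ y ⊞ ε) → x ≤ y
  ∀⊞⇒≤ x y h ε 0<ε = ev-map (λ n g → begin
      seq x n                                ≤⟨ g ⟩
      seq y n ℚ.+ ½ ℚ.* ε ℚ.+ ½ ℚ.* ε        ≡⟨ ℚ.+-assoc (seq y n) (½ ℚ.* ε) (½ ℚ.* ε) ⟩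
      seq y n ℚ.+ (½ ℚ.* ε ℚ.+ ½ ℚ.* ε)      ≡⟨ cong (seq y n ℚ.+_) (½p+½p≡p ε) ⟩
      seq y n ℚ.+ ε                          ∎)
    (h (½ ℚ.* ε) (half-pos 0<ε) (½ ℚ.* ε) (half-pos 0<ε))

  fromℚ-cancel-≤ : ∀ p q ε → 0ℚ ℚ.< ε → fromℚ p ≤ fromℚ q → p ℚ.≤ q ℚ.+ ε
  fromℚ-cancel-≤ p q ε 0<ε h = ev-const (h ε 0<ε)

  Near : ℚ → ℝ → ℚ → Set
  Near q x ε = fromℚ q ≤ x ⊞ ε × x ≤ fromℚ q ⊞ ε

  terms-near : ∀ x ε → 0ℚ ℚ.< ε → Eventually (λ n → Near (seq x n) x ε)
  terms-near x ε 0<ε = let N , hN = oneSided x ε 0<ε in N , λ n N≤n →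
    eventually⇒≤ (fromℚ (seq x n)) (x ⊞ ε) (N , λ m N≤m → hN n m N≤n N≤m) ,
    eventually⇒≤ x (fromℚ (seq x n) ⊞ ε) (N , λ m N≤m → hN m n N≤m N≤n)
    where
    eventually⇒≤ : ∀ x y → Eventually (λ n → seq x n ℚ.≤ seq y n) → x ≤ y
    eventually⇒≤ x y h ε 0<ε = ev-map (λ n g → ℚ.≤-trans g (p≤p+q (seq y n) ε (ℚ.<⇒≤ 0<ε))) h

  approximate : ∀ x ε → 0ℚ ℚ.< ε → ∃ λ q → Near q x ε
  approximate x ε 0<ε = let N , hN = terms-near x ε 0<ε in seq x N , hN N ℕ.≤-refl

  module _ (lo hi : ℕ → ℝ) (c : ℝ)
    (lo-mono : ∀ n → lo n ≤ lo (suc n)) (hi-anti : ∀ n → hi (suc n) ≤ hi n)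
    (lo≤hi : ∀ n → lo n ≤ hi n)
    (width : ∀ n → hi n ≤ lo n + c * unitFraction n) where

    lo-mono′ : ∀ {m n} → m ℕ.≤′ n → lo m ≤ lo n
    lo-mono′ {m} ℕ.≤′-refl = ≈⇒≤ (lo m) (lo m) (≈-refl (lo m))
    lo-mono′ {m} (ℕ.≤′-step {n} h) = ≤-trans (lo m) (lo n) (lo (suc n)) (lo-mono′ h) (lo-mono n)

    hi-anti′ : ∀ {m n} → m ℕ.≤′ n → hi n ≤ hi m
    hi-anti′ {m} ℕ.≤′-refl = ≈⇒≤ (hi m) (hi m) (≈-refl (hi m))
    hi-anti′ {m} (ℕ.≤′-step {n} h) = ≤-trans (hi (suc n)) (hi n) (hi m) (hi-anti n) (hi-anti′ h)

    -- For m beyond N, `hi m` is at most `hi N`, hence at most `lo N ⊞ ε`, and `lo N` lies below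
    -- every `hi n`. So `n` is unrestricted.
    hi-close : ∀ ε → 0ℚ ℚ.< ε → ∃ λ N → ∀ m n → N ℕ.≤ m → hi m ≤ hi n ⊞ ε
    hi-close ε 0<ε = let
        K , 0<K , hK = bounded c
        δ , 0<δ , δ*K≡ε = divide ε K 0<ε 0<K
        N , hN = 1/-archimedean 0<δ
        lo-width : lo N + c * unitFraction N ≤ lo N ⊞ ε
        lo-width = +-monoʳ-≤ (lo N) (c * unitFraction N) (fromℚ ε)
          (λ ν 0<ν → ev-map (λ n h → ℚ.≤-trans
            (bound (seq c n) (+ 1 ℚ./ suc N) K δ (ℚ.<⇒≤ 0<K) (0≤1/ N) (hN N ℕ.≤-refl) δ*K≡ε h)
            (p≤p+q ε ν (ℚ.<⇒≤ 0<ν))) hK)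
      in N , λ m n N≤m → below N lo-width m n N≤m
      where
      bound : ∀ c u K δ → 0ℚ ℚ.≤ K → 0ℚ ℚ.≤ u → u ℚ.≤ δ → δ ℚ.* K ≡ ε → ℚ.∣ c ∣ ℚ.≤ K → c ℚ.* u ℚ.≤ ε
      bound c u K δ 0≤K 0≤u u≤δ e h = begin
        c ℚ.* u   ≤⟨ *-monoʳ-nonNeg u c K 0≤u (ℚ.≤-trans (p≤∣p∣ c) h) ⟩
        K ℚ.* u   ≤⟨ *-monoˡ-nonNeg K u δ 0≤K u≤δ ⟩
        K ℚ.* δ   ≡⟨ trans (ℚ.*-comm K δ) e ⟩
        ε         ∎
      below : ∀ N → lo N + c * unitFraction N ≤ lo N ⊞ ε → ∀ m n → N ℕ.≤ m → hi m ≤ hi n ⊞ ε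
      below N h m n N≤m = ≤-trans (hi m) (hi N) (hi n ⊞ ε) (hi-anti′ (ℕ.≤⇒≤′ N≤m))
        (≤-trans (hi N) (lo N + c * unitFraction N) (hi n ⊞ ε) (width N)
        (≤-trans (lo N + c * unitFraction N) (lo N ⊞ ε) (hi n ⊞ ε) h
        (⊞-mono (lo N) (hi n) ε (lo≤hi′ N n))))
        where
        lo≤hi′ : ∀ m n → lo m ≤ hi n
        lo≤hi′ m n = ≤-trans (lo m) (lo (m ℕ.⊔ n)) (hi n) (lo-mono′ (ℕ.≤⇒≤′ (ℕ.m≤m⊔n m n)))
          (≤-trans (lo (m ℕ.⊔ n)) (hi (m ℕ.⊔ n)) (hi n) (lo≤hi (m ℕ.⊔ n))
            (hi-anti′ (ℕ.≤⇒≤′ (ℕ.m≤n⊔m m n))))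

    0<1/ : ∀ n → 0ℚ ℚ.< + 1 ℚ./ suc n
    0<1/ n = ℚ.positive⁻¹ (+ 1 ℚ./ suc n) {{ℚ.normalize-pos 1 (suc n)}}

    -- A diagonal choice: rationals within 1/(n + 1) of `hi n`, which themselves form the Cauchy
    -- sequence of the limit.
    centre : ℕ → ℚ
    centre n = proj₁ (approximate (hi n) (+ 1 ℚ./ suc n) (0<1/ n))

    centre-near : ∀ ε → 0ℚ ℚ.< ε → Eventually (λ n → Near (centre n) (hi n) ε)
    centre-near ε 0<ε = let N , hN = 1/-archimedean 0<ε in N , λ n N≤n →
      let h₁ , h₂ = proj₂ (approximate (hi n) (+ 1 ℚ./ suc n) (0<1/ n)) in
      ⊞-weaken (fromℚ (centre n)) (hi n) (+ 1 ℚ./ suc n) ε (hN n N≤n) h₁ ,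
      ⊞-weaken (hi n) (fromℚ (centre n)) (+ 1 ℚ./ suc n) ε (hN n N≤n) h₂

    limit-cauchy : OneSidedCauchy centre
    limit-cauchy ε 0<ε = let
        η , 0<η , 5η≤ε = quintuple ε 0<ε
        M , hM = hi-close η 0<η
        N , hN = centre-near η 0<η
      in M ℕ.⊔ N , λ m n h₁ h₂ → combine η 0<η 5η≤ε m n
        (proj₁ (hN m (ℕ.m⊔n≤o⇒n≤o M N h₁)))
        (hM m n (ℕ.m⊔n≤o⇒m≤o M N h₁))
        (proj₂ (hN n (ℕ.m⊔n≤o⇒n≤o M N h₂)))
      where
      combine : ∀ η → 0ℚ ℚ.< η → η ℚ.+ η ℚ.+ η ℚ.+ η ℚ.+ η ℚ.≤ ε → ∀ m n →
        fromℚ (centre m) ≤ hi m ⊞ η → hi m ≤ hi n ⊞ η → hi n ≤ fromℚ (centre n) ⊞ η →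
        centre m ℚ.≤ centre n ℚ.+ ε
      combine η 0<η 5η≤ε m n h₁ h₂ h₃ = begin
        centre m
          -- Three tolerances pay for the chain through `hi m` and `hi n`, two more for returning
          -- from constant reals to rationals.
          ≤⟨ fromℚ-cancel-≤ (centre m) (centre n ℚ.+ (η ℚ.+ (η ℚ.+ η))) (η ℚ.+ η) (ℚ.+-mono-< 0<η 0<η)
               (⊞-trans (fromℚ (centre m)) (hi n) (fromℚ (centre n)) η (η ℚ.+ η)
                 (⊞-trans (fromℚ (centre m)) (hi m) (hi n) η η h₁ h₂) h₃) ⟩
        centre n ℚ.+ (η ℚ.+ (η ℚ.+ η)) ℚ.+ (η ℚ.+ η)
          ≡⟨ solve 2 (λ a h → a :+ (h :+ (h :+ h)) :+ (h :+ h) := a :+ (h :+ h :+ h :+ h :+ h)) refl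
            (centre n) η ⟩
        centre n ℚ.+ (η ℚ.+ η ℚ.+ η ℚ.+ η ℚ.+ η)
          ≤⟨ ℚ.+-monoʳ-≤ (centre n) 5η≤ε ⟩
        centre n ℚ.+ ε ∎

    limit : ℝ
    limit = fromOneSided centre limit-cauchy

    limit-near : ∀ ε → 0ℚ ℚ.< ε → Eventually (λ n → limit ≤ hi n ⊞ (ε ℚ.+ ε) × hi n ≤ limit ⊞ (ε ℚ.+ ε))
    limit-near ε 0<ε = ev-map₂ (λ n (h₁ , h₂) (h₃ , h₄) →
        ⊞-trans limit (fromℚ (centre n)) (hi n) ε ε h₂ h₃ ,
        ⊞-trans (hi n) (fromℚ (centre n)) limit ε ε h₄ h₁)
      (terms-near limit ε 0<ε) (centre-near ε 0<ε)

    lo≤limit : ∀ n → lo n ≤ limit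
    lo≤limit n = ∀⊞⇒≤ (lo n) limit λ ε 0<ε → let
        N , hN = limit-near (½ ℚ.* ε) (half-pos 0<ε)
        m = n ℕ.⊔ N
      in ≤-trans (lo n) (lo m) (limit ⊞ ε) (lo-mono′ (ℕ.≤⇒≤′ (ℕ.m≤m⊔n n N)))
        (≤-trans (lo m) (hi m) (limit ⊞ ε) (lo≤hi m)
          (subst (λ e → hi m ≤ limit ⊞ e) (½p+½p≡p ε) (proj₂ (hN m (ℕ.m≤n⊔m n N)))))

    limit≤hi : ∀ n → limit ≤ hi n
    limit≤hi n = ∀⊞⇒≤ limit (hi n) λ ε 0<ε → let
        N , hN = limit-near (½ ℚ.* ε) (half-pos 0<ε)
        m = n ℕ.⊔ N
      in ≤-trans limit (hi m ⊞ ε) (hi n ⊞ ε)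
          (subst (λ e → limit ≤ hi m ⊞ e) (½p+½p≡p ε) (proj₁ (hN m (ℕ.m≤n⊔m n N))))
          (⊞-mono (hi m) (hi n) ε (hi-anti′ (ℕ.≤⇒≤′ (ℕ.m≤m⊔n n N))))

-- The Cauchy reals as a complete ordered field.

ℝ-commutativeRing : CommutativeRing 0ℓ 0ℓ
ℝ-commutativeRing = record
  { Carrier = ℝ ; _≈_ = _≈_ ; _+_ = _+_ ; _*_ = _*_ ; -_ = -_ ; 0# = 0ℝ ; 1# = 1ℝ
  ; isCommutativeRing = record
    { isRing = record
      { +-isAbelianGroup = record
        { isGroup = record
          { isMonoid = record
            { isSemigroup = record
              { isMagma = record
                { isEquivalence = record
                  { refl  = λ {x} → ≈-refl x
                  ; sym   = λ {x y} → ≈-sym x y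
                  ; trans = λ {x y z} → ≈-trans x y z
                  }
                ; ∙-cong = λ {x x′ y y′} → +-cong x x′ y y′
                }
              ; assoc = λ x y z → ≈-pointwise (x + y + z) (x + (y + z))
                  (λ n → ℚ.+-assoc (seq x n) (seq y n) (seq z n))
              }
            ; identity =
                (λ x → ≈-pointwise (0ℝ + x) x (λ n → ℚ.+-identityˡ (seq x n))) ,
                (λ x → ≈-pointwise (x + 0ℝ) x (λ n → ℚ.+-identityʳ (seq x n)))
            }
          ; inverse =
              (λ x → ≈-pointwise (- x + x) 0ℝ (λ n → ℚ.+-inverseˡ (seq x n))) ,
              (λ x → ≈-pointwise (x + - x) 0ℝ (λ n → ℚ.+-inverseʳ (seq x n)))
          ; ⁻¹-cong = λ {x y} → neg-cong x y
          }
        ; comm = λ x y → ≈-pointwise (x + y) (y + x) (λ n → ℚ.+-comm (seq x n) (seq y n))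
        }
      ; *-cong = λ {x x′ y y′} → *-cong x x′ y y′
      ; *-assoc = λ x y z → ≈-pointwise (x * y * z) (x * (y * z))
          (λ n → ℚ.*-assoc (seq x n) (seq y n) (seq z n))
      ; *-identity =
          (λ x → ≈-pointwise (1ℝ * x) x (λ n → ℚ.*-identityˡ (seq x n))) ,
          (λ x → ≈-pointwise (x * 1ℝ) x (λ n → ℚ.*-identityʳ (seq x n)))
      ; distrib =
          (λ x y z → ≈-pointwise (x * (y + z)) (x * y + x * z)
            (λ n → ℚ.*-distribˡ-+ (seq x n) (seq y n) (seq z n))) ,
          (λ x y z → ≈-pointwise ((y + z) * x) (y * x + z * x)
            (λ n → ℚ.*-distribʳ-+ (seq x n) (seq y n) (seq z n)))
      }
    ; *-comm = *-comm
    }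
  }
  where open RealFacts

open RawMonoidOps (CommutativeRing.+-rawMonoid ℝ-commutativeRing) using () renaming (_×_ to _ℕ×_)

fromℕ-seq : ∀ m n → seq (m ℕ× 1ℝ) n ≡ + m ℚ./ 1
fromℕ-seq zero    n = refl
fromℕ-seq (suc m) n = trans (cong (1ℚ ℚ.+_) (fromℕ-seq m n)) (sym (RationalFacts.suc/1 m))

reals : CompleteOrderedField
reals = record
  { commutativeRing = ℝ-commutativeRing
  ; _≤_ = _≤_ ; √_ = √_ ; unitFraction = unitFraction
  ; fromℚ-morphism = record
    { ⟦_⟧ = fromℚ
    ; +-homo = λ p q → ≈-pointwise (fromℚ (p ℚ.+ q)) (fromℚ p + fromℚ q) (λ _ → refl)
    ; *-homo = λ p q → ≈-pointwise (fromℚ (p ℚ.* q)) (fromℚ p * fromℚ q) (λ _ → refl)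
    ; -‿homo = λ p → ≈-pointwise (fromℚ (ℚ.- p)) (- fromℚ p) (λ _ → refl)
    ; 0-homo = ≈-refl 0ℝ
    ; 1-homo = ≈-refl 1ℝ
    }
  ; ≤-reflexive = λ {x y} → ≈⇒≤ x y
  ; ≤-trans = λ {x y z} → ≤-trans x y z
  ; ≤-antisym = λ {x y} → ≤-antisym x y
  ; ≤-stable = λ {x y} → ≤-stable x y
  ; ≤-total = ≤-total
  ; 1≰0 = gap⇒≰ 1ℝ 0ℝ (1ℚ , ℚ.positive⁻¹ 1ℚ , 0 , λ _ _ → ℚ.≤-reflexive (ℚ.+-identityˡ 1ℚ))
  ; +-monoʳ-≤ = λ x {y z} → +-monoʳ-≤ x y z
  ; 0≤x*y = λ {x y} → 0≤x*y x y
  ; zero-or-inverse = zero-or-inverse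
  ; 0≤√ = 0≤√
  ; √-square = λ {x} → √-square x
  ; √-nonpos = λ {x} → √-nonpos x
  ; unitFraction-* = λ m → ≈-pointwise ((suc m ℕ× 1ℝ) * unitFraction m) 1ℝ
      (λ n → trans (cong (ℚ._* (+ 1 ℚ./ suc m)) (fromℕ-seq (suc m) n)) (n/1*1/n m))
  ; archimedean = λ x → let K , 0<K , hK = bounded x in ℤ.∣ ℚ.↥ K ∣ ,
      λ ε 0<ε → ev-map (λ n h → ℚ.≤-trans (p≤∣p∣ (seq x n)) (ℚ.≤-trans h
        (ℚ.≤-trans (p≤∣↥p∣/1 K) (ℚ.≤-trans (ℚ.≤-reflexive (sym (fromℕ-seq ℤ.∣ ℚ.↥ K ∣ n)))
          (p≤p+q (seq (ℤ.∣ ℚ.↥ K ∣ ℕ× 1ℝ) n) ε (ℚ.<⇒≤ 0<ε)))))) hK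
  ; nestedIntervals = λ lo hi c h₁ h₂ h₃ h₄ →
      limit lo hi c h₁ h₂ h₃ h₄ , lo≤limit lo hi c h₁ h₂ h₃ h₄ , limit≤hi lo hi c h₁ h₂ h₃ h₄
  }
  where
  open RationalFacts
  open RealFacts
  open NestedIntervals

open RealFacts using (unitFraction)
open LinearAlgebra reals
  using (sum; module Order; module RealMatrices; module Realification; module CirculantSums; module
    CirculantNorm)

-- Transfer to complex matrices and to the Pell circulant.

module ComplexMatrices where
  open RealMatrices
  open Realification
  open CirculantSums
  open Algebra.Properties.Monoid.Sum (CommutativeRing.+-monoid ℝ-commutativeRing) using (sum-cong-≗)
  private module R = CompleteOrderedField reals

  re-sumᶜ : ∀ {n} (f : Vector ℂ n) → re (sumᶜ f) ≡ sum (λ i → re (f i))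
  re-sumᶜ {zero}  f = refl
  re-sumᶜ {suc n} f = cong (λ s → re (f zero) + s) (re-sumᶜ (f ∘ suc))

  im-sumᶜ : ∀ {n} (f : Vector ℂ n) → im (sumᶜ f) ≡ sum (λ i → im (f i))
  im-sumᶜ {zero}  f = refl
  im-sumᶜ {suc n} f = cong (λ s → im (f zero) + s) (im-sumᶜ (f ∘ suc))

  fromℕ≈nat : ∀ n → fromℕ n ≈ nat n
  fromℕ≈nat n = RealFacts.≈-pointwise (fromℕ n) (nat n) (λ l → sym (fromℕ-seq n l))

  module _ {n} (A : Matrix n) where
    reᵐ imᵐ : Mat n n
    reᵐ i j = re (A i j)
    imᵐ i j = im (A i j)

    private
      AᴴA : Matrix n
      AᴴA = conjTranspose A *ᵐ A

    re-*ᵛ : ∀ v i → re ((AᴴA *ᵛ v) i)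
      ≡ sum (λ j → gramRe reᵐ imᵐ i j * re (v j) - gramIm reᵐ imᵐ i j * im (v j))
    re-*ᵛ v i = trans (re-sumᶜ (λ l → AᴴA i l *ᶜ v l)) (sum-cong-≗ (λ l →
      cong₂ (λ x y → x * re (v l) - y * im (v l))
        (re-sumᶜ (λ m → conj (A m i) *ᶜ A m l)) (im-sumᶜ (λ m → conj (A m i) *ᶜ A m l))))

    im-*ᵛ : ∀ v i → im ((AᴴA *ᵛ v) i)
      ≡ sum (λ j → gramRe reᵐ imᵐ i j * im (v j) + gramIm reᵐ imᵐ i j * re (v j))
    im-*ᵛ v i = trans (im-sumᶜ (λ l → AᴴA i l *ᶜ v l)) (sum-cong-≗ (λ l →
      cong₂ (λ x y → x * im (v l) + y * re (v l))
        (re-sumᶜ (λ m → conj (A m i) *ᶜ A m l)) (im-sumᶜ (λ m → conj (A m i) *ᶜ A m l))))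

    eigenvector⇒ : ∀ μ v → (∀ i → (AᴴA *ᵛ v) i ≈ᶜ fromℝ μ *ᶜ v i) →
      IsComplexEigenvector reᵐ imᵐ μ (re ∘ v) (im ∘ v)
    eigenvector⇒ μ v h i =
      subst (_≈ (μ * re (v i) - 0ℝ * im (v i))) (re-*ᵛ v i) (proj₁ (h i)) ,
      subst (_≈ (μ * im (v i) + 0ℝ * re (v i))) (im-*ᵛ v i) (proj₂ (h i))

    eigenvector⇐ : ∀ μ v → IsComplexEigenvector reᵐ imᵐ μ (re ∘ v) (im ∘ v) →
      ∀ i → (AᴴA *ᵛ v) i ≈ᶜ fromℝ μ *ᶜ v i
    eigenvector⇐ μ v h i =
      subst (_≈ (μ * re (v i) - 0ℝ * im (v i))) (sym (re-*ᵛ v i)) (proj₁ (h i)) ,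
      subst (_≈ (μ * im (v i) + 0ℝ * re (v i))) (sym (im-*ᵛ v i)) (proj₂ (h i))

  circ-entry : ∀ {n} r (a : ℕ → ℂ) (i j : Fin n) →
    circ r (a ∘ toℕ) i j ≡ circEntry n a (λ l → r *ᶜ a l) (toℕ i) (toℕ j)
  circ-entry {n} r a i j with toℕ i ℕ.≤? toℕ j
  ... | yes _ = cong a (Fin.toℕ-fromℕ< _)
  ... | no  _ = cong (λ l → r *ᶜ a l) (Fin.toℕ-fromℕ< _)

  module _ (k n : ℕ) (r : ℂ) where
    private
      a : ℕ → ℂ
      a l = fromℝ (fromℕ (P k l))
      q : ℕ → ℝ
      q l = nat (P k l)

    re-pellCirc : ∀ i j → re (pellCirc k n r i j)
      ≈ circEntry n q (λ l → re r * q l) (toℕ i) (toℕ j)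
    re-pellCirc i j = subst (λ z → re z ≈ circEntry n q (λ l → re r * q l) (toℕ i) (toℕ j))
      (sym (circ-entry r a i j))
      (circEntry-rel (λ z x → re z ≈ x) n {a} {λ l → r *ᶜ a l} {q} {λ l → re r * q l}
        (λ l → fromℕ≈nat (P k l))
        (λ l → R.trans {re r * fromℕ (P k l) - im r * 0ℝ} {re r * fromℕ (P k l)} {re r * q l}
          (RealFacts.≈-pointwise (re r * fromℕ (P k l) - im r * 0ℝ) (re r * fromℕ (P k l))
            (λ m → absorb (seq (re r) m ℚ.* (+ P k l ℚ./ 1)) (seq (im r) m)))
          (R.*-congˡ {re r} {fromℕ (P k l)} {q l} (fromℕ≈nat (P k l))))
        (toℕ i) (toℕ j))
      where
      absorb : ∀ x y → x ℚ.- y ℚ.* ℚ.0ℚ ≡ x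
      absorb x y = trans (cong (λ z → x ℚ.- z) (ℚ.*-zeroʳ y)) (ℚ.+-identityʳ x)

    im-pellCirc : ∀ i j → im (pellCirc k n r i j)
      ≈ circEntry n (λ _ → 0ℝ) (λ l → im r * q l) (toℕ i) (toℕ j)
    im-pellCirc i j = subst (λ z → im z ≈ circEntry n (λ _ → 0ℝ) (λ l → im r * q l) (toℕ i) (toℕ j))
      (sym (circ-entry r a i j))
      (circEntry-rel (λ z x → im z ≈ x) n {a} {λ l → r *ᶜ a l} {λ _ → 0ℝ} {λ l → im r * q l}
        (λ l → RealFacts.≈-refl 0ℝ)
        (λ l → R.trans {re r * 0ℝ + im r * fromℕ (P k l)} {im r * fromℕ (P k l)} {im r * q l}
          (RealFacts.≈-pointwise (re r * 0ℝ + im r * fromℕ (P k l)) (im r * fromℕ (P k l))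
            (λ m → absorb (seq (im r) m ℚ.* (+ P k l ℚ./ 1)) (seq (re r) m)))
          (R.*-congˡ {im r} {fromℕ (P k l)} {q l} (fromℕ≈nat (P k l))))
        (toℕ i) (toℕ j))
      where
      absorb : ∀ x y → y ℚ.* ℚ.0ℚ ℚ.+ x ≡ x
      absorb x y = trans (cong (ℚ._+ x) (ℚ.*-zeroʳ y)) (ℚ.+-identityˡ x)

  module _ (k n : ℕ) (r : ℂ) (ρ M S¹ S² W² n⁻¹ : ℝ) where
    private
      A = pellCirc k n r
      q : ℕ → ℝ
      q l = nat (P k l)

    circulantBounds : 0ℝ ≤ ρ → ρ * ρ ≈ re r * re r + im r * im r → ρ ≤ M → 1ℝ ≤ M →
      S¹ ≈ ∑< n q → S² ≈ ∑< n (λ l → q l * q l) → W² ≈ ∑< n (λ l → nat l * (q l * q l)) →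
      (∃ λ m → n ≡ suc m) → nat n * n⁻¹ ≈ 1ℝ → ∀ σ → IsSpectralNorm A σ →
      (√ (S² + (ρ * ρ - 1ℝ) * n⁻¹ * W²) ≤ σ) × (σ ≤ M * S¹)
    circulantBounds 0≤ρ ρ²≈ ρ≤M 1≤M S¹≈ S²≈ W²≈ (m , n≡1+m) nn⁻¹≈1 σ (μ , (eigenvalue , largest) ,
      σ≈√μ) =
      -- The two halves of `IsLargestEigenvalue` are split: maximality serves the lower bound, the
      -- eigenvector the upper one.
      lowerBound m n≡1+m n⁻¹ nn⁻¹≈1 σ μ σ≈√μ
        (λ ν ¬¬pair → largest ν (λ h → ¬¬pair (λ (a , b , nz , eig) →
          h ((λ i → a i +i b i) , nz , eigenvector⇐ A ν (λ i → a i +i b i) eig)))) ,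
      upperBound σ μ σ≈√μ
        (λ h → eigenvalue (λ (v , nz , eig) → h (re ∘ v , im ∘ v , nz , eigenvector⇒ A μ v eig)))
      where
      open CirculantNorm n (P k) (re r) (im r) ρ M 0≤ρ ρ²≈ ρ≤M 1≤M (reᵐ A) (imᵐ A)
        (re-pellCirc k n r) (im-pellCirc k n r) S¹ S² W² S¹≈ S²≈ W²≈

  module _ (k m : ℕ) where
    private
      n = suc m
      q : ℕ → ℝ
      q l = nat (P k l)

    S¹≈ : fromℕ (S¹ k m) ≈ ∑< n q
    S¹≈ = ∑<-nat m (P k) q {fromℕ (S¹ k m)} (fromℕ≈nat (S¹ k m)) (λ l → RealFacts.≈-refl (q l))

    S²≈ : fromℕ (S² k m) ≈ ∑< n (λ l → q l * q l)
    S²≈ = ∑<-nat m (λ l → P k l ℕ.^ 2) (λ l → q l * q l) {fromℕ (S² k m)} (fromℕ≈nat (S² k m))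
      (λ l → nat-² (P k l))

    W²≈ : fromℕ (W² k m) ≈ ∑< n (λ l → nat l * (q l * q l))
    W²≈ = ∑<-nat m (λ l → l ℕ.* P k l ℕ.^ 2) (λ l → nat l * (q l * q l)) {fromℕ (W² k m)}
      (fromℕ≈nat (W² k m))
      (λ l → R.trans {nat (l ℕ.* P k l ℕ.^ 2)} {nat l * nat (P k l ℕ.^ 2)} {nat l * (q l * q l)}
        (nat-* l (P k l ℕ.^ 2)) (R.*-congˡ {nat l} {nat (P k l ℕ.^ 2)} {q l * q l} (nat-² (P k l))))

  modulus-square : ∀ z → ∣ z ∣ * ∣ z ∣ ≈ re z * re z + im z * im z
  modulus-square z = RealFacts.√-square (re z * re z + im z * im z)
    (Order.0≤x+y {re z * re z} {im z * im z} (Order.0≤x² (re z)) (Order.0≤x² (im z)))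

theorem2 : ∀ (k n : ℕ) .{{_ : NonZero n}} → 1 ℕ.≤ k → 2 ℕ.≤ n →
    ∀ (r : ℂ) (σ : ℝ) → IsSpectralNorm (pellCirc k n r) σ →
    (√ (fromℕ (S² k (n ∸ 1)) + (∣ r ∣ * ∣ r ∣ - 1ℝ) / n * fromℕ (W² k (n ∸ 1))) ≤ σ)
    × (σ ≤ (∣ r ∣ ⊔ 1ℝ) * fromℕ (S¹ k (n ∸ 1)))
-- Division by `suc m` unfolds to multiplication by `unitFraction m`, so the general bounds have
-- literally the required form.
theorem2 k (suc m) _ _ r σ norm = circulantBounds k (suc m) r ∣ r ∣ (∣ r ∣ ⊔ 1ℝ)
  (fromℕ (S¹ k m)) (fromℕ (S² k m)) (fromℕ (W² k m)) (unitFraction m)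
  (RealFacts.0≤√ (re r * re r + im r * im r)) (modulus-square r)
  (RealFacts.x≤x⊔y ∣ r ∣ 1ℝ) (RealFacts.y≤x⊔y ∣ r ∣ 1ℝ)
  (S¹≈ k m) (S²≈ k m) (W²≈ k m) (m , refl)
  (CompleteOrderedField.unitFraction-* reals m) σ norm
  where open ComplexMatrices
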